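{- Let $q\ge 3$. The group $\tilde H_{2q}(\mathsf{M}_{5q+4};\mathbb{Z})$ contains an element of order $5$ if and only if there is a cycle $\gamma$ of type $[1,0]\wedge[3,1]\wedge[5,2]^q$ in $\tilde C_{2q}(\mathsf{M}_{5q+4};\mathbb{Z})$ whose homology class has order $5$ in $\tilde H_{2q}(\mathsf{M}_{5q+4};\mathbb{Z})$. If this is the case, then $\tilde H_{2q+u}(\mathsf{M}_{5q+4+2u};\mathbb{Z})$ contains an element of order $5$ for every $u\ge 0$.
   Context: For a finite set $S$, $\mathsf{M}[S]$ is the matching complex of the complete graph on $S$ (vertices: edges $ab=\{a,b\}$ of the complete graph on $S$; faces: matchings), and $\mathsf{M}_n=\mathsf{M}[[n]]$. $\tilde C$, $\tilde H$ denote reduced simplicial chains and homology; an oriented simplex is written $e_0\wedge\cdots\wedge e_d$. For chains $c$, $c'$ supported on matchings of disjoint vertex sets, $c\wedge c'$ is the bilinear extension of $(e_0\wedge\cdots\wedge e_a)\wedge(f_0\wedge\cdots\wedge f_b)=e_0\wedge\cdots\wedge e_a\wedge f_0\wedge\cdots\wedge f_b$. A cycle $z\in\tilde C_{d-1}(\mathsf{M}_n)$ with $d=d_1+\cdots+d_s$ has type $[n_1,d_1]\wedge\cdots\wedge[n_s,d_s]$ if there is a partition $[n]=S_1\cup\cdots\cup S_s$ with $|S_i|=n_i$ and cycles $z_i\in\tilde C_{d_i-1}(\mathsf{M}[S_i])$ with $z=z_1\wedge\cdots\wedge z_s$; here $\tilde C_{ -1}$ is spanned by the empty simplex, and $[n,d]^q$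 denotes $q$ copies of $[n,d]$ joined by $\wedge$. -}

module Defs where

open import Data.Bool using (Bool; true; false; if_then_else_; _∧_; not)
open import Data.Nat as ℕ using (ℕ; zero; suc; _+_; _*_; _<ᵇ_; _≡ᵇ_)
open import Data.Fin as Fin using (Fin; toℕ)
open import Data.Fin.Properties using (_≟_)
open import Data.Integer as ℤ using (ℤ; +_; -_)
open import Data.List using (List; []; _∷_; length; map; foldr; allFin; cartesianProduct; filterᵇ; lookup; replicate)
open import Data.List.Relation.Unary.All using (All)
open import Data.List.Relation.Unary.AllPairs using (AllPairs)
open import Data.List.Relation.Unary.Linked using (Linked)
open import Data.Product using (Σ; ∃; _×_; _,_; proj₁; proj₂)
open import Relation.Nullary using (¬_; does)
open import Relation.Binary.PropositionalEquality using (_≡_; _≢_)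
open import Data.Unit using (⊤)

-- Edges of the complete graph on [n] = Fin n are pairs (a , b) with a < b.
-- A (d-1)-simplex of M_n (a matching with d edges) is represented by the
-- list of its edges sorted strictly increasingly w.r.t. key (lex order).

Edge : ℕ → Set
Edge n = Fin n × Fin n

key : ∀ {n} → Edge n → ℕ
key {n} (a , b) = toℕ a * n + toℕ b

Disj : ∀ {n} → Edge n → Edge n → Set
Disj (a , b) (c , d) = a ≢ c × a ≢ d × b ≢ c × b ≢ d

IsMatching : (n m : ℕ) → List (Edge n) → Set
IsMatching n m σ =
  length σ ≡ m
  × All (λ e → toℕ (proj₁ e) ℕ.< toℕ (proj₂ e)) σ
  × Linked (λ e e' → key e ℕ.< key e') σ
  × AllPairs Disj σ

-- integral chains: coefficient of each canonical simplex (values on lists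
-- that are not canonical matchings of the relevant size are irrelevant)
Chain : ℕ → Set
Chain n = List (Edge n) → ℤ

sgn : ℕ → ℤ
sgn zero = + 1
sgn (suc k) = - sgn k

eqᵇ : ∀ {n} → Fin n → Fin n → Bool
eqᵇ x y = does (x ≟ y)

allᵇ : ∀ {A : Set} → (A → Bool) → List A → Bool
allᵇ p [] = true
allᵇ p (x ∷ xs) = p x ∧ allᵇ p xs

disjᵇ : ∀ {n} → Edge n → Edge n → Bool
disjᵇ (a , b) (c , d) = not (eqᵇ a c) ∧ not (eqᵇ a d) ∧ not (eqᵇ b c) ∧ not (eqᵇ b d)

addable : ∀ {n} → Edge n → List (Edge n) → Bool
addable (a , b) σ = (toℕ a <ᵇ toℕ b) ∧ allᵇ (disjᵇ (a , b)) σ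

ins : ∀ {n} → Edge n → List (Edge n) → List (Edge n)
ins e [] = e ∷ []
ins e (x ∷ xs) = if key e <ᵇ key x then e ∷ x ∷ xs else x ∷ ins e xs

pos : ∀ {n} → Edge n → List (Edge n) → ℕ
pos e [] = 0
pos e (x ∷ xs) = if key x <ᵇ key e then suc (pos e xs) else pos e xs

allEdges : (n : ℕ) → List (Edge n)
allEdges n = cartesianProduct (allFin n) (allFin n)

sumℤ : List ℤ → ℤ
sumℤ = foldr ℤ._+_ (+ 0)

prodℤ : List ℤ → ℤ
prodℤ = foldr ℤ._*_ (+ 1)

-- simplicial boundary: coefficient of σ in ∂c, i.e. sum over the cofaces
-- σ ∪ {e} = e_0 ∧ ... ∧ e_d (sorted, e = e_i) of (-1)^i c(σ ∪ {e})
∂ : ∀ {n} → Chain n → Chain n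
∂ {n} c σ = sumℤ (map (λ e → if addable e σ then sgn (pos e σ) ℤ.* c (ins e σ) else + 0) (allEdges n))

-- a chain in C̃_{m-1}(M_n) (m edges) is a cycle (∂ on C̃_{-1} is zero)
IsCycle : (n m : ℕ) → Chain n → Set
IsCycle n zero z = ⊤
IsCycle n (suc m) z = ∀ σ → IsMatching n m σ → ∂ z σ ≡ + 0

IsBoundary : (n m : ℕ) → Chain n → Set
IsBoundary n m z = Σ (Chain n) λ c → ∀ σ → IsMatching n m σ → ∂ c σ ≡ z σ

HasOrder5Class : (n m : ℕ) → Chain n → Set
HasOrder5Class n m z =
  IsCycle n m z × ¬ IsBoundary n m z × IsBoundary n m (λ σ → + 5 ℤ.* z σ)

-- H̃_k(M_n ; ℤ) contains an element of order 5 (k-simplices have k+1 edges)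
HasElemOrder5 : (n k : ℕ) → Set
HasElemOrder5 n k = Σ (Chain n) λ z → HasOrder5Class n (suc k) z

-- Types of cycles. A type [n_1,d_1] ∧ ... ∧ [n_s,d_s] is a list of pairs.

CycleType : Set
CycleType = List (ℕ × ℕ)

countᵇ : ∀ {A : Set} → (A → Bool) → List A → ℕ
countᵇ p xs = length (filterᵇ p xs)

blockSize : ∀ {n s} → (Fin n → Fin s) → Fin s → ℕ
blockSize {n} f i = countᵇ (λ x → eqᵇ (f x) i) (allFin n)

inBlock : ∀ {n s} → (Fin n → Fin s) → Fin s → Edge n → Bool
inBlock f i (a , b) = eqᵇ (f a) i ∧ eqᵇ (f b) i

restrict : ∀ {n s} → (Fin n → Fin s) → Fin s → List (Edge n) → List (Edge n)
restrict f i σ = filterᵇ (inBlock f i) σ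

inversions : List ℕ → ℕ
inversions [] = 0
inversions (x ∷ xs) = countᵇ (λ y → y <ᵇ x) xs + inversions xs

-- coefficient of (sorted) σ in z_1 ∧ ... ∧ z_s, where z_i has d_i edges,
-- the z_i live on the blocks of f and are concatenated in block order
wedge : ∀ {n} (ty : CycleType) → (Fin n → Fin (length ty)) →
        (Fin (length ty) → Chain n) → Chain n
wedge {n} ty f zs σ =
  if allᵇ (λ e → eqᵇ (f (proj₁ e)) (f (proj₂ e))) σ
     ∧ allᵇ (λ i → length (restrict f i σ) ≡ᵇ proj₂ (lookup ty i)) (allFin (length ty))
  then sgn (inversions (map (λ e → toℕ (f (proj₁ e))) σ))
       ℤ.* prodℤ (map (λ i → zs i (restrict f i σ)) (allFin (length ty)))
  else + 0

-- a chain with d edges is a chain of M[S_i] (S_i = block i of f):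
-- it vanishes on matchings not contained in S_i
SupportedIn : ∀ {n s} → (Fin n → Fin s) → Fin s → ℕ → Chain n → Set
SupportedIn {n} f i d c =
  ∀ τ → IsMatching n d τ → ¬ All (λ e → inBlock f i e ≡ true) τ → c τ ≡ + 0

sumℕ : List ℕ → ℕ
sumℕ = foldr _+_ 0

HasType : (n m : ℕ) → Chain n → CycleType → Set
HasType n m z ty =
  IsCycle n m z
  × sumℕ (map proj₂ ty) ≡ m
  × Σ (Fin n → Fin (length ty)) λ f →
      (∀ i → blockSize f i ≡ proj₁ (lookup ty i))
      × Σ (Fin (length ty) → Chain n) λ zs →
          (∀ i → SupportedIn f i (proj₂ (lookup ty i)) (zs i)
                 × IsCycle n (proj₂ (lookup ty i)) (zs i))
          × (∀ σ → IsMatching n m σ → z σ ≡ wedge ty f zs σ)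

type5 : ℕ → CycleType
type5 q = (1 , 0) ∷ (3 , 1) ∷ replicate q (5 , 2)

{-# OPTIONS --safe #-}
module Submission where

-- Away from the primes 2 and 3, three identities govern the homology near the line d = (2n - 8) / 5: two factors [3,1]
-- can be traded for [1,0] ∧ [5,2], they cancel in the presence of a further vertex, and a class 1s ∧ 2t ∧ [1,0] ∧ c lifts
-- to [5,2] ∧ c.  Together with the exact sequence that separates the matchings covering two fixed vertices by two
-- different edges, they give by induction on n that H̃_{2q}(M_{5q+4}) is generated by cycles of type [1,0] ∧ [3,1] ∧ [5,2]^q.
-- These form one orbit of the symmetric group, so if some class has order 5, the representative γ₀ is not killed by
-- powers of 6.
--
-- That 5 γ₀ vanishes up to a power of 6 comes from a chain homotopy: in M[S ∪ {p}] the sum of the transpositions (p s),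
-- s ∈ S, annihilates every cycle of M[S].  Applied to the blocks A = [1,0] ∪ [3,1], B and C of γ₀, it shows for a vertex c
-- of C that X = ∑_{b ∈ B} (c b) kills γ₀, while expanding X² with the same relations gives 5 γ₀.
--
-- The argument for 5 γ₀ uses only two of the factors [5,2]; since q ≥ 3, a third one may be replaced by the fundamental
-- cycle of a chessboard complex M_{u+2,u+3}, and removing u edges by taking links leads back to γ₀.

open import Defs
open import Data.Bool using (Bool; true; false; if_then_else_; _∧_; _∨_; not; T)
import Data.Bool.Properties as 𝔹ₚ
open import Data.Fin as Fin using (Fin; toℕ; zero; suc)
import Data.Fin.Properties as Fₚ
open import Data.Nat as ℕ using (ℕ; zero; suc; _+_; _*_; _≤_; _<_; z≤n; s≤s; _<ᵇ_; _≡ᵇ_)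
import Data.Nat.Properties as ℕₚ
open import Data.Integer as ℤ using (ℤ; +_; -[1+_]; -_; 0ℤ; 1ℤ; -1ℤ)
import Data.Integer.Properties as ℤₚ
open import Data.Integer.Tactic.RingSolver using (solve-∀)
open import Data.List using (List; []; _∷_; _++_; map; length; filter; upTo; allFin)
open import Data.List.Properties as Lₚ using (++-assoc; map-++; map-cong)
open import Data.List.Membership.DecPropositional ℕ._≟_ using (_∈?_)
open import Data.List.Membership.Propositional using (_∈_; _∉_)
open import Data.List.Membership.Propositional.Properties using (∈-upTo⁻; ∈-upTo⁺; ∈-map⁺; ∈-map⁻; ∈-++⁺ˡ; ∈-++⁺ʳ; ∈-++⁻; ∈-cartesianProduct⁺; ∈-cartesianProduct⁻; ∈-cartesianProductWith⁺; ∈-allFin; ∈-filter⁺; ∈-filter⁻)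
open import Data.List.Relation.Unary.All as All using (All; []; _∷_)
open import Data.List.Relation.Unary.AllPairs as AllPairs using (AllPairs; []; _∷_)
open import Data.List.Relation.Unary.Any using (here; there)
import Data.List.Relation.Unary.Linked as Linked
import Data.List.Relation.Unary.Linked.Properties as Linkedₚ
open import Data.List.Relation.Unary.Unique.Propositional using (Unique)
import Data.List.Relation.Unary.Unique.Propositional.Properties as UP
open import Data.Product using (Σ; _×_; _,_; proj₁; proj₂)
open import Data.Sum using (_⊎_; inj₁; inj₂; [_,_])
open import Data.Empty using (⊥; ⊥-elim)
open import Data.Unit using (tt)
open import Function using (_∘_; id; case_of_)
open import Function.Bundles using (_⇔_; mk⇔)
open import Relation.Binary.Definitions using (tri<; tri≈; tri>)
open import Relation.Binary.PropositionalEquality using (_≡_; _≢_; refl; sym; trans; cong; cong₂; subst; ≢-sym; module ≡-Reasoning)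
open import Relation.Nullary using (¬_; Dec; yes; no; does; contradiction; ¬?; _×-dec_; _⊎-dec_)
import Relation.Nullary.Decidable as Dec

-- Formal chains

-- Inverting 6 loses nothing at the prime 5. Since 6 is 1 modulo 5, powers of 6 fix every class of
-- order 5, and a scalar 6^m is absorbed by the factor [1,0], whose cycles are the integer multiples
-- of the empty simplex. For d edges on n vertices the generation argument is governed by 5d - 2n,
-- which is -3 in the theorem. Splitting off [3,1] raises this number, and the recursion would climb
-- without end. The relations behind 5 γ₀ concern Jucys-Murphy elements. With 6 inverted, the
-- transpositions that move one vertex of the pentagon in [1,0] ∧ [3,1] ∧ [5,2] sum to zero, while
-- on [5,2] alone the analogous sum has square 4. The coefficient 5 is the number of vertices of the
-- block B.

E : Set
E = ℕ × ℕ

flipE : E → E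
flipE (a , b) = b , a

Fn : Set
Fn = List E → ℤ

record Alt (φ : Fn) : Set where
  field
    swap : ∀ σ s t τ → φ (σ ++ s ∷ t ∷ τ) ≡ - φ (σ ++ t ∷ s ∷ τ)
    flip : ∀ σ t τ → φ (σ ++ t ∷ τ) ≡ φ (σ ++ flipE t ∷ τ)
open Alt

Alt-∷ : ∀ {φ} → Alt φ → ∀ e → Alt (φ ∘ (e ∷_))
Alt-∷ A e .swap σ = swap A (e ∷ σ)
Alt-∷ A e .flip σ = flip A (e ∷ σ)

infixr 6 _▷_
infixl 5 _⊕_
infixr 7 _⊙_

-- e ▷ a stands for e ∧ a.  Instead of passing to a quotient, two chains are identified (_≈_) when all
-- functions of lists of edges that are alternating and blind to the orientation of edges agree on them.
data Ch : Set where
  𝟎 vac : Ch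
  _▷_ : E → Ch → Ch
  _⊕_ : Ch → Ch → Ch
  _⊙_ : ℤ → Ch → Ch

⊖_ : Ch → Ch
⊖ a = -1ℤ ⊙ a
infix 8 ⊖_

⟨_∣_⟩ : Ch → Fn → ℤ
⟨ 𝟎 ∣ φ ⟩ = 0ℤ
⟨ vac ∣ φ ⟩ = φ []
⟨ e ▷ a ∣ φ ⟩ = ⟨ a ∣ φ ∘ (e ∷_) ⟩
⟨ a ⊕ b ∣ φ ⟩ = ⟨ a ∣ φ ⟩ ℤ.+ ⟨ b ∣ φ ⟩
⟨ k ⊙ a ∣ φ ⟩ = k ℤ.* ⟨ a ∣ φ ⟩

infix 3 _≈_
record _≈_ (a b : Ch) : Set where
  constructor mk
  field at : ∀ φ → Alt φ → ⟨ a ∣ φ ⟩ ≡ ⟨ b ∣ φ ⟩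
open _≈_

≈-refl : ∀ {a} → a ≈ a
≈-refl .at φ A = refl

≈-sym : ∀ {a b} → a ≈ b → b ≈ a
≈-sym p .at φ A = sym (p .at φ A)

≈-trans : ∀ {a b c} → a ≈ b → b ≈ c → a ≈ c
≈-trans p q .at φ A = trans (p .at φ A) (q .at φ A)

≡⇒≈ : ∀ {a b} → a ≡ b → a ≈ b
≡⇒≈ refl = ≈-refl

infixr 2 _≈⟨_⟩_ _≈⟨_⟨_
infix 3 _∎≈
_≈⟨_⟩_ : ∀ a {b c} → a ≈ b → b ≈ c → a ≈ c
a ≈⟨ p ⟩ q = ≈-trans p q
_≈⟨_⟨_ : ∀ a {b c} → b ≈ a → b ≈ c → a ≈ c
a ≈⟨ p ⟨ q = ≈-trans (≈-sym p) q
_∎≈ : ∀ a → a ≈ a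
a ∎≈ = ≈-refl

⊕-cong : ∀ {a b c d} → a ≈ b → c ≈ d → a ⊕ c ≈ b ⊕ d
⊕-cong p q .at φ A = cong₂ ℤ._+_ (p .at φ A) (q .at φ A)

⊙-cong : ∀ k {a b} → a ≈ b → k ⊙ a ≈ k ⊙ b
⊙-cong k p .at φ A = cong (k ℤ.*_) (p .at φ A)

▷-cong : ∀ e {a b} → a ≈ b → e ▷ a ≈ e ▷ b
▷-cong e p .at φ A = p .at _ (Alt-∷ A e)

pair-ext : ∀ a {φ ψ} → (∀ σ → φ σ ≡ ψ σ) → ⟨ a ∣ φ ⟩ ≡ ⟨ a ∣ ψ ⟩
pair-ext 𝟎 p = refl
pair-ext vac p = p []
pair-ext (e ▷ a) p = pair-ext a (p ∘ (e ∷_))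
pair-ext (a ⊕ b) p = cong₂ ℤ._+_ (pair-ext a p) (pair-ext b p)
pair-ext (k ⊙ a) p = cong (k ℤ.*_) (pair-ext a p)

pair-lin : ∀ a k m {φ ψ} → ⟨ a ∣ (λ σ → k ℤ.* φ σ ℤ.+ m ℤ.* ψ σ) ⟩ ≡ k ℤ.* ⟨ a ∣ φ ⟩ ℤ.+ m ℤ.* ⟨ a ∣ ψ ⟩
pair-lin 𝟎 k m = lem k m
  where lem : ∀ k m → 0ℤ ≡ k ℤ.* 0ℤ ℤ.+ m ℤ.* 0ℤ
        lem = solve-∀
pair-lin vac k m = refl
pair-lin (e ▷ a) k m = pair-lin a k m
pair-lin (a ⊕ b) k m {φ} {ψ} = trans (cong₂ ℤ._+_ (pair-lin a k m) (pair-lin b k m)) (lem k m ⟨ a ∣ φ ⟩ ⟨ a ∣ ψ ⟩ ⟨ b ∣ φ ⟩ ⟨ b ∣ ψ ⟩)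
  where lem : ∀ k m x y z w → (k ℤ.* x ℤ.+ m ℤ.* y) ℤ.+ (k ℤ.* z ℤ.+ m ℤ.* w) ≡ k ℤ.* (x ℤ.+ z) ℤ.+ m ℤ.* (y ℤ.+ w)
        lem = solve-∀
pair-lin (n ⊙ a) k m {φ} {ψ} = trans (cong (n ℤ.*_) (pair-lin a k m)) (lem k m n ⟨ a ∣ φ ⟩ ⟨ a ∣ ψ ⟩)
  where lem : ∀ k m n x y → n ℤ.* (k ℤ.* x ℤ.+ m ℤ.* y) ≡ k ℤ.* (n ℤ.* x) ℤ.+ m ℤ.* (n ℤ.* y)
        lem = solve-∀

pair-neg : ∀ a {φ ψ} → (∀ σ → φ σ ≡ - ψ σ) → ⟨ a ∣ φ ⟩ ≡ - ⟨ a ∣ ψ ⟩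
pair-neg a {φ} {ψ} p = begin
  ⟨ a ∣ φ ⟩                              ≡⟨ pair-ext a (λ σ → trans (p σ) (lem (ψ σ))) ⟩
  ⟨ a ∣ (λ σ → 0ℤ ℤ.* ψ σ ℤ.+ -1ℤ ℤ.* ψ σ) ⟩  ≡⟨ pair-lin a 0ℤ -1ℤ {ψ} {ψ} ⟩
  0ℤ ℤ.* ⟨ a ∣ ψ ⟩ ℤ.+ -1ℤ ℤ.* ⟨ a ∣ ψ ⟩       ≡⟨ sym (lem ⟨ a ∣ ψ ⟩) ⟩
  - ⟨ a ∣ ψ ⟩ ∎
  where
  open ≡-Reasoning
  lem : ∀ x → - x ≡ 0ℤ ℤ.* x ℤ.+ -1ℤ ℤ.* x
  lem = solve-∀

▷-swap : ∀ s t a → s ▷ t ▷ a ≈ ⊖ (t ▷ s ▷ a)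
▷-swap s t a .at φ A = trans (pair-neg a (swap A [] s t)) (sym (ℤₚ.-1*i≡-i _))

▷-flip : ∀ t a → t ▷ a ≈ flipE t ▷ a
▷-flip t a .at φ A = pair-ext a (flip A [] t)

FlipInv : (E → ℤ) → Set
FlipInv w = ∀ t → w t ≡ w (flipE t)

-- Every antiderivation below is D w for some weight w: the boundary is the weight 1,
-- the link of the edge e the indicator of e.
D : (E → ℤ) → Ch → Ch
D w 𝟎 = 𝟎
D w vac = 𝟎
D w (t ▷ a) = w t ⊙ a ⊕ ⊖ (t ▷ D w a)
D w (a ⊕ b) = D w a ⊕ D w b
D w (k ⊙ a) = k ⊙ D w a

-- The transpose of `D w`. Since `≈` is tested on alternating functions, `D w` respects it as soon
-- as `δ w` preserves `Alt`.
δ : (E → ℤ) → Fn → Fn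
δ w φ [] = 0ℤ
δ w φ (t ∷ σ) = w t ℤ.* φ σ ℤ.+ -1ℤ ℤ.* δ w (φ ∘ (t ∷_)) σ

D-adj : ∀ w a φ → ⟨ D w a ∣ φ ⟩ ≡ ⟨ a ∣ δ w φ ⟩
D-adj w 𝟎 φ = refl
D-adj w vac φ = refl
D-adj w (t ▷ a) φ = trans (cong (λ x → w t ℤ.* ⟨ a ∣ φ ⟩ ℤ.+ -1ℤ ℤ.* x) (D-adj w a _)) (sym (pair-lin a (w t) -1ℤ))
D-adj w (a ⊕ b) φ = cong₂ ℤ._+_ (D-adj w a φ) (D-adj w b φ)
D-adj w (k ⊙ a) φ = cong (k ℤ.*_) (D-adj w a φ)

δ-ext : ∀ w {φ ψ} → (∀ σ → φ σ ≡ ψ σ) → ∀ σ → δ w φ σ ≡ δ w ψ σ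
δ-ext w p [] = refl
δ-ext w p (t ∷ σ) = cong₂ (λ x y → w t ℤ.* x ℤ.+ -1ℤ ℤ.* y) (p σ) (δ-ext w (p ∘ (t ∷_)) σ)

δ-neg : ∀ w {φ ψ} → (∀ σ → φ σ ≡ - ψ σ) → ∀ σ → δ w φ σ ≡ - δ w ψ σ
δ-neg w p [] = refl
δ-neg w {φ} {ψ} p (t ∷ σ) = trans (cong₂ (λ x y → w t ℤ.* x ℤ.+ -1ℤ ℤ.* y) (p σ) (δ-neg w (p ∘ (t ∷_)) σ)) (lem (w t) (ψ σ) _)
  where lem : ∀ a b c → a ℤ.* - b ℤ.+ -1ℤ ℤ.* - c ≡ - (a ℤ.* b ℤ.+ -1ℤ ℤ.* c)
        lem = solve-∀

δ-swap : ∀ w {φ} → Alt φ → ∀ σ s t τ → δ w φ (σ ++ s ∷ t ∷ τ) ≡ - δ w φ (σ ++ t ∷ s ∷ τ)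
δ-swap w {φ} A [] s t τ = trans (cong (λ y → w s ℤ.* φ (t ∷ τ) ℤ.+ -1ℤ ℤ.* (w t ℤ.* φ (s ∷ τ) ℤ.+ -1ℤ ℤ.* y)) (δ-neg w (swap A [] s t) τ)) (lem (w s) (w t) (φ (t ∷ τ)) (φ (s ∷ τ)) _)
  where lem : ∀ a b x y z → a ℤ.* x ℤ.+ -1ℤ ℤ.* (b ℤ.* y ℤ.+ -1ℤ ℤ.* - z) ≡ - (b ℤ.* y ℤ.+ -1ℤ ℤ.* (a ℤ.* x ℤ.+ -1ℤ ℤ.* z))
        lem = solve-∀
δ-swap w {φ} A (u ∷ σ) s t τ = trans (cong₂ (λ x y → w u ℤ.* x ℤ.+ -1ℤ ℤ.* y) (swap A σ s t τ) (δ-swap w (Alt-∷ A u) σ s t τ)) (lem (w u) (φ (σ ++ t ∷ s ∷ τ)) _)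
  where lem : ∀ a b c → a ℤ.* - b ℤ.+ -1ℤ ℤ.* - c ≡ - (a ℤ.* b ℤ.+ -1ℤ ℤ.* c)
        lem = solve-∀

δ-flip : ∀ {w} → FlipInv w → ∀ {φ} → Alt φ → ∀ σ t τ → δ w φ (σ ++ t ∷ τ) ≡ δ w φ (σ ++ flipE t ∷ τ)
δ-flip {w} W {φ} A [] t τ = cong₂ (λ x y → x ℤ.* φ τ ℤ.+ -1ℤ ℤ.* y) (W t) (δ-ext w (flip A [] t) τ)
δ-flip {w} W {φ} A (u ∷ σ) t τ = cong₂ (λ x y → w u ℤ.* x ℤ.+ -1ℤ ℤ.* y) (flip A σ t τ) (δ-flip W (Alt-∷ A u) σ t τ)

Alt-δ : ∀ {w} → FlipInv w → ∀ {φ} → Alt φ → Alt (δ w φ)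
Alt-δ {w} W A .swap = δ-swap w A
Alt-δ W A .flip = δ-flip W A

D-cong : ∀ {w} → FlipInv w → ∀ {a b} → a ≈ b → D w a ≈ D w b
D-cong {w} W {a} {b} p .at φ A = trans (D-adj w a φ) (trans (p .at _ (Alt-δ W A)) (sym (D-adj w b φ)))

-- Contractions anticommute whatever their weights. This one identity yields that ∂∂ vanishes, that
-- links of cycles are cycles, and the sign for exchanging two linked edges.
D-anti : ∀ w v a → D w (D v a) ≈ ⊖ D v (D w a)
D-anti w v 𝟎 .at φ A = refl
D-anti w v vac .at φ A = refl
D-anti w v (t ▷ a) .at φ A = trans (cong (λ x → v t ℤ.* ⟨ D w a ∣ φ ⟩ ℤ.+ -1ℤ ℤ.* (w t ℤ.* ⟨ D v a ∣ φ ⟩ ℤ.+ -1ℤ ℤ.* x)) (D-anti w v a .at _ (Alt-∷ A t))) (lem (w t) (v t) ⟨ D w a ∣ φ ⟩ ⟨ D v a ∣ φ ⟩ _)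
  where lem : ∀ w v x y z → v ℤ.* x ℤ.+ -1ℤ ℤ.* (w ℤ.* y ℤ.+ -1ℤ ℤ.* (-1ℤ ℤ.* z)) ≡ -1ℤ ℤ.* (w ℤ.* y ℤ.+ -1ℤ ℤ.* (v ℤ.* x ℤ.+ -1ℤ ℤ.* z))
        lem = solve-∀
D-anti w v (a ⊕ b) .at φ A = trans (cong₂ ℤ._+_ (D-anti w v a .at φ A) (D-anti w v b .at φ A)) (sym (ℤₚ.*-distribˡ-+ -1ℤ ⟨ D v (D w a) ∣ φ ⟩ ⟨ D v (D w b) ∣ φ ⟩))
D-anti w v (k ⊙ a) .at φ A = trans (cong (k ℤ.*_) (D-anti w v a .at φ A)) (lem k ⟨ D v (D w a) ∣ φ ⟩)
  where lem : ∀ k x → k ℤ.* (-1ℤ ℤ.* x) ≡ -1ℤ ℤ.* (k ℤ.* x)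
        lem = solve-∀

-- With a weight that takes only the values 0 and 1 this discards the simplices containing a
-- forbidden edge; `K` arises in this way.
M : (E → ℤ) → Ch → Ch
M w 𝟎 = 𝟎
M w vac = vac
M w (t ▷ a) = w t ⊙ (t ▷ M w a)
M w (a ⊕ b) = M w a ⊕ M w b
M w (k ⊙ a) = k ⊙ M w a

μ : (E → ℤ) → List E → ℤ
μ w [] = 1ℤ
μ w (t ∷ σ) = w t ℤ.* μ w σ

pair-scal : ∀ a k {φ} → ⟨ a ∣ (λ σ → k ℤ.* φ σ) ⟩ ≡ k ℤ.* ⟨ a ∣ φ ⟩
pair-scal a k {φ} = trans (pair-ext a (λ σ → lem k (φ σ))) (trans (pair-lin a k 0ℤ {φ} {φ}) (sym (lem k ⟨ a ∣ φ ⟩)))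
  where lem : ∀ k x → k ℤ.* x ≡ k ℤ.* x ℤ.+ 0ℤ ℤ.* x
        lem = solve-∀

M-adj : ∀ w a φ → ⟨ M w a ∣ φ ⟩ ≡ ⟨ a ∣ (λ σ → μ w σ ℤ.* φ σ) ⟩
M-adj w 𝟎 φ = refl
M-adj w vac φ = sym (ℤₚ.*-identityˡ _)
M-adj w (t ▷ a) φ = trans (cong (w t ℤ.*_) (M-adj w a _)) (trans (sym (pair-scal a (w t))) (pair-ext a (λ σ → sym (ℤₚ.*-assoc (w t) (μ w σ) (φ (t ∷ σ))))))
M-adj w (a ⊕ b) φ = cong₂ ℤ._+_ (M-adj w a φ) (M-adj w b φ)
M-adj w (k ⊙ a) φ = cong (k ℤ.*_) (M-adj w a φ)

μ-++ : ∀ w σ τ → μ w (σ ++ τ) ≡ μ w σ ℤ.* μ w τ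
μ-++ w [] τ = sym (ℤₚ.*-identityˡ _)
μ-++ w (t ∷ σ) τ = trans (cong (w t ℤ.*_) (μ-++ w σ τ)) (sym (ℤₚ.*-assoc (w t) (μ w σ) (μ w τ)))

Alt-μ : ∀ {w} → FlipInv w → ∀ {φ} → Alt φ → Alt (λ σ → μ w σ ℤ.* φ σ)
Alt-μ {w} W {φ} A .swap σ s t τ = trans (cong₂ ℤ._*_ (trans (μ-++ w σ _) (trans (cong (μ w σ ℤ.*_) (lem (w s) (w t) (μ w τ))) (sym (μ-++ w σ _)))) (swap A σ s t τ)) (sym (ℤₚ.neg-distribʳ-* (μ w (σ ++ t ∷ s ∷ τ)) _))
  where lem : ∀ a b c → a ℤ.* (b ℤ.* c) ≡ b ℤ.* (a ℤ.* c)
        lem = solve-∀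
Alt-μ {w} W {φ} A .flip σ t τ = cong₂ ℤ._*_ (trans (μ-++ w σ _) (trans (cong (λ x → μ w σ ℤ.* (x ℤ.* μ w τ)) (W t)) (sym (μ-++ w σ _)))) (flip A σ t τ)

M-cong : ∀ {w} → FlipInv w → ∀ {a b} → a ≈ b → M w a ≈ M w b
M-cong {w} W {a} {b} p .at φ A = trans (M-adj w a φ) (trans (p .at _ (Alt-μ W A)) (sym (M-adj w b φ)))

mapE : (ℕ → ℕ) → E → E
mapE f (a , b) = f a , f b

mapC : (ℕ → ℕ) → Ch → Ch
mapC f 𝟎 = 𝟎
mapC f vac = vac
mapC f (e ▷ a) = mapE f e ▷ mapC f a
mapC f (a ⊕ b) = mapC f a ⊕ mapC f b
mapC f (k ⊙ a) = k ⊙ mapC f a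

mapC-adj : ∀ f a φ → ⟨ mapC f a ∣ φ ⟩ ≡ ⟨ a ∣ φ ∘ map (mapE f) ⟩
mapC-adj f 𝟎 φ = refl
mapC-adj f vac φ = refl
mapC-adj f (e ▷ a) φ = mapC-adj f a _
mapC-adj f (a ⊕ b) φ = cong₂ ℤ._+_ (mapC-adj f a φ) (mapC-adj f b φ)
mapC-adj f (k ⊙ a) φ = cong (k ℤ.*_) (mapC-adj f a φ)

Alt-map : ∀ f {φ} → Alt φ → Alt (φ ∘ map (mapE f))
Alt-map f {φ} A .swap σ s t τ = trans (cong φ (map-++ (mapE f) σ _)) (trans (swap A (map (mapE f) σ) _ _ _) (cong (-_ ∘ φ) (sym (map-++ (mapE f) σ _))))
Alt-map f {φ} A .flip σ t τ = trans (cong φ (map-++ (mapE f) σ _)) (trans (flip A (map (mapE f) σ) _ _) (cong φ (sym (map-++ (mapE f) σ _))))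

mapC-cong : ∀ f {a b} → a ≈ b → mapC f a ≈ mapC f b
mapC-cong f {a} {b} p .at φ A = trans (mapC-adj f a φ) (trans (p .at _ (Alt-map f A)) (sym (mapC-adj f b φ)))

mapC-∘ : ∀ f g a → mapC f (mapC g a) ≡ mapC (f ∘ g) a
mapC-∘ f g 𝟎 = refl
mapC-∘ f g vac = refl
mapC-∘ f g (e ▷ a) = cong (_ ▷_) (mapC-∘ f g a)
mapC-∘ f g (a ⊕ b) = cong₂ _⊕_ (mapC-∘ f g a) (mapC-∘ f g b)
mapC-∘ f g (k ⊙ a) = cong (k ⊙_) (mapC-∘ f g a)

mapC-ext : ∀ {f g} → (∀ x → f x ≡ g x) → ∀ a → mapC f a ≡ mapC g a
mapC-ext p 𝟎 = refl
mapC-ext p vac = refl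
mapC-ext p ((x , y) ▷ a) = cong₂ _▷_ (cong₂ _,_ (p x) (p y)) (mapC-ext p a)
mapC-ext p (a ⊕ b) = cong₂ _⊕_ (mapC-ext p a) (mapC-ext p b)
mapC-ext p (k ⊙ a) = cong (k ⊙_) (mapC-ext p a)

∂ₑ : Ch → Ch
∂ₑ = D (λ _ → 1ℤ)

∂-cong : ∀ {a b} → a ≈ b → ∂ₑ a ≈ ∂ₑ b
∂-cong = D-cong (λ _ → refl)

mapC-∂ : ∀ f a → mapC f (∂ₑ a) ≡ ∂ₑ (mapC f a)
mapC-∂ f 𝟎 = refl
mapC-∂ f vac = refl
mapC-∂ f (e ▷ a) = cong (λ x → 1ℤ ⊙ mapC f a ⊕ ⊖ (mapE f e ▷ x)) (mapC-∂ f a)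
mapC-∂ f (a ⊕ b) = cong₂ _⊕_ (mapC-∂ f a) (mapC-∂ f b)
mapC-∂ f (k ⊙ a) = cong (k ⊙_) (mapC-∂ f a)

infixr 6 _⋀_
_⋀_ : Ch → Ch → Ch
𝟎 ⋀ b = 𝟎
vac ⋀ b = b
(e ▷ a) ⋀ b = e ▷ (a ⋀ b)
(a ⊕ c) ⋀ b = (a ⋀ b) ⊕ (c ⋀ b)
(k ⊙ a) ⋀ b = k ⊙ (a ⋀ b)

⋀-adj : ∀ a b φ → ⟨ a ⋀ b ∣ φ ⟩ ≡ ⟨ a ∣ (λ σ → ⟨ b ∣ (λ τ → φ (σ ++ τ)) ⟩) ⟩
⋀-adj 𝟎 b φ = refl
⋀-adj vac b φ = refl
⋀-adj (e ▷ a) b φ = ⋀-adj a b _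
⋀-adj (a ⊕ c) b φ = cong₂ ℤ._+_ (⋀-adj a b φ) (⋀-adj c b φ)
⋀-adj (k ⊙ a) b φ = cong (k ℤ.*_) (⋀-adj a b φ)

Alt-⋀ : ∀ b {φ} → Alt φ → Alt (λ σ → ⟨ b ∣ (λ τ → φ (σ ++ τ)) ⟩)
Alt-⋀ b {φ} A .swap σ s t τ = pair-neg b λ ρ → trans (cong φ (++-assoc σ _ ρ)) (trans (swap A σ s t (τ ++ ρ)) (cong (-_ ∘ φ) (sym (++-assoc σ _ ρ))))
Alt-⋀ b {φ} A .flip σ t τ = pair-ext b λ ρ → trans (cong φ (++-assoc σ _ ρ)) (trans (flip A σ t (τ ++ ρ)) (cong φ (sym (++-assoc σ _ ρ))))

⋀-congˡ : ∀ {a a'} b → a ≈ a' → a ⋀ b ≈ a' ⋀ b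
⋀-congˡ {a} {a'} b p .at φ A = trans (⋀-adj a b φ) (trans (p .at _ (Alt-⋀ b A)) (sym (⋀-adj a' b φ)))

⋀-congʳ : ∀ a {b b'} → b ≈ b' → a ⋀ b ≈ a ⋀ b'
⋀-congʳ 𝟎 p = ≈-refl
⋀-congʳ vac p = p
⋀-congʳ (e ▷ a) p = ▷-cong e (⋀-congʳ a p)
⋀-congʳ (a ⊕ c) p = ⊕-cong (⋀-congʳ a p) (⋀-congʳ c p)
⋀-congʳ (k ⊙ a) p = ⊙-cong k (⋀-congʳ a p)

⋀-assoc : ∀ a b c → (a ⋀ b) ⋀ c ≡ a ⋀ (b ⋀ c)
⋀-assoc 𝟎 b c = refl
⋀-assoc vac b c = refl
⋀-assoc (e ▷ a) b c = cong (e ▷_) (⋀-assoc a b c)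
⋀-assoc (a ⊕ a') b c = cong₂ _⊕_ (⋀-assoc a b c) (⋀-assoc a' b c)
⋀-assoc (k ⊙ a) b c = cong (k ⊙_) (⋀-assoc a b c)

mapC-⋀ : ∀ f a b → mapC f (a ⋀ b) ≡ mapC f a ⋀ mapC f b
mapC-⋀ f 𝟎 b = refl
mapC-⋀ f vac b = refl
mapC-⋀ f (e ▷ a) b = cong (_ ▷_) (mapC-⋀ f a b)
mapC-⋀ f (a ⊕ c) b = cong₂ _⊕_ (mapC-⋀ f a b) (mapC-⋀ f c b)
mapC-⋀ f (k ⊙ a) b = cong (k ⊙_) (mapC-⋀ f a b)

⊕-idʳ : ∀ {a} → a ⊕ 𝟎 ≈ a
⊕-idʳ .at φ A = ℤₚ.+-identityʳ _

⊕-idˡ : ∀ {a} → 𝟎 ⊕ a ≈ a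
⊕-idˡ .at φ A = ℤₚ.+-identityˡ _

⊕-comm : ∀ a b → a ⊕ b ≈ b ⊕ a
⊕-comm a b .at φ A = ℤₚ.+-comm ⟨ a ∣ φ ⟩ _

⊕-assoc : ∀ a b c → (a ⊕ b) ⊕ c ≈ a ⊕ (b ⊕ c)
⊕-assoc a b c .at φ A = ℤₚ.+-assoc ⟨ a ∣ φ ⟩ _ _

⊕-inter : ∀ a b c d → (a ⊕ b) ⊕ (c ⊕ d) ≈ (a ⊕ c) ⊕ (b ⊕ d)
⊕-inter a b c d .at φ A = lem ⟨ a ∣ φ ⟩ ⟨ b ∣ φ ⟩ ⟨ c ∣ φ ⟩ ⟨ d ∣ φ ⟩
  where lem : ∀ a b c d → (a ℤ.+ b) ℤ.+ (c ℤ.+ d) ≡ (a ℤ.+ c) ℤ.+ (b ℤ.+ d)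
        lem = solve-∀

⊕-inv : ∀ a → a ⊕ ⊖ a ≈ 𝟎
⊕-inv a .at φ A = lem ⟨ a ∣ φ ⟩
  where lem : ∀ a → a ℤ.+ -1ℤ ℤ.* a ≡ 0ℤ
        lem = solve-∀

⊕-undo : ∀ a b → (a ⊕ ⊖ b) ⊕ b ≈ a
⊕-undo a b .at φ A = lem ⟨ a ∣ φ ⟩ ⟨ b ∣ φ ⟩
  where lem : ∀ a b → (a ℤ.+ -1ℤ ℤ.* b) ℤ.+ b ≡ a
        lem = solve-∀

⊙-zeroʳ : ∀ k → k ⊙ 𝟎 ≈ 𝟎
⊙-zeroʳ k .at φ A = ℤₚ.*-zeroʳ k

⊙-zeroˡ : ∀ a → 0ℤ ⊙ a ≈ 𝟎
⊙-zeroˡ a .at φ A = ℤₚ.*-zeroˡ ⟨ a ∣ φ ⟩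

⊙-idˡ : ∀ a → 1ℤ ⊙ a ≈ a
⊙-idˡ a .at φ A = ℤₚ.*-identityˡ ⟨ a ∣ φ ⟩

⊙-assoc : ∀ k m a → k ⊙ m ⊙ a ≈ (k ℤ.* m) ⊙ a
⊙-assoc k m a .at φ A = sym (ℤₚ.*-assoc k m ⟨ a ∣ φ ⟩)

⊙-distˡ : ∀ k a b → k ⊙ (a ⊕ b) ≈ k ⊙ a ⊕ k ⊙ b
⊙-distˡ k a b .at φ A = ℤₚ.*-distribˡ-+ k ⟨ a ∣ φ ⟩ ⟨ b ∣ φ ⟩

▷-⊕ : ∀ e a b → e ▷ (a ⊕ b) ≈ e ▷ a ⊕ e ▷ b
▷-⊕ e a b .at φ A = refl

▷-⊙ : ∀ e k a → e ▷ (k ⊙ a) ≈ k ⊙ (e ▷ a)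
▷-⊙ e k a .at φ A = refl

▷-𝟎 : ∀ e → e ▷ 𝟎 ≈ 𝟎
▷-𝟎 e .at φ A = refl

⊖-swap : ∀ {a b} → a ⊕ b ≈ 𝟎 → b ≈ ⊖ a
⊖-swap {a} {b} p .at φ A = trans (lem ⟨ a ∣ φ ⟩ ⟨ b ∣ φ ⟩) (trans (cong (ℤ._+ -1ℤ ℤ.* ⟨ a ∣ φ ⟩) (p .at φ A)) (ℤₚ.+-identityˡ _))
  where lem : ∀ a b → b ≡ (a ℤ.+ b) ℤ.+ -1ℤ ℤ.* a
        lem = solve-∀

⊙-𝟎 : ∀ {k a} → a ≈ 𝟎 → k ⊙ a ≈ 𝟎
⊙-𝟎 {k} p = ≈-trans (⊙-cong k p) (⊙-zeroʳ k)

⊕-𝟎 : ∀ {a b} → a ≈ 𝟎 → b ≈ 𝟎 → a ⊕ b ≈ 𝟎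
⊕-𝟎 p q = ≈-trans (⊕-cong p q) ⊕-idʳ

⊕-elimʳ : ∀ {a b} → b ≈ 𝟎 → a ⊕ b ≈ a
⊕-elimʳ p = ≈-trans (⊕-cong ≈-refl p) ⊕-idʳ

⊕-elimˡ : ∀ {a b} → a ≈ 𝟎 → a ⊕ b ≈ b
⊕-elimˡ p = ≈-trans (⊕-cong p ≈-refl) ⊕-idˡ

▷-elim : ∀ {e a} → a ≈ 𝟎 → e ▷ a ≈ 𝟎
▷-elim {e} p = ≈-trans (▷-cong e p) (▷-𝟎 e)

∑ : ∀ {A : Set} → List A → (A → Ch) → Ch
∑ [] f = 𝟎
∑ (x ∷ l) f = f x ⊕ ∑ l f

∑-cong-∈ : ∀ {A : Set} (l : List A) {f g : A → Ch} → (∀ {x} → x ∈ l → f x ≈ g x) → ∑ l f ≈ ∑ l g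
∑-cong-∈ [] p = ≈-refl
∑-cong-∈ (x ∷ l) p = ⊕-cong (p (here refl)) (∑-cong-∈ l (p ∘ there))

∑-cong : ∀ {A : Set} (l : List A) {f g : A → Ch} → (∀ x → f x ≈ g x) → ∑ l f ≈ ∑ l g
∑-cong l p = ∑-cong-∈ l λ {x} _ → p x

∑-zero : ∀ {A : Set} (l : List A) {f : A → Ch} → (∀ {x} → x ∈ l → f x ≈ 𝟎) → ∑ l f ≈ 𝟎
∑-zero [] p = ≈-refl
∑-zero (x ∷ l) p = ⊕-𝟎 (p (here refl)) (∑-zero l (p ∘ there))

record Hom (H : Ch → Ch) : Set where
  field
    h𝟎 : H 𝟎 ≈ 𝟎
    h⊕ : ∀ a b → H (a ⊕ b) ≈ H a ⊕ H b
open Hom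

∑-hom : ∀ {A : Set} {H} → Hom H → ∀ (l : List A) {f : A → Ch} → H (∑ l f) ≈ ∑ l (H ∘ f)
∑-hom h [] = h𝟎 h
∑-hom h (x ∷ l) = ≈-trans (h⊕ h _ _) (⊕-cong ≈-refl (∑-hom h l))

hom▷ : ∀ e → Hom (e ▷_)
hom▷ e .h𝟎 = ▷-𝟎 e
hom▷ e .h⊕ = ▷-⊕ e

hom⊙ : ∀ k → Hom (k ⊙_)
hom⊙ k .h𝟎 = ⊙-zeroʳ k
hom⊙ k .h⊕ = ⊙-distˡ k

homD : ∀ w → Hom (D w)
homD w .h𝟎 = ≈-refl
homD w .h⊕ a b = ≈-refl

homM : ∀ w → Hom (M w)
homM w .h𝟎 = ≈-refl
homM w .h⊕ a b = ≈-refl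

hom-map : ∀ f → Hom (mapC f)
hom-map f .h𝟎 = ≈-refl
hom-map f .h⊕ a b = ≈-refl

hom⋀ˡ : ∀ b → Hom (_⋀ b)
hom⋀ˡ b .h𝟎 = ≈-refl
hom⋀ˡ b .h⊕ a c = ≈-refl

⋀-𝟎 : ∀ a → a ⋀ 𝟎 ≈ 𝟎
⋀-𝟎 𝟎 = ≈-refl
⋀-𝟎 vac = ≈-refl
⋀-𝟎 (e ▷ a) = ▷-elim (⋀-𝟎 a)
⋀-𝟎 (a ⊕ b) = ⊕-𝟎 (⋀-𝟎 a) (⋀-𝟎 b)
⋀-𝟎 (k ⊙ a) = ⊙-𝟎 (⋀-𝟎 a)

⋀-⊕ʳ : ∀ a b c → a ⋀ (b ⊕ c) ≈ a ⋀ b ⊕ a ⋀ c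
⋀-⊕ʳ 𝟎 b c = ≈-sym ⊕-idʳ
⋀-⊕ʳ vac b c = ≈-refl
⋀-⊕ʳ (e ▷ a) b c = ≈-trans (▷-cong e (⋀-⊕ʳ a b c)) (▷-⊕ e _ _)
⋀-⊕ʳ (a ⊕ a') b c = ≈-trans (⊕-cong (⋀-⊕ʳ a b c) (⋀-⊕ʳ a' b c)) (⊕-inter _ _ _ _)
⋀-⊕ʳ (k ⊙ a) b c = ≈-trans (⊙-cong k (⋀-⊕ʳ a b c)) (⊙-distˡ k _ _)

⊙-comm : ∀ k m a → k ⊙ m ⊙ a ≈ m ⊙ k ⊙ a
⊙-comm k m a .at φ A = lem k m ⟨ a ∣ φ ⟩
  where lem : ∀ k m x → k ℤ.* (m ℤ.* x) ≡ m ℤ.* (k ℤ.* x)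
        lem = solve-∀

⋀-⊙ʳ : ∀ a k b → a ⋀ (k ⊙ b) ≈ k ⊙ (a ⋀ b)
⋀-⊙ʳ 𝟎 k b = ≈-sym (⊙-zeroʳ k)
⋀-⊙ʳ vac k b = ≈-refl
⋀-⊙ʳ (e ▷ a) k b = ≈-trans (▷-cong e (⋀-⊙ʳ a k b)) (▷-⊙ e k _)
⋀-⊙ʳ (a ⊕ a') k b = ≈-trans (⊕-cong (⋀-⊙ʳ a k b) (⋀-⊙ʳ a' k b)) (≈-sym (⊙-distˡ k _ _))
⋀-⊙ʳ (m ⊙ a) k b = ≈-trans (⊙-cong m (⋀-⊙ʳ a k b)) (⊙-comm m k _)

hom⋀ʳ : ∀ a → Hom (a ⋀_)
hom⋀ʳ a .h𝟎 = ⋀-𝟎 a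
hom⋀ʳ a .h⊕ = ⋀-⊕ʳ a

∑-⊕ : ∀ {A : Set} (l : List A) (f g : A → Ch) → ∑ l (λ x → f x ⊕ g x) ≈ ∑ l f ⊕ ∑ l g
∑-⊕ [] f g = ≈-sym ⊕-idʳ
∑-⊕ (x ∷ l) f g = ≈-trans (⊕-cong ≈-refl (∑-⊕ l f g)) (⊕-inter _ _ _ _)

∑-swap : ∀ {A B : Set} (l : List A) (m : List B) (f : A → B → Ch) → ∑ l (λ x → ∑ m (f x)) ≈ ∑ m (λ y → ∑ l (λ x → f x y))
∑-swap [] m f = ≈-sym (∑-zero m λ _ → ≈-refl)
∑-swap (x ∷ l) m f = ≈-trans (⊕-cong ≈-refl (∑-swap l m f)) (≈-sym (∑-⊕ m _ _))

∑-delta : ∀ {A : Set} {l : List A} {y} → Unique l → y ∈ l → (f : A → Ch) → (∀ {x} → x ∈ l → x ≢ y → f x ≈ 𝟎) → ∑ l f ≈ f y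
∑-delta (u ∷ U) (here refl) f p = ⊕-elimʳ (∑-zero _ λ x∈ → p (there x∈) λ { refl → All.lookup u x∈ refl })
∑-delta (u ∷ U) (there y∈) f p = ≈-trans (⊕-cong (p (here refl) (All.lookup u y∈)) (∑-delta U y∈ f (p ∘ there))) ⊕-idˡ

-- Chains supported on the matchings of a vertex set

infixl 5 _∖_
_∖_ : (ℕ → Set) → ℕ → ℕ → Set
(P ∖ x) v = P v × v ≢ x

-- In P d a: up to ≈, a is a combination of matchings with d edges whose vertices satisfy P.
data In (P : ℕ → Set) : ℕ → Ch → Set where
  in𝟎 : ∀ {d} → In P d 𝟎
  invac : In P 0 vac
  in▷ : ∀ {x y d a} → P x → P y → x ≢ y → In (P ∖ x ∖ y) d a → In P (suc d) ((x , y) ▷ a)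
  in⊕ : ∀ {d a b} → In P d a → In P d b → In P d (a ⊕ b)
  in⊙ : ∀ {d a} k → In P d a → In P d (k ⊙ a)
  in≈ : ∀ {d a b} → a ≈ b → In P d a → In P d b

In-mono : ∀ {P Q : ℕ → Set} → (∀ {v} → P v → Q v) → ∀ {d a} → In P d a → In Q d a
In-mono i in𝟎 = in𝟎
In-mono i invac = invac
In-mono i (in▷ px py n a) = in▷ (i px) (i py) n (In-mono (λ ((p , q) , r) → (i p , q) , r) a)
In-mono i (in⊕ a b) = in⊕ (In-mono i a) (In-mono i b)
In-mono i (in⊙ k a) = in⊙ k (In-mono i a)
In-mono i (in≈ e a) = in≈ e (In-mono i a)

D₀ : ∀ {P} w → FlipInv w → ∀ {a} → In P 0 a → D w a ≈ 𝟎
D₀ w W in𝟎 = ≈-refl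
D₀ w W invac = ≈-refl
D₀ w W (in⊕ a b) = ⊕-𝟎 (D₀ w W a) (D₀ w W b)
D₀ w W (in⊙ k a) = ⊙-𝟎 (D₀ w W a)
D₀ w W (in≈ e a) = ≈-trans (D-cong W (≈-sym e)) (D₀ w W a)

In-D : ∀ {P} w → FlipInv w → ∀ {d a} → In P (suc d) a → In P d (D w a)
In-D w W in𝟎 = in𝟎
In-D w W (in▷ {d = zero} px py n a) = in⊕ (in⊙ _ (In-mono (proj₁ ∘ proj₁) a)) (in≈ (≈-sym (⊙-𝟎 (▷-elim (D₀ w W a)))) in𝟎)
In-D w W (in▷ {d = suc d} px py n a) = in⊕ (in⊙ _ (In-mono (proj₁ ∘ proj₁) a)) (in⊙ _ (in▷ px py n (In-D w W a)))
In-D w W (in⊕ a b) = in⊕ (In-D w W a) (In-D w W b)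
In-D w W (in⊙ k a) = in⊙ k (In-D w W a)
In-D w W (in≈ e a) = in≈ (D-cong W e) (In-D w W a)

∂-In : ∀ {P d a} → In P (suc d) a → In P d (∂ₑ a)
∂-In = In-D _ (λ _ → refl)

∂∂ : ∀ a → ∂ₑ (∂ₑ a) ≈ 𝟎
-- Anticommutation of the boundary with itself only gives x = - x; torsion-freeness of the integers
-- does the rest.
∂∂ a .at φ A = lem _ (D-anti (λ _ → 1ℤ) (λ _ → 1ℤ) a .at φ A)
  where
  lem : ∀ x → x ≡ -1ℤ ℤ.* x → x ≡ 0ℤ
  lem x e = ℤₚ.*-cancelˡ-≡ (+ 2) x 0ℤ (trans (l₁ x) (trans (cong (ℤ._+_ x) e) (l₂ x)))
    where
    l₁ : ∀ x → + 2 ℤ.* x ≡ x ℤ.+ x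
    l₁ = solve-∀
    l₂ : ∀ x → x ℤ.+ -1ℤ ℤ.* x ≡ + 2 ℤ.* 0ℤ
    l₂ = solve-∀

-- A weight matters only on edges between distinct admissible vertices. This is what later allows
-- the constant weight 1 to be replaced by a sum of indicators of edges.
D-agree : ∀ {P w v} → FlipInv w → FlipInv v → (∀ {x y} → P x → P y → x ≢ y → w (x , y) ≡ v (x , y)) →
          ∀ {d a} → In P d a → D w a ≈ D v a
D-agree W V p in𝟎 = ≈-refl
D-agree W V p invac = ≈-refl
D-agree {w = w} {v} W V p (in▷ {x} {y} {a = a} px py n i) = ⊕-cong (≡⇒≈ (cong (_⊙ a) (p px py n))) (⊙-cong _ (▷-cong _ (D-agree W V (λ ((px , _) , _) ((py , _) , _) → p px py) i)))
D-agree W V p (in⊕ a b) = ⊕-cong (D-agree W V p a) (D-agree W V p b)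
D-agree W V p (in⊙ k a) = ⊙-cong k (D-agree W V p a)
D-agree W V p (in≈ e a) = ≈-trans (D-cong W (≈-sym e)) (≈-trans (D-agree W V p a) (D-cong V e))

D-0 : ∀ a → D (λ _ → 0ℤ) a ≈ 𝟎
D-0 𝟎 = ≈-refl
D-0 vac = ≈-refl
D-0 (e ▷ a) = ⊕-𝟎 (⊙-zeroˡ a) (⊙-𝟎 (▷-elim (D-0 a)))
D-0 (a ⊕ b) = ⊕-𝟎 (D-0 a) (D-0 b)
D-0 (k ⊙ a) = ⊙-𝟎 (D-0 a)

D-vanish : ∀ {P w} → FlipInv w → (∀ {x y} → P x → P y → x ≢ y → w (x , y) ≡ 0ℤ) → ∀ {d a} → In P d a → D w a ≈ 𝟎
D-vanish W p {a = a} i = ≈-trans (D-agree W (λ _ → refl) p i) (D-0 a)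

M-id : ∀ {P w} → FlipInv w → (∀ {x y} → P x → P y → x ≢ y → w (x , y) ≡ 1ℤ) → ∀ {d a} → In P d a → M w a ≈ a
M-id W p in𝟎 = ≈-refl
M-id W p invac = ≈-refl
M-id {w = w} W p (in▷ {a = a} px py n i) = ≈-trans (≡⇒≈ (cong (_⊙ (_ ▷ M w a)) (p px py n))) (≈-trans (⊙-idˡ _) (▷-cong _ (M-id W (λ ((px , _) , _) ((py , _) , _) → p px py) i)))
M-id W p (in⊕ a b) = ⊕-cong (M-id W p a) (M-id W p b)
M-id W p (in⊙ k a) = ⊙-cong k (M-id W p a)
M-id W p (in≈ e a) = ≈-trans (M-cong W (≈-sym e)) (≈-trans (M-id W p a) e)

mapC-id : ∀ {P f} → (∀ {x} → P x → f x ≡ x) → ∀ {d a} → In P d a → mapC f a ≈ a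
mapC-id p in𝟎 = ≈-refl
mapC-id p invac = ≈-refl
mapC-id {f = f} p (in▷ {a = a} px py n i) = ≈-trans (≡⇒≈ (cong (_▷ mapC f a) (cong₂ _,_ (p px) (p py)))) (▷-cong _ (mapC-id (λ ((px , _) , _) → p px) i))
mapC-id p (in⊕ a b) = ⊕-cong (mapC-id p a) (mapC-id p b)
mapC-id p (in⊙ k a) = ⊙-cong k (mapC-id p a)
mapC-id p (in≈ e a) = ≈-trans (mapC-cong _ (≈-sym e)) (≈-trans (mapC-id p a) e)

mapC-In : ∀ {P Q : ℕ → Set} {f} → (∀ {x} → P x → Q (f x)) → (∀ {x y} → P x → P y → f x ≡ f y → x ≡ y) →
          ∀ {d a} → In P d a → In Q d (mapC f a)
mapC-In i j in𝟎 = in𝟎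
mapC-In i j invac = invac
mapC-In i j (in▷ px py n a) = in▷ (i px) (i py) (n ∘ j px py)
  (mapC-In (λ ((p , q) , r) → (i p , q ∘ j p px) , r ∘ j p py) (λ ((p , _) , _) ((q , _) , _) → j p q) a)
mapC-In i j (in⊕ a b) = in⊕ (mapC-In i j a) (mapC-In i j b)
mapC-In i j (in⊙ k a) = in⊙ k (mapC-In i j a)
mapC-In i j (in≈ e a) = in≈ (mapC-cong _ e) (mapC-In i j a)

Disjoint : (P Q : ℕ → Set) → Set
Disjoint P Q = ∀ {v} → P v → Q v → ⊥

In-⋀ : ∀ {P Q R : ℕ → Set} → Disjoint P Q → (∀ {v} → P v → R v) → (∀ {v} → Q v → R v) →
       ∀ {d e a b} → In P d a → In Q e b → In R (d + e) (a ⋀ b)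
In-⋀ D i j in𝟎 q = in𝟎
In-⋀ D i j invac q = In-mono j q
In-⋀ D i j (in▷ px py n p) q = in▷ (i px) (i py) n
  (In-⋀ (λ ((p , _) , _) → D p) (λ ((p , q) , r) → (i p , q) , r)
    (λ q → (j q , λ { refl → D px q }) , λ { refl → D py q }) p q)
In-⋀ D i j (in⊕ a b) q = in⊕ (In-⋀ D i j a q) (In-⋀ D i j b q)
In-⋀ D i j (in⊙ k a) q = in⊙ k (In-⋀ D i j a q)
In-⋀ D i j (in≈ {b = b} e a) q = in≈ (⋀-congˡ _ e) (In-⋀ D i j a q)

slide : ∀ {P d a} e b → In P d a → a ⋀ (e ▷ b) ≈ sgn d ⊙ (e ▷ (a ⋀ b))
slide {d = d} e b in𝟎 = ≈-sym (⊙-𝟎 {sgn d} (▷-𝟎 e))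
slide e b invac = ≈-sym (⊙-idˡ _)
slide e b (in▷ {x} {y} {d} {a} px py n i) = ≈-trans (▷-cong _ (slide e b i)) (≈-trans (▷-⊙ _ _ _) (≈-trans (⊙-cong _ (▷-swap _ _ _)) lem))
  where
  lem : ∀ {c} → sgn d ⊙ ⊖ c ≈ (- sgn d) ⊙ c
  lem {c} .at φ A = l (sgn d) ⟨ c ∣ φ ⟩
    where l : ∀ s x → s ℤ.* (-1ℤ ℤ.* x) ≡ - s ℤ.* x
          l = solve-∀
slide e b (in⊕ i j) = ≈-trans (⊕-cong (slide e b i) (slide e b j)) (≈-sym (≈-trans (⊙-cong _ (▷-⊕ e _ _)) (⊙-distˡ _ _ _)))
slide e b (in⊙ k i) = ≈-trans (⊙-cong k (slide e b i)) (≈-trans (⊙-comm k _ _) (⊙-cong _ (≈-sym (▷-⊙ e k _))))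
slide e b (in≈ p i) = ≈-trans (⋀-congˡ _ (≈-sym p)) (≈-trans (slide e b i) (⊙-cong _ (▷-cong e (⋀-congˡ b p))))

sgn-+ : ∀ m n → sgn (m + n) ≡ sgn m ℤ.* sgn n
sgn-+ zero n = sym (ℤₚ.*-identityˡ _)
sgn-+ (suc m) n = trans (cong -_ (sgn-+ m n)) (ℤₚ.neg-distribˡ-* (sgn m) (sgn n))

⋀-vac : ∀ {P d a} → In P d a → a ⋀ vac ≈ a
⋀-vac in𝟎 = ≈-refl
⋀-vac invac = ≈-refl
⋀-vac (in▷ _ _ _ i) = ▷-cong _ (⋀-vac i)
⋀-vac (in⊕ i j) = ⊕-cong (⋀-vac i) (⋀-vac j)
⋀-vac (in⊙ k i) = ⊙-cong k (⋀-vac i)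
⋀-vac (in≈ p i) = ≈-trans (⋀-congˡ _ (≈-sym p)) (≈-trans (⋀-vac i) p)

⋀-comm : ∀ {P Q d e a b} → In P d a → In Q e b → a ⋀ b ≈ sgn (d * e) ⊙ (b ⋀ a)
⋀-comm {d = d} {e} {a} i in𝟎 = ≈-trans (⋀-𝟎 a) (≈-sym (⊙-zeroʳ (sgn (d * e))))
⋀-comm {d = d} {a = a} i invac rewrite ℕₚ.*-zeroʳ d = ≈-trans (⋀-vac i) (≈-sym (⊙-idˡ a))
⋀-comm {d = d} {a = a} i (in▷ {x} {y} {e} {b} px py n j) =
  a ⋀ ((x , y) ▷ b)                                  ≈⟨ slide _ _ i ⟩
  sgn d ⊙ ((x , y) ▷ (a ⋀ b))                        ≈⟨ ⊙-cong _ (▷-cong _ (⋀-comm i j)) ⟩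
  sgn d ⊙ ((x , y) ▷ (sgn (d * e) ⊙ (b ⋀ a)))      ≈⟨ ⊙-cong _ (▷-⊙ _ _ _) ⟩
  sgn d ⊙ sgn (d * e) ⊙ ((x , y) ▷ b ⋀ a)          ≈⟨ ⊙-assoc _ _ _ ⟩
  (sgn d ℤ.* sgn (d * e)) ⊙ ((x , y) ▷ b ⋀ a)        ≈⟨ ≡⇒≈ (cong (_⊙ _) (trans (sym (sgn-+ d _)) (cong sgn (sym (ℕₚ.*-suc d e))))) ⟩
  sgn (d * suc e) ⊙ (((x , y) ▷ b) ⋀ a) ∎≈
⋀-comm {a = a} i (in⊕ {a = b} {c} j k) = ≈-trans (⋀-⊕ʳ a b c) (≈-trans (⊕-cong (⋀-comm i j) (⋀-comm i k)) (≈-sym (⊙-distˡ _ _ _)))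
⋀-comm {a = a} i (in⊙ k j) = ≈-trans (⋀-⊙ʳ a k _) (≈-trans (⊙-cong k (⋀-comm i j)) (⊙-comm k _ _))
⋀-comm {a = a} i (in≈ p j) = ≈-trans (⋀-congʳ a (≈-sym p)) (≈-trans (⋀-comm i j) (⊙-cong _ (⋀-congˡ a p)))

D-⋀ : ∀ {P w} → FlipInv w → ∀ {d a} b → In P d a → D w (a ⋀ b) ≈ (D w a ⋀ b) ⊕ sgn d ⊙ (a ⋀ D w b)
D-⋀ {w = w} W {d} b in𝟎 = ≈-sym (≈-trans ⊕-idˡ (⊙-zeroʳ (sgn d)))
D-⋀ {w = w} W b invac = ≈-sym (≈-trans ⊕-idˡ (⊙-idˡ _))
D-⋀ {w = w} W b (in▷ {x} {y} {d} {a} px py n i) = ≈-trans (⊕-cong ≈-refl (⊙-cong _ (▷-cong _ (D-⋀ W b i)))) lem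
  where
  lem : w (x , y) ⊙ (a ⋀ b) ⊕ ⊖ ((x , y) ▷ ((D w a ⋀ b) ⊕ sgn d ⊙ (a ⋀ D w b)))
        ≈ (w (x , y) ⊙ (a ⋀ b) ⊕ ⊖ ((x , y) ▷ (D w a ⋀ b))) ⊕ (- sgn d) ⊙ ((x , y) ▷ (a ⋀ D w b))
  lem .at φ A = l (w (x , y)) (sgn d) ⟨ a ⋀ b ∣ φ ⟩ ⟨ (x , y) ▷ (D w a ⋀ b) ∣ φ ⟩ ⟨ (x , y) ▷ (a ⋀ D w b) ∣ φ ⟩
    where l : ∀ w s x y z → w ℤ.* x ℤ.+ -1ℤ ℤ.* (y ℤ.+ s ℤ.* z) ≡ (w ℤ.* x ℤ.+ -1ℤ ℤ.* y) ℤ.+ - s ℤ.* z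
          l = solve-∀
D-⋀ {w = w} W {d} b (in⊕ {a = a} {c} i j) = ≈-trans (⊕-cong (D-⋀ W b i) (D-⋀ W b j)) (≈-trans (⊕-inter _ _ _ _) (⊕-cong ≈-refl (≈-sym (⊙-distˡ (sgn d) _ _))))
D-⋀ {w = w} W {d} b (in⊙ k i) = ≈-trans (⊙-cong k (D-⋀ W b i)) (≈-trans (⊙-distˡ k _ _) (⊕-cong ≈-refl (⊙-comm k (sgn d) _)))
D-⋀ {w = w} W {d} b (in≈ {a = a} {a'} p i) = ≈-trans (D-cong W (⋀-congˡ b (≈-sym p))) (≈-trans (D-⋀ W b i) (⊕-cong (⋀-congˡ b (D-cong W p)) (⊙-cong _ (⋀-congˡ (D w b) p))))

-- Links and the exact sequence

infix 4 _≟_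
_≟_ = ℕ._≟_

ι : ∀ {P : Set} → Dec P → ℤ
ι d = if does d then 1ℤ else 0ℤ

if-yes : ∀ {P A : Set} {x y : A} (d : Dec P) → P → (if does d then x else y) ≡ x
if-yes (yes _) p = refl
if-yes (no n) p = contradiction p n

if-no : ∀ {P A : Set} {x y : A} (d : Dec P) → ¬ P → (if does d then x else y) ≡ y
if-no (yes p) n = contradiction p n
if-no (no _) n = refl

ι-yes : ∀ {P : Set} (d : Dec P) → P → ι d ≡ 1ℤ
ι-yes = if-yes

ι-no : ∀ {P : Set} (d : Dec P) → ¬ P → ι d ≡ 0ℤ
ι-no = if-no

ι-⇔ : ∀ {P Q : Set} (d : Dec P) (e : Dec Q) → (P → Q) → (Q → P) → ι d ≡ ι e
ι-⇔ (yes p) e f g = sym (ι-yes e (f p))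
ι-⇔ (no n) e f g = sym (ι-no e (n ∘ g))

Same : E → E → Set
Same (p , s) (x , y) = (p ≡ x × s ≡ y) ⊎ (p ≡ y × s ≡ x)

same? : ∀ e t → Dec (Same e t)
same? (p , s) (x , y) = ((p ≟ x) ×-dec (s ≟ y)) ⊎-dec ((p ≟ y) ×-dec (s ≟ x))

Same-flip : ∀ e t → Same e t → Same e (flipE t)
Same-flip e t (inj₁ p) = inj₂ p
Same-flip e t (inj₂ p) = inj₁ p

Same-sym : ∀ {p s} t → Same (p , s) t → Same (s , p) t
Same-sym t (inj₁ (p , q)) = inj₂ (q , p)
Same-sym t (inj₂ (p , q)) = inj₁ (q , p)

avoid? : ∀ p (t : E) → Dec (p ≢ proj₁ t × p ≢ proj₂ t)
avoid? p (x , y) = ¬? (p ≟ x) ×-dec ¬? (p ≟ y)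

abstract
  lnk : E → E → ℤ
  lnk e t = ι (same? e t)

  lnk-yes : ∀ {e t} → Same e t → lnk e t ≡ 1ℤ
  lnk-yes {e} {t} = ι-yes (same? e t)

  lnk-no : ∀ {e t} → ¬ Same e t → lnk e t ≡ 0ℤ
  lnk-no {e} {t} = ι-no (same? e t)

  lnk-⇔ : ∀ {e t e' t'} → (Same e t → Same e' t') → (Same e' t' → Same e t) → lnk e t ≡ lnk e' t'
  lnk-⇔ {e} {t} {e'} {t'} = ι-⇔ (same? e t) (same? e' t')

  avoid : ℕ → E → ℤ
  avoid p t = ι (avoid? p t)

  avoid-yes : ∀ {p t} → p ≢ proj₁ t → p ≢ proj₂ t → avoid p t ≡ 1ℤ
  avoid-yes {p} {t} m n = ι-yes (avoid? p t) (m , n)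

  avoid-no : ∀ {p t} → p ≡ proj₁ t ⊎ p ≡ proj₂ t → avoid p t ≡ 0ℤ
  avoid-no {p} {t} h = ι-no (avoid? p t) (λ (m , n) → [ m , n ] h)

  avoid-flip : ∀ p → FlipInv (avoid p)
  avoid-flip p t = ι-⇔ (avoid? p t) (avoid? p (flipE t)) (λ (a , b) → b , a) (λ (a , b) → b , a)

lnk-flip : ∀ e → FlipInv (lnk e)
lnk-flip e t = lnk-⇔ {e} {t} {e} {flipE t} (Same-flip e t) (Same-flip e (flipE t))

L : ℕ → ℕ → Ch → Ch
L p s = D (lnk (p , s))

-- The terms of a chain that leave `p` unmatched.
K : ℕ → Ch → Ch
K p = M (avoid p)

L-cong : ∀ p s {a b} → a ≈ b → L p s a ≈ L p s b
L-cong p s = D-cong (lnk-flip (p , s))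

K-cong : ∀ p {a b} → a ≈ b → K p a ≈ K p b
K-cong p = M-cong (avoid-flip p)

L-sym : ∀ p s {P d a} → In P d a → L p s a ≈ L s p a
L-sym p s = D-agree (lnk-flip _) (lnk-flip _) λ {x} {y} _ _ _ → lnk-⇔ {p , s} {x , y} {s , p} {x , y} (Same-sym (x , y)) (Same-sym (x , y))

L-out : ∀ {P p s} → ¬ P p → ∀ {d a} → In P d a → L p s a ≈ 𝟎
L-out {p = p} {s} n = D-vanish (lnk-flip _) λ {x} {y} px py _ → lnk-no {p , s} {x , y} λ { (inj₁ (refl , _)) → n px ; (inj₂ (refl , _)) → n py }

L-outʳ : ∀ {P p s} → ¬ P s → ∀ {d a} → In P d a → L p s a ≈ 𝟎
L-outʳ {p = p} {s} n i = ≈-trans (L-sym p s i) (L-out n i)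

L-loop : ∀ {P p d a} → In P d a → L p p a ≈ 𝟎
L-loop {p = p} = D-vanish (lnk-flip _) λ {x} {y} _ _ x≢y → lnk-no {p , p} {x , y} λ { (inj₁ (refl , refl)) → x≢y refl ; (inj₂ (refl , refl)) → x≢y refl }

L₀ : ∀ {P p s a} → In P 0 a → L p s a ≈ 𝟎
L₀ = D₀ _ (lnk-flip _)

K-free : ∀ {P p} → ¬ P p → ∀ {d a} → In P d a → K p a ≈ a
K-free {p = p} n = M-id (avoid-flip _) λ {x} {y} px py _ → avoid-yes {p} {x , y} (λ { refl → n px }) (λ { refl → n py })

L-hit : ∀ {p s} t a → Same (p , s) t → L p s (t ▷ a) ≈ a ⊕ ⊖ (t ▷ L p s a)
L-hit {p} {s} t a h = ⊕-cong (≈-trans (≡⇒≈ (cong (_⊙ a) (lnk-yes {p , s} {t} h))) (⊙-idˡ a)) ≈-refl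

L-miss : ∀ {p s} t a → ¬ Same (p , s) t → L p s (t ▷ a) ≈ ⊖ (t ▷ L p s a)
L-miss {p} {s} t a h = ≈-trans (⊕-cong (≈-trans (≡⇒≈ (cong (_⊙ a) (lnk-no {p , s} {t} h))) (⊙-zeroˡ a)) ≈-refl) ⊕-idˡ

K-hit : ∀ {p} t a → (p ≡ proj₁ t ⊎ p ≡ proj₂ t) → K p (t ▷ a) ≈ 𝟎
K-hit {p} t a h = ≈-trans (≡⇒≈ (cong (_⊙ (t ▷ K p a)) (avoid-no {p} {t} h))) (⊙-zeroˡ _)

K-miss : ∀ {p} t a → p ≢ proj₁ t → p ≢ proj₂ t → K p (t ▷ a) ≈ t ▷ K p a
K-miss {p} t a m n = ≈-trans (≡⇒≈ (cong (_⊙ (t ▷ K p a)) (avoid-yes {p} {t} m n))) (⊙-idˡ _)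

⊖▷-elim : ∀ {e a} → a ≈ 𝟎 → ⊖ (e ▷ a) ≈ 𝟎
⊖▷-elim p = ⊙-𝟎 (▷-elim p)

-- If the leading edge is not `ps` but shares an end with it, the rest cannot contain `ps` and its
-- link is zero. This keeps both ends out of the support.
In-L : ∀ {P} p s {d a} → In P (suc d) a → In (P ∖ p ∖ s) d (L p s a)
In-L p s in𝟎 = in𝟎
In-L {P} p s (in▷ {x} {y} {d} {a} px py n i) with same? (p , s) (x , y)
... | yes (inj₁ (refl , refl)) = in≈ (≈-sym (≈-trans (L-hit (x , y) a (inj₁ (refl , refl))) (⊕-elimʳ (⊖▷-elim (L-out (λ ((_ , q) , _) → q refl) i))))) i
... | yes (inj₂ (refl , refl)) = in≈ (≈-sym (≈-trans (L-hit (x , y) a (inj₂ (refl , refl))) (⊕-elimʳ (⊖▷-elim (L-out (λ (_ , q) → q refl) i))))) (In-mono (λ ((a , b) , c) → (a , c) , b) i)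
... | no ns = in≈ (≈-sym (L-miss (x , y) a ns)) (rest d i refl)
  where
  zero! : L p s a ≈ 𝟎 → In (P ∖ p ∖ s) d (⊖ ((x , y) ▷ L p s a))
  zero! z = in≈ (≈-sym (⊖▷-elim z)) in𝟎
  rest : ∀ d' → In (P ∖ x ∖ y) d' a → d' ≡ d → In (P ∖ p ∖ s) d (⊖ ((x , y) ▷ L p s a))
  rest zero i refl = zero! (L₀ i)
  rest (suc d') i refl with x ≟ p | y ≟ p | x ≟ s | y ≟ s
  ... | yes refl | _ | _ | _ = zero! (L-out (λ ((_ , q) , _) → q refl) i)
  ... | no _ | yes refl | _ | _ = zero! (L-out (λ (_ , q) → q refl) i)
  ... | no _ | no _ | yes refl | _ = zero! (L-outʳ (λ ((_ , q) , _) → q refl) i)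
  ... | no _ | no _ | no _ | yes refl = zero! (L-outʳ (λ (_ , q) → q refl) i)
  ... | no xp | no yp | no xs | no ys = in⊙ _ (in▷ ((px , xp) , xs) ((py , yp) , ys) n
        (In-mono (λ ((((v , vx) , vy) , vp) , vs) → (((v , vp) , vs) , vx) , vy) (In-L p s i)))
In-L p s (in⊕ i j) = in⊕ (In-L p s i) (In-L p s j)
In-L p s (in⊙ k i) = in⊙ k (In-L p s i)
In-L p s (in≈ e i) = in≈ (L-cong p s e) (In-L p s i)

In-K : ∀ {P} p {d a} → In P d a → In (P ∖ p) d (K p a)
In-K p in𝟎 = in𝟎
In-K p invac = invac
In-K p (in▷ {x} {y} {a = a} px py n i) with ℕ._≟_ p x | ℕ._≟_ p y
... | yes q | _ = in≈ (≈-sym (K-hit (x , y) a (inj₁ q))) in𝟎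
... | no _ | yes q = in≈ (≈-sym (K-hit (x , y) a (inj₂ q))) in𝟎
... | no m | no k = in≈ (≈-sym (K-miss (x , y) a m k)) (in▷ (px , ≢-sym m) (py , ≢-sym k) n (In-mono (λ (((v , vx) , vy) , vp) → ((v , vp) , vx) , vy) (In-K p i)))
In-K p (in⊕ i j) = in⊕ (In-K p i) (In-K p j)
In-K p (in⊙ k i) = in⊙ k (In-K p i)
In-K p (in≈ e i) = in≈ (K-cong p e) (In-K p i)

Split : ℕ → List ℕ → Ch → Set
Split p U a = a ≈ ∑ U (λ s → (p , s) ▷ L p s a) ⊕ K p a

Split-≈ : ∀ {p U a b} → a ≈ b → Split p U a → Split p U b
Split-≈ {p} {U} e h = ≈-trans (≈-sym e) (≈-trans h (⊕-cong (∑-cong U λ s → ▷-cong _ (L-cong p s e)) (K-cong p e)))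

Split-hit : ∀ {P p U y d a} → Unique U → y ∈ U → ¬ P p → In P d a → Split p U ((p , y) ▷ a)
Split-hit {p = p} {U} {y} {a = a} u y∈ n i = ≈-sym (≈-trans (⊕-elimʳ (K-hit {p} (p , y) a (inj₁ refl))) (≈-trans (∑-delta u y∈ _ off) on))
  where
  off : ∀ {x} → x ∈ U → x ≢ y → (p , x) ▷ L p x ((p , y) ▷ a) ≈ 𝟎
  off {x} _ x≢y = ▷-elim (≈-trans (L-miss (p , y) a λ { (inj₁ (_ , q)) → x≢y q ; (inj₂ (refl , refl)) → x≢y refl }) (⊖▷-elim (L-out n i)))
  on : (p , y) ▷ L p y ((p , y) ▷ a) ≈ (p , y) ▷ a
  on = ▷-cong _ (≈-trans (L-hit (p , y) a (inj₁ (refl , refl))) (⊕-elimʳ (⊖▷-elim (L-out n i))))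

split : ∀ {P U d a} p → Unique U → (∀ {v} → P v → v ∈ U) → In P d a → Split p U a
split {U = U} p u c in𝟎 = ≈-sym (⊕-elimˡ (∑-zero U λ _ → ▷-𝟎 _))
split {U = U} p u c invac = ≈-sym (⊕-elimˡ (∑-zero U λ _ → ▷-𝟎 _))
split {U = U} p u c (in▷ {x} {y} {a = a} px py n i) with p ≟ x | p ≟ y
... | yes refl | _ = Split-hit u (c py) (λ ((_ , q) , _) → q refl) i
... | no _ | yes refl = Split-≈ {p} {U} (▷-flip _ a) (Split-hit u (c px) (λ (_ , q) → q refl) i)
... | no m | no k = ≈-sym (
  ∑ U (λ s → (p , s) ▷ L p s ((x , y) ▷ a)) ⊕ K p ((x , y) ▷ a)
    ≈⟨ ⊕-cong (∑-cong U λ s → ≈-trans (▷-cong _ (L-miss (x , y) a λ { (inj₁ (q , _)) → m q ; (inj₂ (q , _)) → k q })) (neg s)) (K-miss (x , y) a m k) ⟩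
  ∑ U (λ s → (x , y) ▷ (p , s) ▷ L p s a) ⊕ (x , y) ▷ K p a
    ≈⟨ ⊕-cong (≈-sym (∑-hom (hom▷ _) U)) ≈-refl ⟩
  (x , y) ▷ ∑ U (λ s → (p , s) ▷ L p s a) ⊕ (x , y) ▷ K p a
    ≈⟨ ▷-⊕ _ _ _ ⟨
  (x , y) ▷ (∑ U (λ s → (p , s) ▷ L p s a) ⊕ K p a)
    ≈⟨ ▷-cong _ (≈-sym (split p u (λ ((v , _) , _) → c v) i)) ⟩
  (x , y) ▷ a ∎≈)
  where
  neg : ∀ s → (p , s) ▷ ⊖ ((x , y) ▷ L p s a) ≈ (x , y) ▷ (p , s) ▷ L p s a
  neg s .at φ A = trans (cong (-1ℤ ℤ.*_) (▷-swap (p , s) (x , y) (L p s a) .at φ A)) (l ⟨ (x , y) ▷ (p , s) ▷ L p s a ∣ φ ⟩)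
    where l : ∀ x → -1ℤ ℤ.* (-1ℤ ℤ.* x) ≡ x
          l = solve-∀
split {U = U} p u c (in⊕ i j) = ≈-trans (⊕-cong (split p u c i) (split p u c j)) (≈-trans (⊕-inter _ _ _ _) (⊕-cong (≈-sym (≈-trans (∑-cong U λ s → ▷-⊕ _ _ _) (∑-⊕ U _ _))) ≈-refl))
split {U = U} p u c (in⊙ k i) = ≈-trans (⊙-cong k (split p u c i)) (≈-trans (⊙-distˡ k _ _) (⊕-cong (≈-trans (∑-hom (hom⊙ k) U) (∑-cong U λ s → ≈-sym (▷-⊙ _ k _))) ≈-refl))
split {U = U} p u c (in≈ e i) = Split-≈ {p} {U} e (split p u c i)

record Cyc (P : ℕ → Set) (d : ℕ) (z : Ch) : Set where
  constructor _,_
  field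
    isIn : In P d z
    isCycle : ∂ₑ z ≈ 𝟎
open Cyc

L-cyc : ∀ {P} p s {d z} → Cyc P (suc d) z → Cyc (P ∖ p ∖ s) d (L p s z)
L-cyc p s (i , c) .isIn = In-L p s i
L-cyc p s (i , c) .isCycle = ≈-trans (D-anti _ _ _) (⊙-𝟎 (L-cong p s c))

∂-edge : ∀ e {a} → ∂ₑ a ≈ 𝟎 → ∂ₑ (e ▷ a) ≈ a
∂-edge e p = ≈-trans (⊕-elimʳ (⊖▷-elim p)) (⊙-idˡ _)

-- Apply `K p` to the boundary of the decomposition of `z` at `p`. Since links of cycles are cycles,
-- `(p , x) ▷ L p x z` has boundary `L p x z`, and neither this nor `∂ₑ (K p z)` covers `p`.
∂K : ∀ {P U d z} p → Unique U → (∀ {v} → P v → v ∈ U) → Cyc P (suc d) z → ∂ₑ (K p z) ≈ ⊖ ∑ U (λ x → L p x z)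
∂K {P} {U} {z = z} p u c (i , cyc) = ⊖-swap (≈-sym (
  𝟎                                                          ≈⟨ K-cong p (≈-trans (≈-sym cyc) (∂-cong (split p u c i))) ⟩
  K p (∂ₑ (∑ U (λ x → (p , x) ▷ L p x z)) ⊕ ∂ₑ (K p z))       ≈⟨ ⊕-cong left right ⟩
  ∑ U (λ x → L p x z) ⊕ ∂ₑ (K p z) ∎≈))
  where
  left : K p (∂ₑ (∑ U (λ x → (p , x) ▷ L p x z))) ≈ ∑ U (λ x → L p x z)
  left = ≈-trans (K-cong p (∑-hom (homD _) U)) (≈-trans (∑-hom (homM _) U) (∑-cong U λ x →
    ≈-trans (K-cong p (∂-edge (p , x) (L-cyc p x (i , cyc) .isCycle))) (K-free (λ ((_ , q) , _) → q refl) (In-L p x i))))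
  right : K p (∂ₑ (K p z)) ≈ ∂ₑ (K p z)
  right = K-free (λ (_ , q) → q refl) (∂-In (In-K p i))

-- A 0-cycle of the three-point complex M_3: a cycle of type [3,1].
tri : ℕ → ℕ → ℕ → Ch
tri a b c = (a , b) ▷ vac ⊕ ⊖ ((b , c) ▷ vac)

record Sep (p r : ℕ) (S : List ℕ) (d : ℕ) (z : Ch) : Set where
  field
    b c : ℕ → Ch
    e : Ch
    b-cyc : ∀ {s} → Cyc ((_∈ S) ∖ s) d (b s)
    c-cyc : ∀ {t} → Cyc ((_∈ S) ∖ t) d (c t)
    e-in : In (_∈ S) (suc d) e
    eq : z ≈ (∑ S (λ s → tri s p r ⋀ b s) ⊕ ∑ S (λ t → tri t r p ⋀ c t)) ⊕ ∂ₑ ((p , r) ▷ e)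

-- Exactness of the sequence of the pair (M_n , matchings not covering p and r by two different edges).
separate : ∀ {p r S d z} → Unique (p ∷ r ∷ S) → Cyc (_∈ p ∷ r ∷ S) (suc d) z →
           (∀ s t → L r t (L p s z) ≈ 𝟎) → Sep p r S d z
separate {p} {r} {S} {d} {z} u@((p≢r ∷ _) ∷ _) (i , cyc) h = record
  { b = b ; c = c ; e = e ; b-cyc = λ {s} → b-cyc s ; c-cyc = λ {t} → c-cyc t ; e-in = e-in ; eq = eq }
  where
  U = p ∷ r ∷ S
  b c : ℕ → Ch
  b s = K r (L p s z)
  d0 = L p r z
  e0 = K p z
  c t = L r t e0
  e = K r e0
  -- By `h` no term of `L p s z` covers `r`, so `K r` changes nothing and merely removes `r` from
  -- the support.
  b≈ : ∀ s → b s ≈ L p s z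
  b≈ s = ≈-sym (≈-trans (split r u (λ ((v , _) , _) → v) (In-L p s i)) (⊕-elimˡ (∑-zero U λ {t} _ → ▷-elim (h s t))))
  into : ∀ {v} → v ∈ U → v ≢ p → v ≢ r → v ∈ S
  into (here q) m n = contradiction q m
  into (there (here q)) m n = contradiction q n
  into (there (there q)) m n = q
  b-cyc : ∀ s → Cyc ((_∈ S) ∖ s) d (b s)
  b-cyc s .isIn = In-mono (λ (((v , vp) , vs) , vr) → into v vp vr , vs) (In-K r (In-L p s i))
  b-cyc s .isCycle = ≈-trans (∂-cong (b≈ s)) (L-cyc p s (i , cyc) .isCycle)
  e0-in : In ((_∈ U) ∖ p) (suc d) e0
  e0-in = In-K p i
  e-in : In (_∈ S) (suc d) e
  e-in = In-mono (λ ((v , vp) , vr) → into v vp vr) (In-K r e0-in)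
  Lpp : L p p z ≈ 𝟎
  Lpp = L-loop i
  b̄ = ∑ S b
  fact : ∂ₑ e0 ≈ ⊖ (d0 ⊕ b̄)
  fact = ≈-trans (∂K p u id (i , cyc)) (⊙-cong _ (≈-trans (⊕-elimˡ Lpp) (⊕-cong ≈-refl (∑-cong S λ s → ≈-sym (b≈ s)))))
  r∉b : ∀ s → L r s d0 ≈ 𝟎
  r∉b s = L-out (λ (_ , q) → q refl) (In-L p r i)
  c-cyc : ∀ t → Cyc ((_∈ S) ∖ t) d (c t)
  c-cyc t .isIn = In-mono (λ (((v , vp) , vr) , vt) → into v vp vr , vt) (In-L r t e0-in)
  c-cyc t .isCycle = ≈-trans (D-anti _ _ e0) (⊙-𝟎 (≈-trans (L-cong r t fact) (⊙-𝟎 (⊕-𝟎 (r∉b t)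
    (≈-trans (∑-hom (homD _) S) (∑-zero S λ {s} _ → L-out (λ (_ , q) → q refl) (In-K r (In-L p s i))))))))
  c̄ = ∑ S c
  C = ∑ S (λ t → (t , r) ▷ c t)
  B = ∑ S (λ s → (s , p) ▷ b s)
  e0≈ : e0 ≈ C ⊕ e
  e0≈ = ≈-trans (split r u proj₁ e0-in) (⊕-cong (≈-trans (⊕-elimˡ (▷-elim (L-outʳ (λ (_ , q) → q refl) e0-in))) (≈-trans (⊕-elimˡ (▷-elim (L-loop e0-in))) (∑-cong S λ t → ▷-flip _ _))) ≈-refl)
  z≈ : z ≈ ((p , r) ▷ d0 ⊕ B) ⊕ e0
  z≈ = ≈-trans (split p u id i) (⊕-cong (≈-trans (⊕-elimˡ (▷-elim Lpp)) (⊕-cong ≈-refl (∑-cong S λ s → ≈-trans (▷-cong _ (≈-sym (b≈ s))) (▷-flip _ _)))) ≈-refl)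
  -- The boundary of `e0` is computed twice, by `∂K` at `p` and from its decomposition at `r`; the
  -- comparison determines the boundary of `e`.
  ∂e : ∂ₑ e ≈ ⊖ ((d0 ⊕ b̄) ⊕ c̄)
  ∂e = mk λ φ A → lem (⟨ ∂ₑ e ∣ φ ⟩) (⟨ c̄ ∣ φ ⟩) _ (trans (sym (∂e0 .at φ A)) (fact .at φ A))
    where
    ∂e0 : ∂ₑ e0 ≈ c̄ ⊕ ∂ₑ e
    ∂e0 = ≈-trans (∂-cong e0≈) (⊕-cong (≈-trans (∑-hom (homD _) S) (∑-cong S λ t → ∂-edge _ (c-cyc t .isCycle))) ≈-refl)
    lem : ∀ x y w → y ℤ.+ x ≡ -1ℤ ℤ.* w → x ≡ -1ℤ ℤ.* (w ℤ.+ y)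
    lem x y w q = trans (l₁ x y) (trans (cong (ℤ._+ - y) q) (l₂ y w))
      where l₁ : ∀ x y → x ≡ (y ℤ.+ x) ℤ.+ - y
            l₁ = solve-∀
            l₂ : ∀ y w → -1ℤ ℤ.* w ℤ.+ - y ≡ -1ℤ ℤ.* (w ℤ.+ y)
            l₂ = solve-∀
  tB : ∑ S (λ s → tri s p r ⋀ b s) ≈ B ⊕ ⊖ ((p , r) ▷ b̄)
  tB = ≈-trans (∑-⊕ S _ _) (⊕-cong ≈-refl (≈-sym (≈-trans (⊙-cong _ (∑-hom (hom▷ _) S)) (∑-hom (hom⊙ _) S))))
  tC : ∑ S (λ t → tri t r p ⋀ c t) ≈ C ⊕ ⊖ ((p , r) ▷ c̄)
  tC = ≈-trans (∑-⊕ S _ _) (⊕-cong ≈-refl (≈-sym (≈-trans (⊙-cong _ (≈-trans (▷-flip _ _) (∑-hom (hom▷ _) S))) (∑-hom (hom⊙ _) S))))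
  -- The boundary of `(p , r) ▷ e` is `e` plus the edge `pr` times `d0`, `b̄` and `c̄`. The last two
  -- cancel the second edges of the triangles, and the first is the part of `z` that contains `pr`.
  eq : z ≈ (∑ S (λ s → tri s p r ⋀ b s) ⊕ ∑ S (λ t → tri t r p ⋀ c t)) ⊕ ∂ₑ ((p , r) ▷ e)
  eq = ≈-trans (≈-trans z≈ (⊕-cong ≈-refl e0≈)) (≈-sym (≈-trans (⊕-cong (⊕-cong tB tC) (⊕-cong ≈-refl (⊙-cong _ (▷-cong _ ∂e)))) fin))
    where
    fin : ((B ⊕ ⊖ ((p , r) ▷ b̄)) ⊕ (C ⊕ ⊖ ((p , r) ▷ c̄))) ⊕ (1ℤ ⊙ e ⊕ ⊖ ((p , r) ▷ ⊖ ((d0 ⊕ b̄) ⊕ c̄))) ≈ ((p , r) ▷ d0 ⊕ B) ⊕ (C ⊕ e)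
    fin .at φ A = l ⟨ B ∣ φ ⟩ ⟨ C ∣ φ ⟩ ⟨ (p , r) ▷ b̄ ∣ φ ⟩ ⟨ (p , r) ▷ c̄ ∣ φ ⟩ ⟨ (p , r) ▷ d0 ∣ φ ⟩ ⟨ e ∣ φ ⟩
      where l : ∀ B C b c d e → ((B ℤ.+ -1ℤ ℤ.* b) ℤ.+ (C ℤ.+ -1ℤ ℤ.* c)) ℤ.+ (1ℤ ℤ.* e ℤ.+ -1ℤ ℤ.* (-1ℤ ℤ.* ((d ℤ.+ b) ℤ.+ c))) ≡ (d ℤ.+ B) ℤ.+ (C ℤ.+ e)
            l = solve-∀

-- Transpositions of vertices

sw : ℕ → ℕ → ℕ → ℕ
sw a b x = if does (x ≟ a) then b else if does (x ≟ b) then a else x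

sw-l : ∀ a b → sw a b a ≡ b
sw-l a b = if-yes (a ≟ a) refl

sw-r : ∀ a b → sw a b b ≡ a
sw-r a b with b ≟ a
... | yes refl = if-yes (b ≟ b) refl
... | no n = trans (if-no (b ≟ a) n) (if-yes (b ≟ b) refl)

sw-o : ∀ {a b x} → x ≢ a → x ≢ b → sw a b x ≡ x
sw-o {a} {b} {x} m n = trans (if-no (x ≟ a) m) (if-no (x ≟ b) n)

-- The chain homotopy ∑ₛ ps ∧ (-) (s unmatched) turns the sum of the transpositions (p s) into a boundary.
transposition-sum : ∀ {p U d z} → Unique U → p ∉ U → Cyc (_∈ U) (suc d) z →
  Σ Ch λ h → In (_∈ p ∷ U) (suc (suc d)) h × ∑ U (λ s → mapC (sw p s) z) ≈ ∂ₑ h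
transposition-sum {p} {U} {d} {z} u p∉ (i , cyc) = ∑ U (λ s → (p , s) ▷ K s z) , ∑-In , (
  ∑ U (λ s → mapC (sw p s) z)                                        ≈⟨ ∑-cong-∈ U swapped ⟩
  ∑ U (λ s → K s z ⊕ ∑ U (λ x → (p , x) ▷ L s x z))                  ≈⟨ ∑-⊕ U _ _ ⟩
  ∑ U (λ s → K s z) ⊕ ∑ U (λ s → ∑ U (λ x → (p , x) ▷ L s x z))      ≈⟨ ⊕-cong ≈-refl (∑-swap U U _) ⟩
  -- Links are symmetric in their ends, so in a sum over all ordered pairs the roles of `x` and `s`
  -- can be exchanged; this produces the edge `(p , s)` that occurs in the boundary.
  ∑ U (λ s → K s z) ⊕ ∑ U (λ x → ∑ U (λ s → (p , x) ▷ L s x z))      ≈⟨ ⊕-cong ≈-refl (∑-cong U λ x → ∑-cong U λ s → ▷-cong _ (L-sym s x i)) ⟩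
  ∑ U (λ s → K s z) ⊕ ∑ U (λ x → ∑ U (λ s → (p , x) ▷ L x s z))      ≈⟨ ∑-⊕ U _ _ ⟨
  ∑ U (λ s → K s z ⊕ ∑ U (λ x → (p , s) ▷ L s x z))                  ≈⟨ ∑-cong U bdry ⟨
  ∑ U (λ s → ∂ₑ ((p , s) ▷ K s z))                                   ≈⟨ ∑-hom (homD _) U ⟨
  ∂ₑ (∑ U (λ s → (p , s) ▷ K s z)) ∎≈)
  where
  ∑-In : In (_∈ p ∷ U) (suc (suc d)) (∑ U (λ s → (p , s) ▷ K s z))
  ∑-In = go U id
    where
    go : ∀ l → (∀ {v} → v ∈ l → v ∈ U) → In (_∈ p ∷ U) (suc (suc d)) (∑ l (λ s → (p , s) ▷ K s z))
    go [] f = in𝟎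
    go (s ∷ l) f = in⊕ (in▷ (here refl) (there (f (here refl))) (λ { refl → p∉ (f (here refl)) })
      (In-mono (λ (v , vs) → (there v , λ { refl → p∉ v }) , vs) (In-K s i))) (go l (f ∘ there))
  swapped : ∀ {s} → s ∈ U → mapC (sw p s) z ≈ K s z ⊕ ∑ U (λ x → (p , x) ▷ L s x z)
  swapped {s} s∈ = ≈-trans (mapC-cong _ (split s u id i)) (≈-trans (⊕-cong (≈-trans (∑-hom (hom-map (sw p s)) U) (∑-cong-∈ U step)) fixK) (⊕-comm _ _))
    where
    fixK : mapC (sw p s) (K s z) ≈ K s z
    fixK = mapC-id (λ (v , vs) → sw-o (λ { refl → p∉ v }) vs) (In-K s i)
    step : ∀ {x} → x ∈ U → (sw p s s , sw p s x) ▷ mapC (sw p s) (L s x z) ≈ (p , x) ▷ L s x z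
    step {x} x∈ with x ≟ s
    ... | yes refl = ≈-trans (▷-elim (mapC-cong _ (L-loop i))) (≈-sym (▷-elim (L-loop i)))
    ... | no n = ≈-trans (≡⇒≈ (cong (_▷ mapC (sw p s) (L s x z)) (cong₂ _,_ (sw-r p s) (sw-o (λ { refl → p∉ x∈ }) n))))
                   (▷-cong _ (mapC-id (λ ((v , vs) , vx) → sw-o (λ { refl → p∉ v }) vs) (In-L s x i)))
  bdry : ∀ s → ∂ₑ ((p , s) ▷ K s z) ≈ K s z ⊕ ∑ U (λ x → (p , s) ▷ L s x z)
  bdry s = ⊕-cong (⊙-idˡ _) (≈-trans (⊙-cong _ (▷-cong _ (∂K s u id (i , cyc)))) (≈-trans (⊖⊖ ((p , s)) (∑ U (λ x → L s x z))) (∑-hom (hom▷ _) U)))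
    where
    ⊖⊖ : ∀ t a → ⊖ (t ▷ ⊖ a) ≈ t ▷ a
    ⊖⊖ t a .at φ A = l ⟨ t ▷ a ∣ φ ⟩
      where l : ∀ x → -1ℤ ℤ.* (-1ℤ ℤ.* x) ≡ x
            l = solve-∀

-- Deciding identities between explicit chains

sameᵇ : List E → List E → Bool
sameᵇ [] [] = true
sameᵇ ((a , b) ∷ σ) ((c , d) ∷ τ) = (a ≡ᵇ c) ∧ (b ≡ᵇ d) ∧ sameᵇ σ τ
sameᵇ _ _ = false

∧-true : ∀ {a b} → a ∧ b ≡ true → a ≡ true × b ≡ true
∧-true {true} h = refl , h

≡ᵇ-sound : ∀ a b → (a ≡ᵇ b) ≡ true → a ≡ b
≡ᵇ-sound a b h = ℕₚ.≡ᵇ⇒≡ a b (subst T (sym h) tt)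

sameᵇ-sound : ∀ σ τ → sameᵇ σ τ ≡ true → σ ≡ τ
sameᵇ-sound [] [] h = refl
sameᵇ-sound ((a , b) ∷ σ) ((c , d) ∷ τ) h =
  let p , h₁ = ∧-true {a ≡ᵇ c} h ; q , r = ∧-true {b ≡ᵇ d} h₁ in
  cong₂ _∷_ (cong₂ _,_ (≡ᵇ-sound a c p) (≡ᵇ-sound b d q)) (sameᵇ-sound σ τ r)

Terms : Set
Terms = List (ℤ × List E)

val : Terms → Fn → ℤ
val [] φ = 0ℤ
val ((k , σ) ∷ l) φ = k ℤ.* φ σ ℤ.+ val l φ

flat : Ch → Terms
flat 𝟎 = []
flat vac = (1ℤ , []) ∷ []
flat (e ▷ a) = map (λ (k , σ) → k , e ∷ σ) (flat a)
flat (a ⊕ b) = flat a ++ flat b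
flat (k ⊙ a) = map (λ (m , σ) → k ℤ.* m , σ) (flat a)

val-++ : ∀ l m φ → val (l ++ m) φ ≡ val l φ ℤ.+ val m φ
val-++ [] m φ = sym (ℤₚ.+-identityˡ _)
val-++ ((k , σ) ∷ l) m φ = trans (cong (λ ○ → k ℤ.* φ σ ℤ.+ ○) (val-++ l m φ)) (sym (ℤₚ.+-assoc (k ℤ.* φ σ) _ _))

val-▷ : ∀ l e φ → val (map (λ (k , σ) → k , e ∷ σ) l) φ ≡ val l (φ ∘ (e ∷_))
val-▷ [] e φ = refl
val-▷ ((k , σ) ∷ l) e φ = cong (λ ○ → k ℤ.* φ (e ∷ σ) ℤ.+ ○) (val-▷ l e φ)

val-⊙ : ∀ l k φ → val (map (λ (m , σ) → k ℤ.* m , σ) l) φ ≡ k ℤ.* val l φ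
val-⊙ [] k φ = sym (ℤₚ.*-zeroʳ k)
val-⊙ ((m , σ) ∷ l) k φ = trans (cong (λ ○ → k ℤ.* m ℤ.* φ σ ℤ.+ ○) (val-⊙ l k φ)) (lem k m (φ σ) (val l φ))
  where lem : ∀ k m x y → k ℤ.* m ℤ.* x ℤ.+ k ℤ.* y ≡ k ℤ.* (m ℤ.* x ℤ.+ y)
        lem = solve-∀

flat-val : ∀ a φ → ⟨ a ∣ φ ⟩ ≡ val (flat a) φ
flat-val 𝟎 φ = refl
flat-val vac φ = sym (trans (ℤₚ.+-identityʳ _) (ℤₚ.*-identityˡ _))
flat-val (e ▷ a) φ = trans (flat-val a _) (sym (val-▷ (flat a) e φ))
flat-val (a ⊕ b) φ = trans (cong₂ ℤ._+_ (flat-val a φ) (flat-val b φ)) (sym (val-++ (flat a) _ φ))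
flat-val (k ⊙ a) φ = trans (cong (k ℤ.*_) (flat-val a φ)) (sym (val-⊙ (flat a) k φ))

orient : E → E
orient (a , b) = if b <ᵇ a then b , a else (a , b)

-- Comparing first ends is enough: in a matching they are distinct once each edge starts with its
-- smaller end. Soundness does not depend on the order chosen, only the success of the check does.
insert : E → List E → ℤ × List E
insert e [] = 1ℤ , e ∷ []
insert e (t ∷ σ) = if proj₁ e <ᵇ proj₁ t then (1ℤ , e ∷ t ∷ σ)
  else (let k , τ = insert e σ in - k , t ∷ τ)

sort : List E → ℤ × List E
sort [] = 1ℤ , []
sort (e ∷ σ) = let k , τ = sort σ ; m , ρ = insert (orient e) τ in k ℤ.* m , ρ

insert-val : ∀ e σ {φ} → Alt φ → φ (e ∷ σ) ≡ proj₁ (insert e σ) ℤ.* φ (proj₂ (insert e σ))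
insert-val e [] A = sym (ℤₚ.*-identityˡ _)
insert-val e (t ∷ σ) {φ} A with proj₁ e <ᵇ proj₁ t
... | true = sym (ℤₚ.*-identityˡ _)
... | false = trans (Alt.swap A [] e t σ) (trans (cong -_ (insert-val e σ (Alt-∷ A t))) (ℤₚ.neg-distribˡ-* (proj₁ (insert e σ)) _))

orient-val : ∀ e σ {φ} → Alt φ → φ (e ∷ σ) ≡ φ (orient e ∷ σ)
orient-val (a , b) σ A with b <ᵇ a
... | true = Alt.flip A [] (a , b) σ
... | false = refl

sort-val : ∀ σ {φ} → Alt φ → φ σ ≡ proj₁ (sort σ) ℤ.* φ (proj₂ (sort σ))
sort-val [] A = sym (ℤₚ.*-identityˡ _)
sort-val (e ∷ σ) {φ} A = trans (orient-val e σ A) (trans (sort-val σ (Alt-∷ A (orient e)))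
  (trans (cong (proj₁ (sort σ) ℤ.*_) (insert-val (orient e) (proj₂ (sort σ)) A)) (sym (ℤₚ.*-assoc (proj₁ (sort σ)) _ _))))

normal : Terms → Terms
normal = map λ (k , σ) → let m , τ = sort σ in k ℤ.* m , τ

normal-val : ∀ l {φ} → Alt φ → val l φ ≡ val (normal l) φ
normal-val [] A = refl
normal-val ((k , σ) ∷ l) A = cong₂ ℤ._+_ (trans (cong (k ℤ.*_) (sort-val σ A)) (sym (ℤₚ.*-assoc k _ _))) (normal-val l A)

extract : List E → Terms → ℤ × Terms
extract σ [] = 0ℤ , []
extract σ ((k , τ) ∷ l) = let m , r = extract σ l in
  if sameᵇ σ τ then (k ℤ.+ m , r) else (m , (k , τ) ∷ r)

extract-val : ∀ σ l φ → val l φ ≡ proj₁ (extract σ l) ℤ.* φ σ ℤ.+ val (proj₂ (extract σ l)) φ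
extract-val σ [] φ = sym (trans (ℤₚ.+-identityʳ _) (ℤₚ.*-zeroˡ (φ σ)))
extract-val σ ((k , τ) ∷ l) φ with sameᵇ σ τ in eq
... | true rewrite sameᵇ-sound σ τ eq = trans (cong (λ ○ → k ℤ.* φ τ ℤ.+ ○) (extract-val τ l φ)) (lem k (proj₁ (extract τ l)) (φ τ) _)
  where lem : ∀ k m x y → k ℤ.* x ℤ.+ (m ℤ.* x ℤ.+ y) ≡ (k ℤ.+ m) ℤ.* x ℤ.+ y
        lem = solve-∀
... | false = trans (cong (λ ○ → k ℤ.* φ τ ℤ.+ ○) (extract-val σ l φ)) (lem (k ℤ.* φ τ) (proj₁ (extract σ l) ℤ.* φ σ) _)
  where lem : ∀ x y z → x ℤ.+ (y ℤ.+ z) ≡ y ℤ.+ (x ℤ.+ z)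
        lem = solve-∀

-- The number is fuel, since `extract` does not return a structural sublist; the length of the list
-- suffices.
cancels : ℕ → Terms → Bool
cancels _ [] = true
cancels zero (_ ∷ _) = false
cancels (suc n) ((k , σ) ∷ l) = let m , r = extract σ l in does (k ℤ.+ m ℤ.≟ 0ℤ) ∧ cancels n r

cancels-val : ∀ n l φ → cancels n l ≡ true → val l φ ≡ 0ℤ
cancels-val n [] φ _ = refl
cancels-val (suc n) ((k , σ) ∷ l) φ h with k ℤ.+ proj₁ (extract σ l) ℤ.≟ 0ℤ
... | yes q = trans (cong (λ ○ → k ℤ.* φ σ ℤ.+ ○) (extract-val σ l φ)) (trans (lem k (proj₁ (extract σ l)) (φ σ) (val (proj₂ (extract σ l)) φ))
      (trans (cong₂ (λ x y → x ℤ.* φ σ ℤ.+ y) q (cancels-val n (proj₂ (extract σ l)) φ h)) (trans (ℤₚ.+-identityʳ _) (ℤₚ.*-zeroˡ (φ σ)))))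
  where lem : ∀ k m x y → k ℤ.* x ℤ.+ (m ℤ.* x ℤ.+ y) ≡ (k ℤ.+ m) ℤ.* x ℤ.+ y
        lem = solve-∀

agrees : Ch → Ch → Bool
agrees a b = let l = normal (flat (a ⊕ ⊖ b)) in cancels (length l) l

-- Proof by reflection: both sides are expanded into signed sorted simplices whose coefficients are
-- compared. The explicit fillings are all certified in this way.
compute : ∀ a b → agrees a b ≡ true → a ≈ b
compute a b h .at φ A = lem _ _ (trans (flat-val (a ⊕ ⊖ b) φ) (trans (normal-val (flat (a ⊕ ⊖ b)) A) (cancels-val _ (normal (flat (a ⊕ ⊖ b))) φ h)))
  where lem : ∀ x y → x ℤ.+ -1ℤ ℤ.* y ≡ 0ℤ → x ≡ y
        lem x y q = trans (l₁ x y) (trans (cong (ℤ._+ y) q) (ℤₚ.+-identityˡ y))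
          where l₁ : ∀ x y → x ≡ (x ℤ.+ -1ℤ ℤ.* y) ℤ.+ y
                l₁ = solve-∀

inside : (ℕ → Bool) → ℕ → Ch → Bool
inside p d 𝟎 = true
inside p zero vac = true
inside p (suc d) vac = false
inside p zero (e ▷ a) = false
inside p (suc d) ((x , y) ▷ a) = p x ∧ p y ∧ not (x ≡ᵇ y) ∧ inside (λ v → p v ∧ not (v ≡ᵇ x) ∧ not (v ≡ᵇ y)) d a
inside p d (a ⊕ b) = inside p d a ∧ inside p d b
inside p d (k ⊙ a) = inside p d a

≢ᵇ-sound : ∀ {x y} → not (x ≡ᵇ y) ≡ true → x ≢ y
≢ᵇ-sound {x} h refl with x ≡ᵇ x in eq
... | false = subst T eq (ℕₚ.≡⇒≡ᵇ x x refl)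

inside-In : ∀ p d a → inside p d a ≡ true → In (λ v → p v ≡ true) d a
inside-In p d 𝟎 h = in𝟎
inside-In p zero vac h = invac
inside-In p (suc d) ((x , y) ▷ a) h =
  let px , h₁ = ∧-true {p x} h ; py , h₂ = ∧-true {p y} h₁ ; n , i = ∧-true {not (x ≡ᵇ y)} h₂ in
  in▷ px py (≢ᵇ-sound n) (In-mono (λ {v} q → let pv , q₁ = ∧-true {p v} q ; m , k = ∧-true {not (v ≡ᵇ x)} q₁ in (pv , ≢ᵇ-sound m) , ≢ᵇ-sound k) (inside-In _ d a i))
inside-In p d (a ⊕ b) h = let i , j = ∧-true {inside p d a} h in in⊕ (inside-In p d a i) (inside-In p d b j)
inside-In p d (k ⊙ a) h = in⊙ k (inside-In p d a h)

In< : ∀ n d a → inside (_<ᵇ n) d a ≡ true → In (_< n) d a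
In< n d a h = In-mono (λ {v} q → ℕₚ.<ᵇ⇒< v n (subst T (sym q) tt)) (inside-In (_<ᵇ n) d a h)

-- The graph M_5 is the Petersen graph; this is the 5-cycle through the points ab, cd, be, ac, de,
-- in that order, hence a cycle of type [5,2].
pent : ℕ → ℕ → ℕ → ℕ → ℕ → Ch
pent a b c d e = (a , b) ▷ (c , d) ▷ vac ⊕ (c , d) ▷ (b , e) ▷ vac ⊕ (b , e) ▷ (a , c) ▷ vac ⊕ (a , c) ▷ (d , e) ▷ vac ⊕ (d , e) ▷ (a , b) ▷ vac

simplex : List ℕ → Ch
simplex (a ∷ b ∷ l) = (a , b) ▷ simplex l
simplex _ = vac

combine : List (ℤ × Ch) → Ch
combine [] = 𝟎
combine ((k , a) ∷ l) = k ⊙ a ⊕ combine l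

lab : List ℕ → ℕ → ℕ
lab [] n = 0
lab (v ∷ vs) zero = v
lab (v ∷ vs) (suc n) = lab vs n

-- The fillings below were found by integer linear algebra.

tri²-pents : List (ℤ × List ℕ)
tri²-pents =
    (-[1+ 0 ] , 0 ∷ 1 ∷ 2 ∷ 4 ∷ 3 ∷ 5 ∷ [])
  ∷ (+ 1 , 2 ∷ 0 ∷ 1 ∷ 3 ∷ 5 ∷ 4 ∷ [])
  ∷ (-[1+ 1 ] , 2 ∷ 0 ∷ 1 ∷ 5 ∷ 3 ∷ 4 ∷ [])
  ∷ (-[1+ 1 ] , 3 ∷ 0 ∷ 1 ∷ 4 ∷ 5 ∷ 2 ∷ [])
  ∷ (-[1+ 1 ] , 3 ∷ 0 ∷ 2 ∷ 4 ∷ 1 ∷ 5 ∷ [])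
  ∷ (+ 2 , 3 ∷ 0 ∷ 2 ∷ 4 ∷ 5 ∷ 1 ∷ [])
  ∷ (-[1+ 1 ] , 3 ∷ 0 ∷ 2 ∷ 5 ∷ 4 ∷ 1 ∷ [])
  ∷ (+ 1 , 4 ∷ 0 ∷ 1 ∷ 3 ∷ 5 ∷ 2 ∷ [])
  ∷ []

tri²-filling₆ : Ch
tri²-filling₆ = combine
  ( (-[1+ 0 ] , simplex (0 ∷ 1 ∷ 2 ∷ 5 ∷ 3 ∷ 4 ∷ []))
  ∷ (+ 1 , simplex (0 ∷ 3 ∷ 1 ∷ 2 ∷ 4 ∷ 5 ∷ []))
  ∷ (+ 1 , simplex (0 ∷ 3 ∷ 1 ∷ 4 ∷ 2 ∷ 5 ∷ []))
  ∷ (-[1+ 1 ] , simplex (0 ∷ 5 ∷ 1 ∷ 2 ∷ 3 ∷ 4 ∷ []))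
  ∷ [])

-- The first entry of the list is the vertex that the pentagon leaves free. It is dropped here, but
-- it supplies the factor [1,0] when two factors [3,1] are traded for a pentagon.
pentOf : List ℕ → Ch
pentOf (x ∷ a ∷ b ∷ c ∷ d ∷ e ∷ _) = pent a b c d e
pentOf _ = 𝟎

tri²-as-pents : + 3 ⊙ (tri 0 1 2 ⋀ tri 3 4 5) ≈ combine (map (λ (k , l) → k , pentOf l) tri²-pents) ⊕ ∂ₑ tri²-filling₆
tri²-as-pents = compute _ _ refl

tri²-filling₇ : Ch
tri²-filling₇ = combine
  ( (-[1+ 1 ] , simplex (0 ∷ 1 ∷ 2 ∷ 5 ∷ 3 ∷ 4 ∷ []))
  ∷ (+ 2 , simplex (0 ∷ 1 ∷ 2 ∷ 5 ∷ 3 ∷ 6 ∷ []))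
  ∷ (-[1+ 0 ] , simplex (0 ∷ 1 ∷ 2 ∷ 6 ∷ 3 ∷ 4 ∷ []))
  ∷ (+ 1 , simplex (0 ∷ 1 ∷ 2 ∷ 6 ∷ 4 ∷ 5 ∷ []))
  ∷ (+ 2 , simplex (0 ∷ 1 ∷ 3 ∷ 6 ∷ 4 ∷ 5 ∷ []))
  ∷ (-[1+ 0 ] , simplex (0 ∷ 4 ∷ 1 ∷ 2 ∷ 3 ∷ 5 ∷ []))
  ∷ (+ 1 , simplex (0 ∷ 4 ∷ 1 ∷ 2 ∷ 3 ∷ 6 ∷ []))
  ∷ (-[1+ 0 ] , simplex (0 ∷ 4 ∷ 1 ∷ 3 ∷ 2 ∷ 5 ∷ []))
  ∷ (+ 1 , simplex (0 ∷ 4 ∷ 1 ∷ 3 ∷ 2 ∷ 6 ∷ []))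
  ∷ (-[1+ 0 ] , simplex (0 ∷ 4 ∷ 2 ∷ 5 ∷ 3 ∷ 6 ∷ []))
  ∷ (+ 1 , simplex (0 ∷ 4 ∷ 2 ∷ 6 ∷ 3 ∷ 5 ∷ []))
  ∷ (-[1+ 0 ] , simplex (0 ∷ 5 ∷ 1 ∷ 2 ∷ 3 ∷ 4 ∷ []))
  ∷ (+ 1 , simplex (0 ∷ 5 ∷ 1 ∷ 2 ∷ 3 ∷ 6 ∷ []))
  ∷ (+ 1 , simplex (0 ∷ 5 ∷ 1 ∷ 4 ∷ 2 ∷ 6 ∷ []))
  ∷ (-[1+ 0 ] , simplex (0 ∷ 5 ∷ 1 ∷ 4 ∷ 3 ∷ 6 ∷ []))
  ∷ (+ 1 , simplex (0 ∷ 5 ∷ 2 ∷ 6 ∷ 3 ∷ 4 ∷ []))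
  ∷ (-[1+ 1 ] , simplex (0 ∷ 6 ∷ 1 ∷ 2 ∷ 3 ∷ 4 ∷ []))
  ∷ (+ 1 , simplex (0 ∷ 6 ∷ 1 ∷ 2 ∷ 3 ∷ 5 ∷ []))
  ∷ (+ 1 , simplex (0 ∷ 6 ∷ 1 ∷ 2 ∷ 4 ∷ 5 ∷ []))
  ∷ (+ 1 , simplex (0 ∷ 6 ∷ 1 ∷ 3 ∷ 2 ∷ 5 ∷ []))
  ∷ (-[1+ 0 ] , simplex (0 ∷ 6 ∷ 1 ∷ 3 ∷ 4 ∷ 5 ∷ []))
  ∷ (+ 1 , simplex (0 ∷ 6 ∷ 1 ∷ 4 ∷ 2 ∷ 5 ∷ []))
  ∷ (-[1+ 0 ] , simplex (0 ∷ 6 ∷ 1 ∷ 4 ∷ 3 ∷ 5 ∷ []))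
  ∷ (+ 2 , simplex (0 ∷ 6 ∷ 2 ∷ 5 ∷ 3 ∷ 4 ∷ []))
  ∷ (-[1+ 1 ] , simplex (1 ∷ 2 ∷ 3 ∷ 6 ∷ 4 ∷ 5 ∷ []))
  ∷ (-[1+ 0 ] , simplex (1 ∷ 3 ∷ 2 ∷ 6 ∷ 4 ∷ 5 ∷ []))
  ∷ (-[1+ 0 ] , simplex (1 ∷ 4 ∷ 2 ∷ 5 ∷ 3 ∷ 6 ∷ []))
  ∷ (-[1+ 0 ] , simplex (1 ∷ 4 ∷ 2 ∷ 6 ∷ 3 ∷ 5 ∷ []))
  ∷ [])

-- The group H̃_1 of M_7 has order 3, so a multiple by 3 must bound as soon as a seventh vertex,
-- here 6, is available.
tri²-torsion : + 3 ⊙ (tri 0 1 2 ⋀ tri 3 4 5) ≈ ∂ₑ tri²-filling₇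
tri²-torsion = compute _ _ refl

-- Homology away from 2 and 3

-- Homology with 6 inverted, as a closure: `bdy` trivialises boundaries and `div` allows division by
-- 6. The span of no generators, `Nul`, thus consists of the chains that bound after multiplication
-- by a power of 6; see `nul-bounds`.
data Span (G : Ch → Set) (P : ℕ → Set) (d : ℕ) : Ch → Set where
  gen : ∀ {a} → G a → Span G P d a
  bdy : ∀ {h} → In P (suc d) h → Span G P d (∂ₑ h)
  add : ∀ {a b} → Span G P d a → Span G P d b → Span G P d (a ⊕ b)
  scl : ∀ {a} k → Span G P d a → Span G P d (k ⊙ a)
  rsp : ∀ {a b} → a ≈ b → Span G P d a → Span G P d b
  div : ∀ {a} → Span G P d (+ 6 ⊙ a) → Span G P d a

Nul : (ℕ → Set) → ℕ → Ch → Set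
Nul = Span (λ _ → ⊥)

span-𝟎 : ∀ {G P d a} → a ≈ 𝟎 → Span G P d a
span-𝟎 e = rsp (≈-sym e) (bdy in𝟎)

span-neg : ∀ {G P d a} → Span G P d a → Span G P d (⊖ a)
span-neg = scl -1ℤ

span-∑ : ∀ {A : Set} {G P d} (l : List A) {f : A → Ch} → (∀ {x} → x ∈ l → Span G P d (f x)) → Span G P d (∑ l f)
span-∑ [] p = span-𝟎 ≈-refl
span-∑ (x ∷ l) p = add (p (here refl)) (span-∑ l (p ∘ there))

div-by : ∀ {G P d a} k m → k ℤ.* m ≡ + 6 → Span G P d (k ⊙ a) → Span G P d a
div-by {a = a} k m e s = div (rsp (≈-trans (⊙-assoc m k a) (≡⇒≈ (cong (_⊙ a) (trans (ℤₚ.*-comm m k) e)))) (scl m s))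

record Lin (F : Ch → Ch) : Set where
  field
    l≈ : ∀ {a b} → a ≈ b → F a ≈ F b
    l⊕ : ∀ a b → F (a ⊕ b) ≈ F a ⊕ F b
    l⊙ : ∀ k a → F (k ⊙ a) ≈ k ⊙ F a
open Lin

span-lin : ∀ {F G H P Q d e} → Lin F → (∀ {a} → G a → Span H Q e (F a)) → (∀ {h} → In P (suc d) h → Span H Q e (F (∂ₑ h))) →
           ∀ {a} → Span G P d a → Span H Q e (F a)
span-lin l g b (gen x) = g x
span-lin l g b (bdy i) = b i
span-lin l g b (add s t) = rsp (≈-sym (l⊕ l _ _)) (add (span-lin l g b s) (span-lin l g b t))
span-lin l g b (scl k s) = rsp (≈-sym (l⊙ l k _)) (scl k (span-lin l g b s))
span-lin l g b (rsp e s) = rsp (l≈ l e) (span-lin l g b s)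
span-lin l g b (div s) = div (rsp (l⊙ l _ _) (span-lin l g b s))

lin-id : Lin id
lin-id = record { l≈ = id ; l⊕ = λ _ _ → ≈-refl ; l⊙ = λ _ _ → ≈-refl }

lin-map : ∀ f → Lin (mapC f)
lin-map f = record { l≈ = mapC-cong f ; l⊕ = λ _ _ → ≈-refl ; l⊙ = λ _ _ → ≈-refl }

lin-⋀ˡ : ∀ b → Lin (_⋀ b)
lin-⋀ˡ b = record { l≈ = ⋀-congˡ b ; l⊕ = λ _ _ → ≈-refl ; l⊙ = λ _ _ → ≈-refl }

lin-⋀ʳ : ∀ a → Lin (a ⋀_)
lin-⋀ʳ a = record { l≈ = ⋀-congʳ a ; l⊕ = ⋀-⊕ʳ a ; l⊙ = ⋀-⊙ʳ a }

span-bind : ∀ {G H P Q d} → (∀ {v} → P v → Q v) → (∀ {a} → G a → Span H Q d a) → ∀ {a} → Span G P d a → Span H Q d a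
span-bind i g = span-lin lin-id g (bdy ∘ In-mono i)

nul-map : ∀ {P Q : ℕ → Set} {f d} → (∀ {x} → P x → Q (f x)) → (∀ {x y} → P x → P y → f x ≡ f y → x ≡ y) →
          ∀ {a} → Nul P d a → Nul Q d (mapC f a)
nul-map {f = f} i j = span-lin (lin-map f) (λ ()) λ {h} k → rsp (≡⇒≈ (sym (mapC-∂ f h))) (bdy (mapC-In i j k))

∂-⋀ʳ : ∀ {P d h} w → In P d h → ∂ₑ w ≈ 𝟎 → ∂ₑ (h ⋀ w) ≈ ∂ₑ h ⋀ w
∂-⋀ʳ {h = h} w i c = ≈-trans (D-⋀ (λ _ → refl) w i) (⊕-elimʳ (⊙-𝟎 (≈-trans (⋀-congʳ h c) (⋀-𝟎 h))))

∂-⋀ˡ : ∀ {P d w} h → In P d w → ∂ₑ w ≈ 𝟎 → ∂ₑ (w ⋀ h) ≈ sgn d ⊙ (w ⋀ ∂ₑ h)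
∂-⋀ˡ {w = w} h i c = ≈-trans (D-⋀ (λ _ → refl) h i) (⊕-elimˡ (⋀-congˡ h c))

sgn² : ∀ d → sgn d ℤ.* sgn d ≡ 1ℤ
sgn² zero = refl
sgn² (suc d) = trans (lem (sgn d)) (sgn² d)
  where lem : ∀ x → - x ℤ.* - x ≡ x ℤ.* x
        lem = solve-∀

bdy-⋀ʳ : ∀ {G P Q R d e w} → Disjoint P Q → (∀ {v} → P v → R v) → (∀ {v} → Q v → R v) → Cyc Q e w →
         ∀ {h} → In P (suc d) h → Span G R (d + e) (∂ₑ h ⋀ w)
bdy-⋀ʳ D i j (wi , wc) hi = rsp (∂-⋀ʳ _ hi wc) (bdy (In-⋀ D i j hi wi))

bdy-⋀ˡ : ∀ {G P Q R d e w} → Disjoint Q P → (∀ {v} → P v → R v) → (∀ {v} → Q v → R v) → Cyc Q e w →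
         ∀ {h} → In P (suc d) h → Span G R (e + d) (w ⋀ ∂ₑ h)
bdy-⋀ˡ {R = R} {d} {e} {w} D i j (wi , wc) {h} hi =
  rsp (≈-trans (⊙-cong (sgn e) (∂-⋀ˡ h wi wc)) (≈-trans (⊙-assoc _ _ _) (≈-trans (≡⇒≈ (cong (_⊙ _) (sgn² e))) (⊙-idˡ _))))
    (scl (sgn e) (bdy (subst (λ n → In R n (w ⋀ h)) (ℕₚ.+-suc e d) (In-⋀ D j i wi hi))))

nul-⋀ʳ : ∀ {P Q R d e w} → Disjoint P Q → (∀ {v} → P v → R v) → (∀ {v} → Q v → R v) → Cyc Q e w →
         ∀ {a} → Nul P d a → Nul R (d + e) (a ⋀ w)
nul-⋀ʳ D i j w = span-lin (lin-⋀ˡ _) (λ ()) (bdy-⋀ʳ D i j w)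

-- Sums over vertices and sums of transpositions

∑-unique : ∀ {l m} → Unique l → Unique m → (∀ {x} → x ∈ l → x ∈ m) → (∀ {x} → x ∈ m → x ∈ l) → (f : ℕ → Ch) → ∑ l f ≈ ∑ m f
∑-unique {l} {m} ul um i j f =
  ∑ l f                                           ≈⟨ ∑-cong-∈ l (λ {x} x∈ → pick um (i x∈)) ⟨
  -- A double sum against the Kronecker delta, evaluated in both orders, makes it unnecessary to
  -- permute one list into the other.
  ∑ l (λ x → ∑ m (λ y → ι (x ≟ y) ⊙ f y))         ≈⟨ ∑-swap l m _ ⟩
  ∑ m (λ y → ∑ l (λ x → ι (x ≟ y) ⊙ f y))         ≈⟨ ∑-cong-∈ m (λ {y} y∈ → ≈-trans (∑-delta ul (j y∈) _ λ {x} _ n → off x y n) (on y)) ⟩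
  ∑ m f ∎≈
  where
  on : ∀ y → ι (y ≟ y) ⊙ f y ≈ f y
  on y = ≈-trans (≡⇒≈ (cong (_⊙ f y) (ι-yes (y ≟ y) refl))) (⊙-idˡ _)
  off : ∀ x y → x ≢ y → ι (x ≟ y) ⊙ f y ≈ 𝟎
  off x y n = ≈-trans (≡⇒≈ (cong (_⊙ f y) (ι-no (x ≟ y) n))) (⊙-zeroˡ _)
  pick : ∀ {m x} → Unique m → x ∈ m → ∑ m (λ y → ι (x ≟ y) ⊙ f y) ≈ f x
  pick {x = x} um x∈ = ≈-trans (∑-delta um x∈ _ λ {y} _ n → off x y (≢-sym n)) (on x)

∑-patch : ∀ {A : Set} {l : List A} {y} → Unique l → y ∈ l → (f g : A → Ch) → (∀ {x} → x ∈ l → x ≢ y → f x ≈ g x) → ∑ l f ⊕ g y ≈ ∑ l g ⊕ f y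
∑-patch {l = x ∷ l} {y} (u ∷ U) (here refl) f g p = ≈-trans (⊕-cong (⊕-cong ≈-refl (∑-cong-∈ l λ z∈ → p (there z∈) λ { refl → All.lookup u z∈ refl })) ≈-refl) (rot (f x) (g x) (∑ l g))
  where
  rot : ∀ a b c → (a ⊕ c) ⊕ b ≈ (b ⊕ c) ⊕ a
  rot a b c .at φ A = lem ⟨ a ∣ φ ⟩ ⟨ b ∣ φ ⟩ ⟨ c ∣ φ ⟩
    where lem : ∀ a b c → (a ℤ.+ c) ℤ.+ b ≡ (b ℤ.+ c) ℤ.+ a
          lem = solve-∀
∑-patch {l = x ∷ l} {y} (u ∷ U) (there y∈) f g p = ≈-trans (⊕-assoc _ _ _) (≈-trans (⊕-cong (p (here refl) (All.lookup u y∈)) (∑-patch U y∈ f g (p ∘ there))) (≈-sym (⊕-assoc _ _ _)))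

-- An element of the group ring of the symmetric group. If `c` lies in `l`, the term at `c` is the
-- identity; without that term it is a Jucys-Murphy element.
X : List ℕ → ℕ → Ch → Ch
X l c y = ∑ l (λ i → mapC (sw c i) y)

lin-∑ : ∀ l {F : ℕ → Ch → Ch} → (∀ i → Lin (F i)) → Lin (λ y → ∑ l (λ i → F i y))
lin-∑ l {F} h .l≈ e = ∑-cong l λ i → l≈ (h i) e
lin-∑ l {F} h .l⊕ a b = ≈-trans (∑-cong l λ i → l⊕ (h i) a b) (∑-⊕ l _ _)
lin-∑ l {F} h .l⊙ k a = ≈-trans (∑-cong l λ i → l⊙ (h i) k a) (≈-sym (∑-hom (hom⊙ k) l))

lin-X : ∀ l c → Lin (X l c)
lin-X l c = lin-∑ l (λ i → lin-map (sw c i))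

∑-++ : ∀ {A : Set} (l m : List A) (f : A → Ch) → ∑ (l ++ m) f ≈ ∑ l f ⊕ ∑ m f
∑-++ [] m f = ≈-sym ⊕-idˡ
∑-++ (x ∷ l) m f = ≈-trans (⊕-cong ≈-refl (∑-++ l m f)) (≈-sym (⊕-assoc _ _ _))

sw-involutive : ∀ a b x → sw a b (sw a b x) ≡ x
sw-involutive a b x with x ≟ a | x ≟ b
... | yes refl | _ = trans (cong (sw x b) (sw-l x b)) (sw-r x b)
... | no _ | yes refl = trans (cong (sw a x) (sw-r a x)) (sw-l a x)
... | no m | no n = trans (cong (sw a b) (sw-o m n)) (sw-o m n)

sw-inj : ∀ a b {x y} → sw a b x ≡ sw a b y → x ≡ y
sw-inj a b {x} {y} e = trans (sym (sw-involutive a b x)) (trans (cong (sw a b) e) (sw-involutive a b y))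

sw-closed : ∀ {P : ℕ → Set} {a b} → P a → P b → ∀ {x} → P x → P (sw a b x)
sw-closed {P} {a} {b} pa pb {x} px with x ≟ a | x ≟ b
... | yes refl | _ = subst P (sym (sw-l x b)) pb
... | no _ | yes refl = subst P (sym (sw-r a x)) pa
... | no m | no n = subst P (sym (sw-o m n)) px

sw-self : ∀ c x → sw c c x ≡ x
sw-self c x with x ≟ c
... | yes refl = sw-l x x
... | no n = sw-o n n

sw-braid : ∀ {a b c} → a ≢ b → a ≢ c → b ≢ c → ∀ x → sw c b (sw c a x) ≡ sw c a (sw a b x)
sw-braid {a} {b} {c} ab ac bc x with x ≟ a | x ≟ b | x ≟ c
... | yes refl | _ | _ = trans (cong (sw c b) (sw-r c a)) (trans (sw-l c b) (sym (trans (cong (sw c a) (sw-l a b)) (sw-o bc (≢-sym ab)))))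
... | no n | yes refl | _ = trans (cong (sw c b) (sw-o bc n)) (trans (sw-r c b) (sym (trans (cong (sw c a) (sw-r a b)) (sw-r c a))))
... | no n | no m | yes refl = trans (cong (sw c b) (sw-l c a)) (trans (sw-o ac ab) (sym (trans (cong (sw c a) (sw-o (≢-sym ac) (≢-sym bc))) (sw-l c a))))
... | no n | no m | no k = trans (cong (sw c b) (sw-o k n)) (trans (sw-o k m) (sym (trans (cong (sw c a) (sw-o n m)) (sw-o k n))))

sw-conj : ∀ {P : ℕ → Set} {f} → (∀ {x y} → P x → P y → f x ≡ f y → x ≡ y) → ∀ {a b} → P a → P b → ∀ {x} → P x → f (sw a b x) ≡ sw (f a) (f b) (f x)
sw-conj {f = f} j {a} {b} pa pb {x} px with x ≟ a | x ≟ b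
... | yes refl | _ = trans (cong f (sw-l x b)) (sym (sw-l (f x) (f b)))
... | no _ | yes refl = trans (cong f (sw-r a x)) (sym (sw-r (f a) (f x)))
... | no m | no n = trans (cong f (sw-o m n)) (sym (sw-o (m ∘ j px pa) (n ∘ j px pb)))

mapC-agree : ∀ {P f g} → (∀ {x} → P x → f x ≡ g x) → ∀ {d a} → In P d a → mapC f a ≈ mapC g a
mapC-agree p in𝟎 = ≈-refl
mapC-agree p invac = ≈-refl
mapC-agree {f = f} p (in▷ {a = a} px py n i) = ≈-trans (≡⇒≈ (cong (_▷ mapC f a) (cong₂ _,_ (p px) (p py)))) (▷-cong _ (mapC-agree (λ ((px , _) , _) → p px) i))
mapC-agree p (in⊕ a b) = ⊕-cong (mapC-agree p a) (mapC-agree p b)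
mapC-agree p (in⊙ k a) = ⊙-cong k (mapC-agree p a)
mapC-agree p (in≈ e a) = ≈-trans (mapC-cong _ (≈-sym e)) (≈-trans (mapC-agree p a) (mapC-cong _ e))

X-conj : ∀ {P : ℕ → Set} {f d y} → (∀ {x y} → P x → P y → f x ≡ f y → x ≡ y) → In P d y → ∀ l {c} → P c → (∀ {x} → x ∈ l → P x) →
         mapC f (X l c y) ≈ X (map f l) (f c) (mapC f y)
X-conj j i [] pc pl = ≈-refl
X-conj {f = f} {y = y} j i (x ∷ l) {c} pc pl = ⊕-cong
  (≈-trans (≡⇒≈ (mapC-∘ f _ y)) (≈-trans (mapC-agree (sw-conj j pc (pl (here refl))) i) (≡⇒≈ (sym (mapC-∘ _ f y)))))
  (X-conj j i l pc (pl ∘ there))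

-- Summing over all n vertices, the term i = c contributes y itself; hence the ⊖ y.
Good : ℕ → ℕ → ℕ → Ch → Set
Good n d c y = Nul (_< n) d (X (upTo n) c y ⊕ ⊖ y)

lin-X-id : ∀ l c → Lin (λ y → X l c y ⊕ ⊖ y)
lin-X-id l c .l≈ e = ⊕-cong (l≈ (lin-X l c) e) (⊙-cong _ e)
lin-X-id l c .l⊕ a b = ≈-trans (⊕-cong (l⊕ (lin-X l c) a b) (⊙-distˡ _ a b)) (⊕-inter _ _ _ _)
lin-X-id l c .l⊙ k a = ≈-trans (⊕-cong (l⊙ (lin-X l c) k a) (⊙-comm _ k a)) (≈-sym (⊙-distˡ k _ _))

nul-X : ∀ {P : ℕ → Set} {d c} l → P c → (∀ {x} → x ∈ l → P x) → ∀ {a} → Nul P d a → Nul P d (X l c a)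
nul-X {P} l pc pl s = span-∑ l λ {x} x∈ → nul-map (sw-closed {P} pc (pl x∈)) (λ _ _ → sw-inj _ _) s

upTo-< : ∀ n {x} → x ∈ upTo n → x < n
upTo-< n = ∈-upTo⁻

good-bdy : ∀ {n d c h} → c < n → In (_< n) (suc d) h → Good n d c (∂ₑ h)
good-bdy {n} c< i = add (nul-X (upTo n) c< (upTo-< n) (bdy i)) (span-neg (bdy i))

memᵇ : List ℕ → ℕ → Bool
memᵇ [] v = false
memᵇ (x ∷ l) v = (v ≡ᵇ x) ∨ memᵇ l v

memᵇ-sound : ∀ l {v} → memᵇ l v ≡ true → v ∈ l
memᵇ-sound (x ∷ l) {v} h with v ≡ᵇ x in eq
... | true = here (≡ᵇ-sound v x eq)
... | false = there (memᵇ-sound l h)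

memᵇ-complete : ∀ l {v} → v ∈ l → memᵇ l v ≡ true
memᵇ-complete (x ∷ l) {v} (here refl) with v ≡ᵇ v in eq
... | true = refl
... | false = ⊥-elim (subst T eq (ℕₚ.≡⇒≡ᵇ v v refl))
memᵇ-complete (x ∷ l) {v} (there i) with v ≡ᵇ x
... | true = refl
... | false = memᵇ-complete l i

all-∈ : ∀ {A : Set} {P : A → Bool} l → allᵇ P l ≡ true → ∀ {x} → x ∈ l → P x ≡ true
all-∈ {P = P} (x ∷ l) h (here refl) = proj₁ (∧-true {P x} h)
all-∈ {P = P} (x ∷ l) h (there i) = all-∈ l (proj₂ (∧-true {P x} h)) i

disjᵇˡ : List ℕ → List ℕ → Bool
disjᵇˡ l m = allᵇ (λ x → not (memᵇ m x)) l

disjᵇˡ-sound : ∀ l m → disjᵇˡ l m ≡ true → Disjoint (_∈ l) (_∈ m)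
disjᵇˡ-sound l m h {v} vl vm = case trans (sym (all-∈ l h vl)) (cong not (memᵇ-complete m vm)) of λ ()

uniqueᵇ : List ℕ → Bool
uniqueᵇ [] = true
uniqueᵇ (x ∷ l) = not (memᵇ l x) ∧ uniqueᵇ l

uniqueᵇ-sound : ∀ l → uniqueᵇ l ≡ true → Unique l
uniqueᵇ-sound [] h = []
uniqueᵇ-sound (x ∷ l) h = let p , q = ∧-true {not (memᵇ l x)} h in
  All.tabulate (λ { i refl → case trans (sym p) (cong not (memᵇ-complete l i)) of λ () }) ∷ uniqueᵇ-sound l q

subsetᵇ : List ℕ → List ℕ → Bool
subsetᵇ l m = allᵇ (memᵇ m) l

subsetᵇ-sound : ∀ l m → subsetᵇ l m ≡ true → ∀ {x} → x ∈ l → x ∈ m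
subsetᵇ-sound l m h = memᵇ-sound m ∘ all-∈ l h

inside-∈ : ∀ l d a → inside (memᵇ l) d a ≡ true → In (_∈ l) d a
inside-∈ l d a h = In-mono (memᵇ-sound l) (inside-In (memᵇ l) d a h)

spectatorᵇ : (n d c : ℕ) → List ℕ → (y y' h : Ch) → Bool
spectatorᵇ n d c U y y' h = uniqueᵇ (c ∷ U) ∧ subsetᵇ (c ∷ U) (upTo n) ∧ subsetᵇ (upTo n) (c ∷ U) ∧ inside (memᵇ U) (suc d) y'
  ∧ agrees (∂ₑ y') 𝟎 ∧ agrees y (y' ⊕ ∂ₑ h) ∧ inside (_<ᵇ n) (suc (suc d)) h

-- If `y` is homologous to a cycle `y'` that avoids `c`, then `transposition-sum` makes the
-- transpositions of `c` with the other vertices annihilate `y'`, and the term at `c` cancels the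
-- subtracted copy. The Boolean gathers these hypotheses so that they can be checked by evaluation.
good-spectator : ∀ n d c U y y' h → spectatorᵇ n d c U y y' h ≡ true → Good n (suc d) c y
good-spectator n d c U y y' h q =
  let q₁ , r₁ = ∧-true {uniqueᵇ (c ∷ U)} q ; q₂ , r₂ = ∧-true {subsetᵇ (c ∷ U) (upTo n)} r₁
      q₃ , r₃ = ∧-true {subsetᵇ (upTo n) (c ∷ U)} r₂ ; q₄ , r₄ = ∧-true {inside (memᵇ U) (suc d) y'} r₃
      q₅ , r₅ = ∧-true {agrees (∂ₑ y') 𝟎} r₄ ; q₆ , q₇ = ∧-true {agrees y (y' ⊕ ∂ₑ h)} r₅
      uu = uniqueᵇ-sound (c ∷ U) q₁
      i = subsetᵇ-sound (c ∷ U) (upTo n) q₂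
      j = subsetᵇ-sound (upTo n) (c ∷ U) q₃
      k , k-in , k-eq = transposition-sum (AllPairs.tail uu) (λ c∈ → All.lookup (AllPairs.head uu) c∈ refl)
                          (inside-∈ U (suc d) y' q₄ , compute _ _ q₅)
      y'-good : Good n (suc d) c y'
      y'-good = rsp (≈-sym (≈-trans (⊕-cong (≈-trans (∑-unique (UP.upTo⁺ n) uu j i _) (⊕-cong (≈-trans (≡⇒≈ (mapC-ext (sw-self c) y')) (mapC-id (λ _ → refl) (inside-∈ U (suc d) y' q₄))) k-eq)) ≈-refl) (cancel y' (∂ₑ k))))
                  (bdy (In-mono (upTo-< n ∘ i) k-in))
  in rsp (≈-sym (l≈ (lin-X-id (upTo n) c) (compute _ _ q₆))) (rsp (≈-sym (l⊕ (lin-X-id (upTo n) c) y' (∂ₑ h)))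
       (add y'-good (good-bdy (upTo-< n (i (here refl))) (In< n _ h q₇))))
  where
  cancel : ∀ a b → (a ⊕ b) ⊕ ⊖ a ≈ b
  cancel a b .at φ A = lem ⟨ a ∣ φ ⟩ ⟨ b ∣ φ ⟩
    where lem : ∀ a b → (a ℤ.+ b) ℤ.+ -1ℤ ℤ.* a ≡ b
          lem = solve-∀

-- Exponent 5

tri³ : List ℕ → Ch
tri³ w = tri (lab w 0) (lab w 1) (lab w 2) ⋀ tri (lab w 3) (lab w 4) (lab w 5) ⋀ tri (lab w 6) (lab w 7) (lab w 8)

-- Bring the block of w containing c to the front, with the sign this costs.
front : ℕ → List ℕ → ℤ × List ℕ
front c (a₀ ∷ a₁ ∷ a₂ ∷ b₀ ∷ b₁ ∷ b₂ ∷ l) =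
  if memᵇ (a₀ ∷ a₁ ∷ a₂ ∷ []) c then (1ℤ , a₀ ∷ a₁ ∷ a₂ ∷ b₀ ∷ b₁ ∷ b₂ ∷ l)
  else if memᵇ (b₀ ∷ b₁ ∷ b₂ ∷ []) c then (-1ℤ , b₀ ∷ b₁ ∷ b₂ ∷ a₀ ∷ a₁ ∷ a₂ ∷ l)
  else (1ℤ , l ++ a₀ ∷ a₁ ∷ a₂ ∷ b₀ ∷ b₁ ∷ b₂ ∷ [])
front c l = 1ℤ , l

-- In M₄ the class of tri a b c is fixed by the double transpositions of {a,b,c,x}: a chain
-- homologous to tri a b c that avoids v, the vertices it uses, and the chain between them.
avoiding : (v x a b c : ℕ) → Ch × List ℕ × Ch
avoiding v x a b c =
  if does (v ≟ a) then (tri x c b , x ∷ c ∷ b ∷ [] , (x , c) ▷ (a , b) ▷ vac)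
  else if does (v ≟ b) then (tri c x a , c ∷ x ∷ a ∷ [] , (c , x) ▷ (a , b) ▷ vac ⊕ (b , c) ▷ (x , a) ▷ vac)
  else (tri b a x , b ∷ a ∷ x ∷ [] , (b , c) ▷ (a , x) ▷ vac)

tri³-term : List ℕ → List ℕ → Ch
tri³-term w l = tri (lab w 0) (lab w 1) (lab w 2) ⋀ pentOf (map (lab w ∘ (3 ℕ.+_)) l)

-- The sign comes from moving the boundary past `tri`, which has one edge.
tri³-filling : List ℕ → Ch
tri³-filling w = ⊖ (tri (lab w 0) (lab w 1) (lab w 2) ⋀ mapC (lab w ∘ (3 ℕ.+_)) tri²-filling₆)

-- The pentagon that replaces the last two blocks leaves the vertex `lab p 0` free. Together with
-- the front block, which is to contain `c`, it spans a copy of M_4, and there the triangle can be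
-- moved away from `c`.
termᵇ : ℕ → List ℕ → List ℕ → Bool
termᵇ c w l = let p = map (lab w ∘ (3 ℕ.+_)) l
                  y' , vs , h = avoiding c (lab p 0) (lab w 0) (lab w 1) (lab w 2)
              in spectatorᵇ 9 2 c (vs ++ Data.List.drop 1 p) (tri³-term w l) (y' ⋀ pentOf p) (h ⋀ pentOf p)

term-good : ∀ c w l → termᵇ c w l ≡ true → Good 9 3 c (tri³-term w l)
term-good c w l = let p = map (lab w ∘ (3 ℕ.+_)) l
                      y' , vs , h = avoiding c (lab p 0) (lab w 0) (lab w 1) (lab w 2)
                  in good-spectator 9 2 c (vs ++ Data.List.drop 1 p) (tri³-term w l) (y' ⋀ pentOf p) (h ⋀ pentOf p)

terms : (List ℕ → Ch) → List (ℤ × List ℕ) → Ch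
terms F l = combine (map (λ (k , x) → k , F x) l)

good-terms : ∀ {n d c} (l : List (ℤ × List ℕ)) (F : List ℕ → Ch) (t : List ℕ → Bool) → (∀ x → t x ≡ true → Good n d c (F x)) →
             allᵇ (t ∘ proj₂) l ≡ true → Good n d c (terms F l)
good-terms {n} {d} {c} [] F t h q = span-𝟎 (⊕-𝟎 (∑-zero (upTo n) λ _ → ≈-refl) (⊙-zeroʳ _))
good-terms {n} {d} {c} ((k , x) ∷ l) F t h q = let q₁ , q₂ = ∧-true {t x} q in
  rsp (≈-sym (l⊕ (lin-X-id (upTo n) c) _ _)) (add (rsp (≈-sym (l⊙ (lin-X-id (upTo n) c) k _)) (scl k (h x q₁))) (good-terms l F t h q₂))

expandsᵇ : (n d : ℕ) (k s : ℤ) (y : Ch) (l : List (ℤ × List ℕ)) (F : List ℕ → Ch) (t : List ℕ → Bool) (f : Ch) → Bool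
expandsᵇ n d k s y l F t f = allᵇ (t ∘ proj₂) l ∧ agrees (k ⊙ y) (s ⊙ (terms F l ⊕ ∂ₑ f)) ∧ inside (_<ᵇ n) (suc d) f

good-expands : ∀ n d c k m s y l F t f → k ℤ.* m ≡ + 6 → c < n → (∀ x → t x ≡ true → Good n d c (F x)) →
               expandsᵇ n d k s y l F t f ≡ true → Good n d c y
good-expands n d c k m s y l F t f km c< h q =
  let q₁ , r = ∧-true {allᵇ (t ∘ proj₂) l} q
      q₂ , q₃ = ∧-true {agrees (k ⊙ y) (s ⊙ (terms F l ⊕ ∂ₑ f))} r
      X' = lin-X-id (upTo n) c
  in div-by k m km (rsp (l⊙ X' k y) (rsp (≈-sym (l≈ X' (compute _ _ q₂))) (rsp (≈-sym (l⊙ X' s _)) (scl s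
       (rsp (≈-sym (l⊕ X' (terms F l) (∂ₑ f))) (add (good-terms l F t h q₁) (good-bdy c< (In< n (suc d) f q₃))))))))

tri³ᵇ : ℕ → List ℕ → Bool
tri³ᵇ c w = let s , w' = front c w in expandsᵇ 9 3 (+ 3) s (tri³ w) tri²-pents (tri³-term w') (termᵇ c w') (tri³-filling w')

good-tri³ : ∀ c w → c < 9 → tri³ᵇ c w ≡ true → Good 9 3 c (tri³ w)
good-tri³ c w c< = let s , w' = front c w in
  good-expands 9 3 c (+ 3) (+ 2) s (tri³ w) tri²-pents (tri³-term w') (termᵇ c w') (tri³-filling w') refl c< (term-good c w')

first second : List ℕ → List ℕ
first p = 1 ∷ 2 ∷ 3 ∷ lab p 0 ∷ lab p 2 ∷ lab p 3 ∷ lab p 4 ∷ lab p 1 ∷ 0 ∷ []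
second p = 1 ∷ 2 ∷ 3 ∷ lab p 0 ∷ lab p 1 ∷ 0 ∷ lab p 2 ∷ lab p 3 ∷ lab p 4 ∷ []

pentL : List ℕ → Ch
pentL p = pent (lab p 0) (lab p 1) (lab p 2) (lab p 3) (lab p 4)

-- Let p be a, b, c, d, e. The triangles of `second` minus those of `first` give the pentagon,
-- except that ac ∧ de is replaced by b0 ∧ de + ac ∧ b0. The boundary of ac ∧ b0 ∧ de repairs this.
pent-filling : List ℕ → Ch
pent-filling p = tri 1 2 3 ⋀ simplex (lab p 0 ∷ lab p 2 ∷ lab p 1 ∷ 0 ∷ lab p 3 ∷ lab p 4 ∷ [])

-- In homology tri 1 2 3 ⋀ pentL p is tri³ (second p) - tri³ (first p); the lists encode first as 0 and second as 1.
tri-pent-terms : List (ℤ × List ℕ)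
tri-pent-terms = (-1ℤ , 0 ∷ []) ∷ (1ℤ , 1 ∷ []) ∷ []

tri-pent-term : List ℕ → List ℕ → List ℕ
tri-pent-term p l = if lab l 0 ≡ᵇ 0 then first p else second p

tri-pentᵇ : ℕ → List ℕ → Bool
tri-pentᵇ c p = expandsᵇ 9 3 1ℤ 1ℤ (tri 1 2 3 ⋀ pentL p) tri-pent-terms (tri³ ∘ tri-pent-term p) (tri³ᵇ c ∘ tri-pent-term p) (pent-filling p)

good-tri-pent : ∀ c p → c < 9 → tri-pentᵇ c p ≡ true → Good 9 3 c (tri 1 2 3 ⋀ pentL p)
good-tri-pent c p c< = good-expands 9 3 c 1ℤ (+ 6) 1ℤ (tri 1 2 3 ⋀ pentL p) tri-pent-terms (tri³ ∘ tri-pent-term p) (tri³ᵇ c ∘ tri-pent-term p)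
  (pent-filling p) refl c< (λ x → good-tri³ c (tri-pent-term p x) c<)

B₉ : List ℕ
B₉ = 4 ∷ 5 ∷ 6 ∷ 7 ∷ 8 ∷ []

abstract
  tri-pent-every-vertex : allᵇ (λ c → tri-pentᵇ c B₉) B₉ ≡ true
  tri-pent-every-vertex = refl

  -- The vertex 4 stays fixed while the pentagon is permuted, because the relation is needed for
  -- every summand of `X C₁₄ 9 γ₁₄` with the same base vertex 9.
  tri-pent-swapped : allᵇ (λ i → tri-pentᵇ 4 (map (sw 4 i) B₉)) B₉ ≡ true
  tri-pent-swapped = refl

A₄ C₁₄ : List ℕ
A₄ = 0 ∷ 1 ∷ 2 ∷ 3 ∷ []
C₁₄ = 9 ∷ 10 ∷ 11 ∷ 12 ∷ 13 ∷ []

X-⋀ʳ : ∀ {Q : ℕ → Set} {e w} l c → In Q e w → ¬ Q c → (∀ {x} → x ∈ l → ¬ Q x) → ∀ a → X l c (a ⋀ w) ≈ X l c a ⋀ w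
X-⋀ʳ {w = w} l c i nc nl a = ≈-trans (∑-cong-∈ l λ {x} x∈ → ≈-trans (≡⇒≈ (mapC-⋀ (sw c x) a w)) (⋀-congʳ _
  (mapC-id (λ { q → sw-o (λ { refl → nc q }) (λ { refl → nl x∈ q }) }) i))) (≈-sym (∑-hom (hom⋀ˡ w) l))

X-⋀ˡ : ∀ {Q : ℕ → Set} {e w} l c → In Q e w → ¬ Q c → (∀ {x} → x ∈ l → ¬ Q x) → ∀ a → X l c (w ⋀ a) ≈ w ⋀ X l c a
X-⋀ˡ {w = w} l c i nc nl a = ≈-trans (∑-cong-∈ l λ {x} x∈ → ≈-trans (≡⇒≈ (mapC-⋀ (sw c x) w a)) (⋀-congˡ _
  (mapC-id (λ { q → sw-o (λ { refl → nc q }) (λ { refl → nl x∈ q }) }) i))) (≈-sym (∑-hom (hom⋀ʳ w) l))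

-- The relation (c b)(c a) = (c a)(a b) moves the outer sum inside, where it is based at `a` instead
-- of `c`. It serves both to show that a composite vanishes and, read backwards, to recognise a sum
-- as such a composite.
X-X : ∀ l m c → (∀ {b} → b ∈ l → b ≢ c) → (∀ {a} → a ∈ m → a ≢ c) → (∀ {a b} → a ∈ m → b ∈ l → a ≢ b) →
      ∀ y → X l c (X m c y) ≈ ∑ m (λ a → mapC (sw c a) (X l a y))
X-X l m c lc mc ml y =
  ∑ l (λ b → mapC (sw c b) (∑ m (λ a → mapC (sw c a) y)))     ≈⟨ ∑-cong l (λ b → ∑-hom (hom-map (sw c b)) m) ⟩
  ∑ l (λ b → ∑ m (λ a → mapC (sw c b) (mapC (sw c a) y)))     ≈⟨ ∑-swap l m _ ⟩
  ∑ m (λ a → ∑ l (λ b → mapC (sw c b) (mapC (sw c a) y)))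
    ≈⟨ ∑-cong-∈ m (λ {a} a∈ → ∑-cong-∈ l λ {b} b∈ → ≡⇒≈ (trans (mapC-∘ _ _ y) (trans (mapC-ext (sw-braid (ml a∈ b∈) (mc a∈) (lc b∈)) y) (sym (mapC-∘ _ _ y))))) ⟩
  ∑ m (λ a → ∑ l (λ b → mapC (sw c a) (mapC (sw a b) y)))     ≈⟨ ∑-cong m (λ a → ∑-hom (hom-map (sw c a)) l) ⟨
  ∑ m (λ a → mapC (sw c a) (X l a y)) ∎≈

-- The twist compared with X-X comes from the terms in which the same vertex is moved twice.
X-X-self : ∀ l c {P d y} → In P d y → Unique l → (∀ {b} → b ∈ l → b ≢ c) →
           X l c (X l c y) ⊕ X l c y ≈ ∑ l (λ b → mapC (sw c b) (X l b y)) ⊕ ∑ l (λ _ → y)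
X-X-self l c {y = y} i u lc =
  X l c (X l c y) ⊕ X l c y
    ≈⟨ ⊕-cong (≈-trans (∑-cong l λ b → ∑-hom (hom-map (sw c b)) l) (∑-swap l l _)) ≈-refl ⟩
  ∑ l (λ b → ∑ l (λ b' → mapC (sw c b') (mapC (sw c b) y))) ⊕ X l c y
    ≈⟨ ∑-⊕ l _ _ ⟨
  ∑ l (λ b → ∑ l (λ b' → mapC (sw c b') (mapC (sw c b) y)) ⊕ mapC (sw c b) y)
    ≈⟨ ∑-cong-∈ l step ⟩
  ∑ l (λ b → mapC (sw c b) (X l b y) ⊕ y)
    ≈⟨ ∑-⊕ l _ _ ⟩
  ∑ l (λ b → mapC (sw c b) (X l b y)) ⊕ ∑ l (λ _ → y) ∎≈
  where
  step : ∀ {b} → b ∈ l → ∑ l (λ b' → mapC (sw c b') (mapC (sw c b) y)) ⊕ mapC (sw c b) y ≈ mapC (sw c b) (X l b y) ⊕ y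
  step {b} b∈ = ≈-trans (⊕-cong ≈-refl (≡⇒≈ (trans (sym (mapC-ext (λ x → cong (sw c b) (sw-self b x)) y)) (sym (mapC-∘ _ _ y)))))
    (≈-trans (∑-patch u b∈ _ (λ b' → mapC (sw c b) (mapC (sw b b') y)) λ {b'} b'∈ n →
      ≡⇒≈ (trans (mapC-∘ _ _ y) (trans (mapC-ext (sw-braid (≢-sym n) (lc b∈) (lc b'∈)) y) (sym (mapC-∘ _ _ y)))))
    (⊕-cong (≈-sym (∑-hom (hom-map (sw c b)) l)) (≈-trans (≡⇒≈ (mapC-∘ _ _ y)) (mapC-id (λ {x} _ → sw-involutive c b x) i))))

lab-∈ : ∀ vs {n} → n < length vs → lab vs n ∈ vs
lab-∈ (v ∷ vs) {zero} _ = here refl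
lab-∈ (v ∷ vs) {suc n} (s≤s p) = there (lab-∈ vs p)

lab-inj : ∀ {vs} → Unique vs → ∀ {m n} → m < length vs → n < length vs → lab vs m ≡ lab vs n → m ≡ n
lab-inj (u ∷ U) {zero} {zero} p q e = refl
lab-inj {v ∷ vs} (u ∷ U) {zero} {suc n} p (s≤s q) e = contradiction e (All.lookup u (lab-∈ vs q))
lab-inj {v ∷ vs} (u ∷ U) {suc m} {zero} (s≤s p) q e = contradiction (sym e) (All.lookup u (lab-∈ vs p))
lab-inj (u ∷ U) {suc m} {suc n} (s≤s p) (s≤s q) e = cong suc (lab-inj U p q e)

P₁₄ : ℕ → Set
P₁₄ = _< 14

N : Ch → Set
N = Nul P₁₄ 5

γ₁₄ : Ch
γ₁₄ = (tri 1 2 3 ⋀ pentL B₉) ⋀ pentL C₁₄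

-- Carries the copy of M_9 on `A₄` and `B₉` to the copy on `A₄` and `C₁₄`; the vertex 4 goes to 9.
relabel : ℕ → ℕ
relabel = lab (A₄ ++ C₁₄)

-- Here `j` is meant to run over `B₉`, which `relabel` maps onto `C₁₄`; these are then the summands
-- of `X C₁₄ 9 γ₁₄`.
γ-at : ℕ → Ch
γ-at j = mapC (sw 9 (relabel j)) γ₁₄

bound : ∀ n l → allᵇ (_<ᵇ n) l ≡ true → ∀ {x} → x ∈ l → x < n
bound n l h {x} x∈ = ℕₚ.<ᵇ⇒< x n (subst T (sym (all-∈ l h x∈)) tt)

pB-cyc : Cyc (_∈ B₉) 2 (pentL B₉)
pB-cyc = inside-∈ B₉ 2 (pentL B₉) refl , compute _ _ refl

pC-cyc : Cyc (_∈ C₁₄) 2 (pentL C₁₄)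
pC-cyc = inside-∈ C₁₄ 2 (pentL C₁₄) refl , compute _ _ refl

y₉-in : In (_∈ A₄ ++ B₉) 3 (tri 1 2 3 ⋀ pentL B₉)
y₉-in = inside-∈ (A₄ ++ B₉) 3 _ refl

γ₁₄-in : In P₁₄ 5 γ₁₄
γ₁₄-in = In< 14 5 γ₁₄ refl

-- Vertex 0 is the factor [1,0] of block A. It is free already, and for the other three vertices it
-- is the fourth vertex that lets the triangle move away.
move : ℕ → Ch × List ℕ × Ch
move zero = tri 1 2 3 , 1 ∷ 2 ∷ 3 ∷ [] , 𝟎
move (suc a) = avoiding (suc a) 0 1 2 3

exchangesᵇ : (n d e a : ℕ) (B vs : List ℕ) (y p u h : Ch) → Bool
exchangesᵇ n d e a B vs y p u h = agrees y (p ⋀ u ⊕ ∂ₑ h)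
  ∧ inside (memᵇ vs) e u ∧ agrees (∂ₑ u) 𝟎 ∧ inside (_<ᵇ n) (suc (suc d + e)) h
  ∧ disjᵇˡ (a ∷ B) vs ∧ not (memᵇ B a) ∧ allᵇ (_<ᵇ n) (a ∷ B) ∧ allᵇ (_<ᵇ n) vs

-- The chain `y` is homologous to `p ⋀ u`, where `p` is a cycle on `B` and `u` avoids `B` and `a`.
-- The operator therefore acts on `p` alone, and `transposition-sum` makes the result a boundary.
exchanges : ∀ n d e a B vs y p u h → Unique B → Cyc (_∈ B) (suc d) p → exchangesᵇ n d e a B vs y p u h ≡ true → Nul (_< n) (suc d + e) (X B a y)
exchanges n d e a B vs y p u h uB pc q =
  let q₁ , r₁ = ∧-true {agrees y (p ⋀ u ⊕ ∂ₑ h)} q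
      q₂ , r₂ = ∧-true {inside (memᵇ vs) e u} r₁
      q₃ , r₃ = ∧-true {agrees (∂ₑ u) 𝟎} r₂
      q₄ , r₄ = ∧-true {inside (_<ᵇ n) (suc (suc d + e)) h} r₃
      q₅ , r₅ = ∧-true {disjᵇˡ (a ∷ B) vs} r₄
      q₆ , r₆ = ∧-true {not (memᵇ B a)} r₅
      q₇ , q₈ = ∧-true {allᵇ (_<ᵇ n) (a ∷ B)} r₆
      dj = disjᵇˡ-sound (a ∷ B) vs q₅
      u-in = inside-∈ vs e u q₂
      k , k-in , k-eq = transposition-sum uB (λ i → case trans (sym q₆) (cong not (memᵇ-complete B i)) of λ ()) pc
      bn = bound n (a ∷ B) q₇
  in rsp (≈-sym (l≈ (lin-X B a) (compute _ _ q₁))) (rsp (≈-sym (l⊕ (lin-X B a) (p ⋀ u) (∂ₑ h))) (add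
       (rsp (≈-sym (≈-trans (X-⋀ʳ B a u-in (dj (here refl)) (dj ∘ there) p) (⋀-congˡ u k-eq)))
         (bdy-⋀ʳ {Q = _∈ vs} dj bn (bound n vs q₈) (u-in , compute _ _ q₃) k-in))
       (nul-X B (bn (here refl)) (bn ∘ there) (bdy (In< n _ h q₄)))))

exchangeᵇ : ℕ → ℕ → Bool
exchangeᵇ a j = let t , vs , h = move a ; w = pentL (map (sw 9 (relabel j)) C₁₄) in
  exchangesᵇ 14 1 3 a B₉ (vs ++ C₁₄) (γ-at j) (pentL B₉) (t ⋀ w) (pentL B₉ ⋀ (h ⋀ w))

exchange : ∀ a j → exchangeᵇ a j ≡ true → N (X B₉ a (γ-at j))
exchange a j = let t , vs , h = move a ; w = pentL (map (sw 9 (relabel j)) C₁₄) in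
  exchanges 14 1 3 a B₉ (vs ++ C₁₄) (γ-at j) (pentL B₉) (t ⋀ w) (pentL B₉ ⋀ (h ⋀ w)) (uniqueᵇ-sound B₉ refl) pB-cyc

abstract
  exchange-all : allᵇ (λ a → allᵇ (exchangeᵇ a) B₉) A₄ ≡ true
  exchange-all = refl

N-exchange : ∀ {a j} → a ∈ A₄ → j ∈ B₉ → N (X B₉ a (γ-at j))
N-exchange {a} {j} a∈ j∈ = exchange a j (all-∈ {P = exchangeᵇ a} B₉ (all-∈ {P = λ a → allᵇ (exchangeᵇ a) B₉} A₄ exchange-all a∈) j∈)

good-⋀ : ∀ {n m d e c y w Q} → c < n → n ≤ m → Cyc Q e w → (∀ {v} → Q v → n ≤ v) → (∀ {v} → Q v → v < m) →
         Good n d c y → Nul (_< m) (d + e) (X (upTo n) c (y ⋀ w) ⊕ ⊖ (y ⋀ w))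
good-⋀ {n} {c = c} {y} {w} {Q} c< n≤m wc lo hi g =
  rsp (⊕-cong (≈-sym (X-⋀ʳ (upTo n) c (wc .isIn) (out c<) (out ∘ upTo-< n) y)) ≈-refl)
    (nul-⋀ʳ {P = _< n} {Q = Q} (λ p q → out p q) (λ p → ℕₚ.<-≤-trans p n≤m) hi wc g)
  where
  out : ∀ {v} → v < n → ¬ Q v
  out p q = ℕₚ.<-irrefl refl (ℕₚ.<-≤-trans p (lo q))

good-⋀-++ : ∀ {n m d e c y w Q g} l k → upTo n ≡ l ++ k → y ⋀ w ≡ g → c < n → n ≤ m → Cyc Q e w → (∀ {v} → Q v → n ≤ v) → (∀ {v} → Q v → v < m) →
            Good n d c y → Nul (_< m) (d + e) ((X l c g ⊕ X k c g) ⊕ ⊖ g)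
good-⋀-++ {n} {m} {d} {e} {c} {y} {w} l k eq refl c< n≤m wc lo hi g =
  rsp (⊕-cong (∑-++ l k _) ≈-refl) (subst (λ u → Nul (_< m) (d + e) (X u c (y ⋀ w) ⊕ ⊖ (y ⋀ w))) eq (good-⋀ c< n≤m wc lo hi g))

C-low : ∀ {v} → v ∈ C₁₄ → 9 ≤ v
C-low {v} v∈ = ℕₚ.≤ᵇ⇒≤ 9 v (subst T (sym (all-∈ {P = 9 ℕ.≤ᵇ_} C₁₄ refl v∈)) tt)

N-full-B : ∀ {b} → b ∈ B₉ → N ((X A₄ b γ₁₄ ⊕ X B₉ b γ₁₄) ⊕ ⊖ γ₁₄)
N-full-B {b} b∈ = good-⋀-++ {n = 9} {m = 14} {d = 3} {e = 2} {c = b} {y = tri 1 2 3 ⋀ pentL B₉} {w = pentL C₁₄} {g = γ₁₄} A₄ B₉ refl refl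
    b< (ℕₚ.m≤m+n 9 5) pC-cyc C-low (bound 14 C₁₄ refl)
    (good-tri-pent b B₉ b< (all-∈ {P = λ c → tri-pentᵇ c B₉} B₉ tri-pent-every-vertex b∈))
  where b< = bound 9 B₉ refl b∈

relabeledᵇ : ℕ → Bool
relabeledᵇ j = agrees (mapC relabel (tri 1 2 3 ⋀ pentL (map (sw 4 j) B₉)) ⋀ pentL B₉) (γ-at j)
  ∧ inside (_<ᵇ 9) 3 (tri 1 2 3 ⋀ pentL (map (sw 4 j) B₉))

abstract
  relabeled-all : allᵇ relabeledᵇ B₉ ≡ true
  relabeled-all = refl

good-relabel : ∀ {n m d e c c' y w f Q g} l k → (∀ {x y} → x < n → y < n → f x ≡ f y → x ≡ y) → map f (upTo n) ≡ l ++ k → f c ≡ c' → mapC f y ⋀ w ≈ g →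
               c < n → In (_< n) d y → Cyc Q e w → Disjoint (_∈ l ++ k) Q → (∀ {v} → v ∈ l ++ k → v < m) → (∀ {v} → Q v → v < m) →
               Good n d c y → Nul (_< m) (d + e) ((X l c' g ⊕ X k c' g) ⊕ ⊖ g)
good-relabel {n} {m} {d} {e} {c} {y = y} {w} {f} {Q} l k inj eq refl ge c< i wc dj hi hi' g =
  rsp (⊕-cong (∑-++ l k _) ≈-refl) (rsp (l≈ (lin-X-id (l ++ k) (f c)) ge)
    (subst (λ u → Nul (_< m) (d + e) (X u (f c) (mapC f y ⋀ w) ⊕ ⊖ (mapC f y ⋀ w))) eq
      (rsp (⊕-cong (≈-trans (⋀-congˡ w (X-conj inj i (upTo n) c< (upTo-< n))) (≈-sym (X-⋀ʳ (map f (upTo n)) (f c) (wc .isIn) (dj (f∈ c<)) (dj ∘ subst (_ ∈_) eq) (mapC f y)))) ≈-refl)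
        (nul-⋀ʳ {P = _∈ l ++ k} {Q = Q} dj hi hi' wc (nul-map f∈ inj g)))))
  where
  f∈ : ∀ {x} → x < n → f x ∈ l ++ k
  f∈ x< = subst (_ ∈_) eq (∈-map⁺ f (∈-upTo⁺ x<))

relabel-inj : ∀ {x y} → x < 9 → y < 9 → relabel x ≡ relabel y → x ≡ y
relabel-inj = lab-inj (uniqueᵇ-sound (A₄ ++ C₁₄) refl)

N-full-C : ∀ {j} → j ∈ B₉ → N ((X A₄ 9 (γ-at j) ⊕ X C₁₄ 9 (γ-at j)) ⊕ ⊖ γ-at j)
N-full-C {j} j∈ =
  let yⱼ = tri 1 2 3 ⋀ pentL (map (sw 4 j) B₉)
      q₁ , q₂ = ∧-true {agrees (mapC relabel yⱼ ⋀ pentL B₉) (γ-at j)} (all-∈ {P = relabeledᵇ} B₉ relabeled-all j∈)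
  in good-relabel {n = 9} {m = 14} {d = 3} {e = 2} {c = 4} {c' = 9} {y = yⱼ} {w = pentL B₉} {f = relabel} {g = γ-at j} A₄ C₁₄ relabel-inj refl refl
         (compute (mapC relabel yⱼ ⋀ pentL B₉) (γ-at j) q₁) 4< (In< 9 3 yⱼ q₂) pB-cyc
         (disjᵇˡ-sound (A₄ ++ C₁₄) B₉ refl) (bound 14 (A₄ ++ C₁₄) refl) (bound 14 B₉ refl)
         (good-tri-pent 4 (map (sw 4 j) B₉) 4< (all-∈ {P = λ i → tri-pentᵇ 4 (map (sw 4 i) B₉)} B₉ tri-pent-swapped j∈))
  where
  4< : 4 < 9
  4< = bound 9 (4 ∷ []) refl (here refl)

lin-∘ : ∀ {F G} → Lin F → Lin G → Lin (F ∘ G)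
lin-∘ f g .l≈ e = l≈ f (l≈ g e)
lin-∘ f g .l⊕ a b = ≈-trans (l≈ f (l⊕ g a b)) (l⊕ f _ _)
lin-∘ f g .l⊙ k a = ≈-trans (l≈ f (l⊙ g k a)) (l⊙ f k _)

lin-⊖ : ∀ {F G} → Lin F → Lin G → Lin (λ y → F y ⊕ ⊖ G y)
lin-⊖ f g .l≈ e = ⊕-cong (l≈ f e) (⊙-cong _ (l≈ g e))
lin-⊖ f g .l⊕ a b = ≈-trans (⊕-cong (l⊕ f a b) (≈-trans (⊙-cong _ (l⊕ g a b)) (⊙-distˡ _ _ _))) (⊕-inter _ _ _ _)
lin-⊖ f g .l⊙ k a = ≈-trans (⊕-cong (l⊙ f k a) (≈-trans (⊙-cong _ (l⊙ g k a)) (⊙-comm _ k _))) (≈-sym (⊙-distˡ k _ _))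

lin-hom : ∀ {F} → Lin F → Hom F
lin-hom {F} l .h𝟎 = ≈-trans (l≈ l (≈-sym (⊙-zeroˡ 𝟎))) (≈-trans (l⊙ l 0ℤ 𝟎) (⊙-zeroˡ (F 𝟎)))
lin-hom l .h⊕ = l⊕ l

drop-l : ∀ {G P d a b} → Span G P d a → Span G P d (a ⊕ b) → Span G P d b
drop-l {a = a} {b} s t = rsp (mk λ φ A → lem ⟨ a ∣ φ ⟩ ⟨ b ∣ φ ⟩) (add t (span-neg s))
  where lem : ∀ a b → (a ℤ.+ b) ℤ.+ -1ℤ ℤ.* a ≡ b
        lem = solve-∀

-- With W = X B c y: the hypothesis on (X C c)² gives 4W ~ 0, and then expanding X B c W ~ 0 by X-X-self leaves |B| y ~ 0.
exchange-torsion : ∀ {n d} A B C c y → In (_< n) d y → Unique B →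
  (∀ {x} → x ∈ A → x < n) → (∀ {x} → x ∈ B → x < n) → c < n → c ∈ C →
  (∀ {b} → b ∈ B → b ≢ c) → (∀ {a} → a ∈ A → a ≢ c) → (∀ {a b} → a ∈ A → b ∈ B → a ≢ b) →
  (∀ {a i} → a ∈ A → i ∈ C → Nul (_< n) d (X B a (mapC (sw c i) y))) →
  (∀ {b} → b ∈ B → Nul (_< n) d ((X A b y ⊕ X B b y) ⊕ ⊖ y)) →
  (∀ {i} → i ∈ C → Nul (_< n) d ((X A c (mapC (sw c i) y) ⊕ X C c (mapC (sw c i) y)) ⊕ ⊖ mapC (sw c i) y)) →
  X C c (X C c y) ≈ + 2 ⊙ X C c y ⊕ + 3 ⊙ y →
  Nul (_< n) d (∑ B (λ _ → y))
exchange-torsion {n} {d} A B C c y yin uB A< B< c< c∈ Bc Ac AB hX hB hC hJ =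
  drop-l nSB (rsp (X-X-self B c yin uB Bc) (add (nul-X B c< B< nW) nW))
  where
  𝒩 = Nul (_< n) d
  W = X B c y
  V = X B c (X C c y)
  F : Ch → Ch
  F z = X B c (X C c z) ⊕ ⊖ X B c z
  linF : Lin F
  linF = lin-⊖ (lin-∘ (lin-X B c) (lin-X C c)) (lin-X B c)
  -- Apply `X B c` to `hC`. The part through `A` is null by `X-X` and `hX`, which leaves the part
  -- through `C` minus the identity.
  nFᵢ : ∀ {i} → i ∈ C → 𝒩 (F (mapC (sw c i) y))
  nFᵢ {i} i∈ = let yᵢ = mapC (sw c i) y in
    drop-l {a = X B c (X A c yᵢ)}
      (rsp (≈-sym (X-X B A c Bc Ac AB yᵢ)) (span-∑ A λ a∈ → nul-map (sw-closed {_< n} c< (A< a∈)) (λ _ _ → sw-inj _ _) (hX a∈ i∈)))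
      (rsp (≈-trans (l⊕ (lin-X B c) _ _) (≈-trans (⊕-cong (l⊕ (lin-X B c) _ _) (l⊙ (lin-X B c) -1ℤ yᵢ)) (⊕-assoc _ _ _))) (nul-X B c< B< (hC i∈)))
  nFy : 𝒩 (F y)
  nFy = rsp (l≈ linF (≈-trans (≡⇒≈ (mapC-ext (sw-self c) y)) (mapC-id (λ _ → refl) yin))) (nFᵢ c∈)
  nFX : 𝒩 (F (X C c y))
  nFX = rsp (≈-sym (∑-hom (lin-hom linF) C)) (span-∑ C nFᵢ)
  -- By the quadratic relation `F (X C c y)` is V + 3 W, while `F y` is V - W.
  n4W : 𝒩 (+ 4 ⊙ W)
  n4W = rsp eq (add nFX (span-neg nFy))
    where
    eq : F (X C c y) ⊕ ⊖ F y ≈ + 4 ⊙ W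
    eq = ≈-trans (⊕-cong (⊕-cong (≈-trans (l≈ (lin-X B c) hJ) (≈-trans (l⊕ (lin-X B c) _ _) (⊕-cong (l⊙ (lin-X B c) (+ 2) _) (l⊙ (lin-X B c) (+ 3) _)))) ≈-refl) ≈-refl)
           (mk λ φ A → lem ⟨ V ∣ φ ⟩ ⟨ W ∣ φ ⟩)
      where lem : ∀ v w → ((+ 2 ℤ.* v ℤ.+ + 3 ℤ.* w) ℤ.+ -1ℤ ℤ.* v) ℤ.+ -1ℤ ℤ.* (v ℤ.+ -1ℤ ℤ.* w) ≡ + 4 ℤ.* w
            lem = solve-∀
  -- Since 9 times 4 is 6 times 6, the factor 4 is invertible together with 6.
  nW : 𝒩 W
  nW = div (div (rsp (≈-trans (⊙-assoc (+ 9) (+ 4) W) (≈-sym (⊙-assoc (+ 6) (+ 6) W))) (scl (+ 9) n4W)))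
  SA = ∑ B (λ b → mapC (sw c b) (X A b y))
  SB = ∑ B (λ b → mapC (sw c b) (X B b y))
  -- `X-X` read backwards: this sum is `X A c W`, and `W` is already null.
  nSA : 𝒩 SA
  nSA = rsp (X-X A B c Ac Bc (λ b∈ a∈ → ≢-sym (AB a∈ b∈)) y) (nul-X A c< A< nW)
  -- Apply the transposition (c b) to `hB` at `b` and sum over `b`: SA + SB - W is null.
  nSB : 𝒩 SB
  nSB = drop-l nSA (rsp eq (add (span-∑ B λ b∈ → nul-map (sw-closed {_< n} c< (B< b∈)) (λ _ _ → sw-inj _ _) (hB b∈)) nW))
    where
    eq : ∑ B (λ b → mapC (sw c b) ((X A b y ⊕ X B b y) ⊕ ⊖ y)) ⊕ W ≈ SA ⊕ SB
    eq = ≈-trans (⊕-cong (≈-trans (∑-⊕ B _ _) (⊕-cong (∑-⊕ B _ _) (≈-sym (∑-hom (hom⊙ -1ℤ) B)))) ≈-refl)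
           (mk λ φ A → lem ⟨ SA ∣ φ ⟩ ⟨ SB ∣ φ ⟩ ⟨ W ∣ φ ⟩)
      where lem : ∀ a b w → ((a ℤ.+ b) ℤ.+ -1ℤ ℤ.* w) ℤ.+ w ≡ a ℤ.+ b
            lem = solve-∀

quadratic-⋀ˡ : ∀ {Q e w} C c p → In Q e w → ¬ Q c → (∀ {x} → x ∈ C → ¬ Q x) → X C c (X C c p) ≈ + 2 ⊙ X C c p ⊕ + 3 ⊙ p →
              X C c (X C c (w ⋀ p)) ≈ + 2 ⊙ X C c (w ⋀ p) ⊕ + 3 ⊙ (w ⋀ p)
quadratic-⋀ˡ {w = w} C c p i nc nC h =
  X C c (X C c (w ⋀ p))                     ≈⟨ l≈ (lin-X C c) (X-⋀ˡ C c i nc nC p) ⟩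
  X C c (w ⋀ X C c p)                       ≈⟨ X-⋀ˡ C c i nc nC (X C c p) ⟩
  w ⋀ X C c (X C c p)                       ≈⟨ ⋀-congʳ w h ⟩
  w ⋀ (+ 2 ⊙ X C c p ⊕ + 3 ⊙ p)             ≈⟨ ≈-trans (⋀-⊕ʳ w _ _) (⊕-cong (⋀-⊙ʳ w (+ 2) _) (⋀-⊙ʳ w (+ 3) p)) ⟩
  + 2 ⊙ (w ⋀ X C c p) ⊕ + 3 ⊙ (w ⋀ p)       ≈⟨ ⊕-cong (⊙-cong _ (X-⋀ˡ C c i nc nC p)) ≈-refl ⟨
  + 2 ⊙ X C c (w ⋀ p) ⊕ + 3 ⊙ (w ⋀ p) ∎≈

-- As 9 lies in `C₁₄`, the operator is 1 + J with J a Jucys-Murphy element, and the relation says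
-- that J has square 4. Rationally H̃_1 of M_5 is the Specht module of (3,1,1), whose removable
-- boxes have contents 2 and -2.
pC-quadratic : X C₁₄ 9 (X C₁₄ 9 (pentL C₁₄)) ≈ + 2 ⊙ X C₁₄ 9 (pentL C₁₄) ⊕ + 3 ⊙ pentL C₁₄
pC-quadratic = compute _ _ refl

γ₁₄-sum : N (∑ B₉ (λ _ → γ₁₄))
γ₁₄-sum = exchange-torsion {14} {5} A₄ B₉ C₁₄ 9 γ₁₄ γ₁₄-in (uniqueᵇ-sound B₉ refl) (bound 14 A₄ refl) (bound 14 B₉ refl) (bound 14 C₁₄ refl (here refl)) (here refl)
  (λ { b∈ refl → disjᵇˡ-sound B₉ (9 ∷ []) refl b∈ (here refl) }) (λ { a∈ refl → disjᵇˡ-sound A₄ (9 ∷ []) refl a∈ (here refl) })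
  (λ { a∈ b∈ refl → disjᵇˡ-sound A₄ B₉ refl a∈ b∈ })
  (λ {a} a∈ i∈ → at′ (λ i → N (X B₉ a (mapC (sw 9 i) γ₁₄))) (N-exchange a∈) i∈)
  N-full-B
  (at′ (λ i → N ((X A₄ 9 (mapC (sw 9 i) γ₁₄) ⊕ X C₁₄ 9 (mapC (sw 9 i) γ₁₄)) ⊕ ⊖ mapC (sw 9 i) γ₁₄)) N-full-C)
  (quadratic-⋀ˡ {Q = _∈ A₄ ++ B₉} {w = tri 1 2 3 ⋀ pentL B₉} C₁₄ 9 (pentL C₁₄) y₉-in (λ i → disjᵇˡ-sound (A₄ ++ B₉) C₁₄ refl i (here refl))
    (λ x∈ i → disjᵇˡ-sound (A₄ ++ B₉) C₁₄ refl i x∈) pC-quadratic)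
  where
  at′ : (Z : ℕ → Set) → (∀ {j} → j ∈ B₉ → Z (relabel j)) → ∀ {i} → i ∈ C₁₄ → Z i
  at′ Z h i∈ with ∈-map⁻ relabel {xs = B₉} i∈
  ... | j , j∈ , refl = h j∈

γ₁₄-torsion : N (+ 5 ⊙ γ₁₄)
γ₁₄-torsion = rsp (five γ₁₄) γ₁₄-sum
  where
  five : ∀ y → ∑ B₉ (λ _ → y) ≈ + 5 ⊙ y
  five y .at φ A = lem ⟨ y ∣ φ ⟩
    where lem : ∀ x → x ℤ.+ (x ℤ.+ (x ℤ.+ (x ℤ.+ (x ℤ.+ 0ℤ)))) ≡ + 5 ℤ.* x
          lem = solve-∀

-- Generators

infixl 5 _−_
_−_ : (ℕ → Set) → List ℕ → (ℕ → Set)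
(P − vs) v = P v × v ∉ vs

record Lab (P : ℕ → Set) (vs : List ℕ) : Set where
  constructor lab!
  field
    uniq : Unique vs
    incl : ∀ {v} → v ∈ vs → P v
open Lab

Lab-mono : ∀ {P Q : ℕ → Set} → (∀ {v} → P v → Q v) → ∀ {vs} → Lab P vs → Lab Q vs
Lab-mono i (lab! u p) = lab! u (i ∘ p)

Lab-++ : ∀ {P xs ys} → Lab P xs → Lab (P − xs) ys → Lab P (xs ++ ys)
Lab-++ {P} {xs} {ys} (lab! u p) (lab! v q) = lab! (UP.++⁺ u v λ (i , j) → proj₂ (q j) i)
  λ i → [ p , proj₁ ∘ q ] (∈-++⁻ xs i)

Lab-split : ∀ {P} xs {ys} → Lab P (xs ++ ys) → Lab P xs × Lab (P − xs) ys
Lab-split [] (lab! u p) = lab! [] (λ ()) , lab! u λ i → p i , λ ()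
Lab-split (x ∷ xs) {ys} (lab! (n ∷ u) p) =
  let lab! u₁ p₁ , lab! u₂ p₂ = Lab-split xs (lab! u (p ∘ there)) in
  lab! (All.tabulate (λ i → All.lookup n (∈-++⁺ˡ i)) ∷ u₁) (λ { (here refl) → p (here refl) ; (there i) → p₁ i }) ,
  lab! u₂ λ i → proj₁ (p₂ i) , λ { (here refl) → All.lookup n (∈-++⁺ʳ xs i) refl ; (there j) → proj₂ (p₂ i) j }

Cyc-mono : ∀ {P Q : ℕ → Set} → (∀ {v} → P v → Q v) → ∀ {d a} → Cyc P d a → Cyc Q d a
Cyc-mono i (a , c) = In-mono i a , c

cyc-⋀ : ∀ {P Q R : ℕ → Set} {d e a b} → Disjoint P Q → (∀ {v} → P v → R v) → (∀ {v} → Q v → R v) → Cyc P d a → Cyc Q e b → Cyc R (d + e) (a ⋀ b)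
cyc-⋀ {d = d} {a = a} D i j (ai , ac) (bi , bc) = In-⋀ D i j ai bi ,
  ≈-trans (D-⋀ (λ _ → refl) _ ai) (⊕-𝟎 (⋀-congˡ _ ac) (⊙-𝟎 (≈-trans (⋀-congʳ a bc) (⋀-𝟎 a))))

In-lab : ∀ {vs n d a} → Unique vs → length vs ≡ n → In (_< n) d a → In (_∈ vs) d (mapC (lab vs) a)
In-lab {vs} u refl = mapC-In (lab-∈ vs) (lab-inj u)

cyc-lab : ∀ n d a → inside (_<ᵇ n) d a ≡ true → agrees (∂ₑ a) 𝟎 ≡ true → ∀ {vs} → Unique vs → length vs ≡ n → Cyc (_∈ vs) d (mapC (lab vs) a)
cyc-lab n d a i c {vs} u l = In-lab u l (In< n d a i) , ≈-trans (≡⇒≈ (sym (mapC-∂ (lab vs) a))) (mapC-cong (lab vs) (compute (∂ₑ a) 𝟎 c))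

tri-cyc : ∀ {a b c} → Unique (a ∷ b ∷ c ∷ []) → Cyc (_∈ a ∷ b ∷ c ∷ []) 1 (tri a b c)
tri-cyc u = cyc-lab 3 1 (tri 0 1 2) refl refl u refl

pent-cyc : ∀ {a b c d e} → Unique (a ∷ b ∷ c ∷ d ∷ e ∷ []) → Cyc (_∈ a ∷ b ∷ c ∷ d ∷ e ∷ []) 2 (pent a b c d e)
pent-cyc u = cyc-lab 5 2 (pent 0 1 2 3 4) refl refl u refl

-- 2q and 5q, arranged so that they compute on suc q.
dbl quin : ℕ → ℕ
dbl zero = 0
dbl (suc q) = suc (suc (dbl q))
quin zero = 0
quin (suc q) = 5 + quin q

pents : List ℕ → Ch
pents (a ∷ b ∷ c ∷ d ∷ e ∷ vs) = pent a b c d e ⋀ pents vs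
pents _ = vac

pents-cyc : ∀ q {vs} → Unique vs → length vs ≡ quin q → Cyc (_∈ vs) (dbl q) (pents vs)
pents-cyc zero {[]} u l = invac , ≈-refl
pents-cyc (suc q) {a ∷ b ∷ c ∷ d ∷ e ∷ vs} u l =
  let five = a ∷ b ∷ c ∷ d ∷ e ∷ [] ; lab! u₁ p₁ , lab! u₂ p₂ = Lab-split {_∈ five ++ vs} five (lab! u id) in
  cyc-⋀ (λ i j → proj₂ (p₂ j) i) p₁ (proj₁ ∘ p₂) (pent-cyc u₁) (pents-cyc q u₂ (ℕₚ.+-cancelˡ-≡ 5 _ _ l))

nul-bdy : ∀ {G P Q vs d e h w} → Lab P vs → Cyc Q e w → (∀ {v} → Q v → (P − vs) v) → In (_∈ vs) (suc d) h → Span G P (d + e) (∂ₑ h ⋀ w)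
nul-bdy l wc q h = bdy-⋀ʳ (λ i j → proj₂ (q j) i) (incl l) (proj₁ ∘ q) wc h

tri²-spectator : ∀ {G P a b c a' b' c' x d w} → Lab P (a ∷ b ∷ c ∷ a' ∷ b' ∷ c' ∷ x ∷ []) → Cyc (P − (a ∷ b ∷ c ∷ a' ∷ b' ∷ c' ∷ x ∷ [])) d w →
                 Span G P (2 + d) (tri a b c ⋀ tri a' b' c' ⋀ w)
tri²-spectator {a = a} {b} {c} {a'} {b'} {c'} {x} {w = w} l wc = rsp (≡⇒≈ (⋀-assoc (tri a b c) (tri a' b' c') w)) (div-by (+ 3) (+ 2) refl
  (rsp (⋀-congˡ w (≈-sym (≈-trans (mapC-cong f tri²-torsion) (≡⇒≈ (mapC-∂ f tri²-filling₇)))))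
    (nul-bdy l wc id (In-lab (uniq l) refl (In< 7 3 tri²-filling₇ refl)))))
  where f = lab (a ∷ b ∷ c ∷ a' ∷ b' ∷ c' ∷ x ∷ [])

sixᵇ : ℤ × List ℕ → Bool
sixᵇ (_ , l) = (length l ≡ᵇ 6) ∧ uniqueᵇ l ∧ subsetᵇ l (upTo 6)

unique-map : ∀ (f : ℕ → ℕ) {l} → (∀ {x y} → x ∈ l → y ∈ l → f x ≡ f y → x ≡ y) → Unique l → Unique (map f l)
unique-map f i [] = []
unique-map f {x ∷ l} i (n ∷ u) = All.tabulate (λ y∈ e → let z , z∈ , q = ∈-map⁻ f {xs = l} y∈ in All.lookup n z∈ (i (here refl) (there z∈) (trans e q))) ∷ unique-map f (λ p q → i (there p) (there q)) u

combine-span : ∀ {H Q e} (F : Ch → Ch) (l : List (ℤ × List ℕ)) → Lin F → (∀ {k v} → (k , v) ∈ l → Span H Q e (F (pentOf v))) →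
               Span H Q e (F (combine (map (λ (k , v) → k , pentOf v) l)))
combine-span F [] L h = span-𝟎 (lin-hom L .h𝟎)
combine-span F ((k , v) ∷ l) L h = rsp (≈-sym (l⊕ L _ _)) (add (rsp (≈-sym (l⊙ L k _)) (scl k (h (here refl)))) (combine-span F l L (h ∘ there)))

-- The pentagons of `tri²-as-pents` use different labellings of the six vertices, so the conclusion
-- is requested for all of them; `x` is the vertex left free.
tri²-exchange : ∀ {G P a b c a' b' c' d w} → let six = a ∷ b ∷ c ∷ a' ∷ b' ∷ c' ∷ [] in
  Lab P six → Cyc (P − six) d w →
  (∀ {x v₁ v₂ v₃ v₄ v₅} → Unique (x ∷ v₁ ∷ v₂ ∷ v₃ ∷ v₄ ∷ v₅ ∷ []) → (∀ {v} → v ∈ x ∷ v₁ ∷ v₂ ∷ v₃ ∷ v₄ ∷ v₅ ∷ [] → v ∈ six) → Span G P (2 + d) (pent v₁ v₂ v₃ v₄ v₅ ⋀ w)) →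
  Span G P (2 + d) (tri a b c ⋀ tri a' b' c' ⋀ w)
tri²-exchange {G} {P} {a} {b} {c} {a'} {b'} {c'} {d} {w} l wc h = rsp (≡⇒≈ (⋀-assoc (tri a b c) (tri a' b' c') w)) (div-by (+ 3) (+ 2) refl
  (rsp (⋀-congˡ w (≈-sym (mapC-cong f tri²-as-pents)))
    (add (combine-span (λ y → mapC f y ⋀ w) tri²-pents (lin-∘ (lin-⋀ˡ w) (lin-map f)) (λ {k} {v} v∈ → each v {k} (All.lookup sixes v∈)))
      (rsp (⋀-congˡ w (≡⇒≈ (sym (mapC-∂ f tri²-filling₆)))) (nul-bdy l wc id (In-lab (uniq l) refl (In< 6 3 tri²-filling₆ refl)))))))
  where
  six = a ∷ b ∷ c ∷ a' ∷ b' ∷ c' ∷ []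
  f = lab six
  sixes : All (λ kv → sixᵇ kv ≡ true) tri²-pents
  sixes = refl ∷ refl ∷ refl ∷ refl ∷ refl ∷ refl ∷ refl ∷ refl ∷ []
  each : ∀ v {k} → sixᵇ (k , v) ≡ true → Span G P (2 + d) (mapC f (pentOf v) ⋀ w)
  each v@(x ∷ v₁ ∷ v₂ ∷ v₃ ∷ v₄ ∷ v₅ ∷ []) q =
    let q₁ , q₂ = ∧-true {uniqueᵇ v} q
        sub : ∀ {y} → y ∈ v → y < 6
        sub = λ i → upTo-< 6 (subsetᵇ-sound v (upTo 6) q₂ i)
    in
    h (unique-map f (λ i j → lab-inj (uniq l) (sub i) (sub j)) (uniqueᵇ-sound v q₁))
      (λ i → let z , z∈ , e = ∈-map⁻ f {xs = v} i in subst (_∈ six) (sym e) (lab-∈ six (sub z∈)))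
  each [] ()
  each (_ ∷ []) ()
  each (_ ∷ _ ∷ []) ()
  each (_ ∷ _ ∷ _ ∷ []) ()
  each (_ ∷ _ ∷ _ ∷ _ ∷ []) ()
  each (_ ∷ _ ∷ _ ∷ _ ∷ _ ∷ []) ()
  each (_ ∷ _ ∷ _ ∷ _ ∷ _ ∷ _ ∷ _ ∷ _) ()

tri-⋀ : ∀ {G H Q P a b c d w} → Lab P (a ∷ b ∷ c ∷ []) → (∀ {v} → Q v → (P − (a ∷ b ∷ c ∷ [])) v) →
        (∀ {g} → G g → Span H P (suc d) (tri a b c ⋀ g)) → Span G Q d w → Span H P (suc d) (tri a b c ⋀ w)
tri-⋀ {a = a} {b} {c} l q h = span-lin (lin-⋀ʳ (tri a b c)) h (bdy-⋀ˡ (λ i j → proj₂ (q j) i) (proj₁ ∘ q) (incl l) (tri-cyc (uniq l)))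

-- There is no sign because a pentagon has an even number of edges per term.
tri-pent : ∀ {a b c v₁ v₂ v₃ v₄ v₅} w → Unique (a ∷ b ∷ c ∷ []) → Unique (v₁ ∷ v₂ ∷ v₃ ∷ v₄ ∷ v₅ ∷ []) →
           tri a b c ⋀ (pent v₁ v₂ v₃ v₄ v₅ ⋀ w) ≈ pent v₁ v₂ v₃ v₄ v₅ ⋀ (tri a b c ⋀ w)
tri-pent {a} {b} {c} {v₁} {v₂} {v₃} {v₄} {v₅} w u v = ≈-trans (≡⇒≈ (sym (⋀-assoc (tri a b c) _ w)))
  (≈-trans (⋀-congˡ w (≈-trans (⋀-comm (tri-cyc u .isIn) (pent-cyc v .isIn)) (⊙-idˡ _))) (≡⇒≈ (⋀-assoc (pent v₁ v₂ v₃ v₄ v₅) _ w)))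

record Removed (S : List ℕ) (vs : List ℕ) : Set where
  field
    left : List ℕ
    left-uniq : Unique left
    left-length : length S ≡ length vs + length left
    to : ∀ {v} → v ∈ left → v ∈ S × v ∉ vs
    from : ∀ {v} → v ∈ S → v ∉ vs → v ∈ left

remove₁ : ∀ {S x} → Unique S → x ∈ S → Removed S (x ∷ [])
remove₁ {y ∷ S} (n ∷ u) (here refl) = record { left = S ; left-uniq = u ; left-length = refl
  ; to = λ i → there i , λ { (here refl) → All.lookup n i refl }
  ; from = λ { (here refl) m → contradiction (here refl) m ; (there i) m → i } }
remove₁ {y ∷ S} {x} (n ∷ u) (there x∈) = record { left = y ∷ left ; left-uniq = All.tabulate (λ i → All.lookup n (proj₁ (to i))) ∷ left-uniq ; left-length = cong suc left-length
  ; to = λ { (here refl) → here refl , (λ { (here refl) → All.lookup n x∈ refl }) ; (there i) → there (proj₁ (to i)) , proj₂ (to i) }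
  ; from = λ { (here refl) m → here refl ; (there i) m → there (from i m) } }
  where open Removed (remove₁ u x∈)

remove : ∀ {S vs} → Unique S → Lab (_∈ S) vs → Removed S vs
remove {S} {[]} u l = record { left = S ; left-uniq = u ; left-length = refl ; to = λ i → i , λ () ; from = λ i _ → i }
remove {S} {x ∷ vs} u l = record { left = R₂.left ; left-uniq = R₂.left-uniq ; left-length = trans R₁.left-length (cong suc R₂.left-length)
  ; to = λ i → let j , m = R₂.to i ; k , m' = R₁.to j in k , λ { (here refl) → m' (here refl) ; (there h) → m h }
  ; from = λ i m → R₂.from (R₁.from i λ { (here refl) → m (here refl) }) (m ∘ there) }
  where
  module R₁ = Removed (remove₁ u (incl l (here refl)))
  l' : Lab (_∈ R₁.left) vs
  l' = let _ , m = Lab-split (x ∷ []) l in Lab-mono (λ (p , q) → R₁.from p q) m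
  module R₂ = Removed (remove R₁.left-uniq l')

pow : ℕ → ℤ
pow zero = 1ℤ
pow (suc m) = + 6 ℤ.* pow m

pow-+ : ∀ m n → pow (m + n) ≡ pow m ℤ.* pow n
pow-+ zero n = sym (ℤₚ.*-identityˡ _)
pow-+ (suc m) n = trans (cong (+ 6 ℤ.*_) (pow-+ m n)) (sym (ℤₚ.*-assoc (+ 6) (pow m) (pow n)))

div-pow : ∀ {G P d a} m → Span G P d (pow m ⊙ a) → Span G P d a
div-pow {a = a} zero s = rsp (⊙-idˡ a) s
div-pow {a = a} (suc m) s = div-pow m (div (rsp (≈-sym (⊙-assoc (+ 6) (pow m) a)) s))

link-same : ∀ {R p s d y} → ¬ R p → In R d y → L p s ((p , s) ▷ y) ≈ y
link-same {p = p} {s} {y = y} n i = ≈-trans (L-hit (p , s) y (inj₁ (refl , refl))) (⊕-elimʳ (⊖▷-elim (L-out n i)))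

link-other : ∀ {R p s s' d y} → s' ≢ s → ¬ R p → In R d y → L p s' ((p , s) ▷ y) ≈ 𝟎
link-other {p = p} {s} {y = y} m n i = ≈-trans (L-miss (p , s) y λ { (inj₁ (_ , e)) → m e ; (inj₂ (refl , refl)) → m refl }) (⊖▷-elim (L-out n i))

L𝟎 : ∀ {p s a} → a ≈ 𝟎 → L p s a ≈ 𝟎
L𝟎 {p} {s} e = L-cong p s e

-- Eliminating the terms that cover two fixed vertices by different edges

module Elimination {p r : ℕ} {S : List ℕ} (u : Unique (p ∷ r ∷ S)) where

  P : ℕ → Set
  P = _∈ p ∷ r ∷ S

  p≢r : p ≢ r
  p≢r = All.head (AllPairs.head u)

  p∉ : p ∉ S
  p∉ i = All.lookup (All.tail (AllPairs.head u)) i refl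

  r∉ : r ∉ S
  r∉ i = All.lookup (AllPairs.head (AllPairs.tail u)) i refl

  -- The coefficient of ps ∧ rt. Being a composite of two contractions it commutes with the
  -- boundary.
  LL : ℕ → ℕ → Ch → Ch
  LL s t z = L r t (L p s z)

  LL-∂ : ∀ s t y → LL s t (∂ₑ y) ≈ ∂ₑ (LL s t y)
  LL-∂ s t y = ≈-trans (L-cong r t (D-anti _ _ y)) (≈-trans (⊙-cong _ (D-anti _ _ (L p s y))) (≈-trans (⊙-assoc _ _ _) (⊙-idˡ _)))

  -- A multiple of a is the coefficient of ps ∧ rt in the cycle Y, and Y has no other term covering p and r separately.
  record Lifted (H : Ch → Set) (d s t : ℕ) (a : Ch) : Set where
    field
      m : ℕ
      Y : Ch
      member : H Y
      cycle : Cyc P (2 + d) Y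
      hit : LL s t Y ≈ pow m ⊙ a
      miss : ∀ {s' t'} → s' ∈ S → t' ∈ S → s' ≢ s ⊎ t' ≢ t → LL s' t' Y ≈ 𝟎
  open Lifted

  Q : ℕ → ℕ → ℕ → Set
  Q s t = (_∈ S) − (s ∷ t ∷ [])

  module _ {s t : ℕ} (l : Lab (_∈ S) (s ∷ t ∷ [])) where

    s∈ : s ∈ S
    s∈ = incl l (here refl)

    t∈ : t ∈ S
    t∈ = incl l (there (here refl))

    s≢t : s ≢ t
    s≢t = All.head (AllPairs.head (uniq l))

    s≢p : s ≢ p
    s≢p refl = p∉ s∈

    t≢p : t ≢ p
    t≢p refl = p∉ t∈

    s≢r : s ≢ r
    s≢r refl = r∉ s∈

    t≢r : t ≢ r
    t≢r refl = r∉ t∈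

    from-S : ∀ {v} → v ∈ S → P v
    from-S = there ∘ there

    Q-in : ∀ {v} → Q s t v → (P ∖ p ∖ s ∖ r ∖ t) v
    Q-in (v , n) = (((from-S v , λ { refl → p∉ v }) , λ { refl → n (here refl) }) , λ { refl → r∉ v }) , λ { refl → n (there (here refl)) }

    start-in : ∀ {d h} → In (Q s t) d h → In (P ∖ p ∖ s) (suc d) ((r , t) ▷ h)
    start-in i = in▷ ((there (here refl) , ≢-sym p≢r) , ≢-sym s≢r) ((from-S t∈ , t≢p) , ≢-sym s≢t) (≢-sym t≢r) (In-mono Q-in i)

    start-in′ : ∀ {d h} → In (Q s t) d h → In P (2 + d) ((p , s) ▷ (r , t) ▷ h)
    start-in′ i = in▷ (here refl) (from-S s∈) (≢-sym s≢p) (start-in i)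

    LL-start : ∀ {d h} → In (Q s t) d h → LL s t ((p , s) ▷ (r , t) ▷ h) ≈ h
    LL-start i = ≈-trans (L-cong r t (link-same (λ ((_ , n) , _) → n refl) (start-in i))) (link-same (r∉ ∘ proj₁) i)

    LL-start-miss : ∀ {d h s' t'} → In (Q s t) d h → s' ≢ s ⊎ t' ≢ t → LL s' t' ((p , s) ▷ (r , t) ▷ h) ≈ 𝟎
    LL-start-miss {s' = s'} {t'} i n with s' ≟ s
    ... | no m = L𝟎 (link-other m (λ ((_ , n) , _) → n refl) (start-in i))
    ... | yes refl = ≈-trans (L-cong r t' (link-same (λ ((_ , n) , _) → n refl) (start-in i)))
                       (link-other ([ (λ m → contradiction refl m) , id ] n) (r∉ ∘ proj₁) i)

    lift-∂ : ∀ {G d h} → In (Q s t) (suc d) h → Lifted (Span G P (2 + d)) d s t (∂ₑ h)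
    lift-∂ {h = h} i = record { m = 0 ; Y = ∂ₑ x ; member = bdy (start-in′ i) ; cycle = ∂-In (start-in′ i) , ∂∂ x
      ; hit = ≈-trans (LL-∂ s t x) (≈-trans (∂-cong (LL-start i)) (≈-sym (⊙-idˡ _)))
      ; miss = λ {s'} {t'} _ _ n → ≈-trans (LL-∂ s' t' x) (∂-cong (LL-start-miss i n)) }
      where x = (p , s) ▷ (r , t) ▷ h

    -- Of the five terms of the pentagon only ps ∧ rt covers both `p` and `r` by different edges: of
    -- the others, one misses `p`, one misses `r`, and two contain the edge `pr`. The fifth vertex
    -- `x` is the factor [1,0] that is consumed.
    lift-pent : ∀ {H : Ch → Set} {x d g} → Lab (Q s t) (x ∷ []) → Cyc (Q s t − (x ∷ [])) d g → H (pent p s r t x ⋀ g) → Lifted H d s t g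
    lift-pent {x = x} {d} {g} lx (gi , gc) h = record { m = 0 ; Y = pent p s r t x ⋀ g ; member = h ; cycle = cyc
      ; hit = ≈-trans (LL-sum s∈ t∈) (≈-trans (LL-start gQ) (≈-sym (⊙-idˡ g)))
      ; miss = λ s'∈ t'∈ n → ≈-trans (LL-sum s'∈ t'∈) (LL-start-miss gQ n) }
      where
      x∈ : x ∈ S
      x∈ = proj₁ (incl lx (here refl))
      x≢s : x ≢ s
      x≢s e = proj₂ (incl lx (here refl)) (here e)
      x≢t : x ≢ t
      x≢t e = proj₂ (incl lx (here refl)) (there (here e))
      x≢p : x ≢ p
      x≢p refl = p∉ x∈
      x≢r : x ≢ r
      x≢r refl = r∉ x∈
      gQ : In (Q s t) d g
      gQ = In-mono proj₁ gi
      free : ∀ {v} → (Q s t − (x ∷ [])) v → v ∈ S × v ≢ s × v ≢ t × v ≢ x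
      free ((v , n) , m) = v , (λ { refl → n (here refl) }) , (λ { refl → n (there (here refl)) }) , (λ { refl → m (here refl) })
      five : Lab P (p ∷ s ∷ r ∷ t ∷ x ∷ [])
      five = lab! ((≢-sym s≢p ∷ p≢r ∷ ≢-sym t≢p ∷ ≢-sym x≢p ∷ []) ∷ (s≢r ∷ s≢t ∷ ≢-sym x≢s ∷ []) ∷ (≢-sym t≢r ∷ ≢-sym x≢r ∷ []) ∷ (≢-sym x≢t ∷ []) ∷ [] ∷ [])
        λ { (here refl) → here refl ; (there (here refl)) → from-S s∈ ; (there (there (here refl))) → there (here refl)
          ; (there (there (there (here refl)))) → from-S t∈ ; (there (there (there (there (here refl))))) → from-S x∈ }
      cyc : Cyc P (2 + d) (pent p s r t x ⋀ g)
      cyc = cyc-⋀ (λ i q → let v , vs , vt , vx = free q in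
          case i of λ { (here refl) → p∉ v ; (there (here refl)) → vs refl ; (there (there (here refl))) → r∉ v
                      ; (there (there (there (here refl)))) → vt refl ; (there (there (there (there (here refl))))) → vx refl })
        (incl five) (λ q → from-S (proj₁ (free q))) (pent-cyc (uniq five)) (gi , gc)
      T₂ T₃ T₄ T₅ : Ch
      T₂ = (r , t) ▷ (s , x) ▷ g
      T₃ = (s , x) ▷ (p , r) ▷ g
      T₄ = (p , r) ▷ (t , x) ▷ g
      T₅ = (t , x) ▷ (p , s) ▷ g
      T₂-in : In (P ∖ p) (2 + d) T₂
      T₂-in = in▷ (there (here refl) , ≢-sym p≢r) (from-S t∈ , t≢p) (≢-sym t≢r) (in▷ (((from-S s∈ , s≢p) , s≢r) , s≢t) (((from-S x∈ , x≢p) , x≢r) , x≢t) (≢-sym x≢s)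
        (In-mono (λ q → let v , vs , vt , vx = free q in ((((from-S v , λ { refl → p∉ v }) , λ { refl → r∉ v }) , vt) , vs) , vx) gi))
      tx-in : In (P ∖ p) (suc d) ((t , x) ▷ g)
      tx-in = in▷ (from-S t∈ , t≢p) (from-S x∈ , x≢p) (≢-sym x≢t) (In-mono (λ q → let v , vs , vt , vx = free q in ((from-S v , λ { refl → p∉ v }) , vt) , vx) gi)
      T₅-in : In (P ∖ r) (2 + d) T₅
      T₅-in = in▷ (from-S t∈ , t≢r) (from-S x∈ , x≢r) (≢-sym x≢t) (in▷ (((here refl , p≢r) , ≢-sym t≢p) , ≢-sym x≢p) (((from-S s∈ , s≢r) , s≢t) , ≢-sym x≢s) (≢-sym s≢p)
        (In-mono (λ q → let v , vs , vt , vx = free q in ((((from-S v , λ { refl → r∉ v }) , vt) , vx) , λ { refl → p∉ v }) , vs) gi))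
      LL-sum : ∀ {s' t'} → s' ∈ S → t' ∈ S → LL s' t' (pent p s r t x ⋀ g) ≈ LL s' t' ((p , s) ▷ (r , t) ▷ g)
      LL-sum {s'} {t'} s'∈ t'∈ = ≈-trans (⊕-elimʳ z₅) (≈-trans (⊕-elimʳ z₄) (≈-trans (⊕-elimʳ z₃) (⊕-elimʳ z₂)))
        where
        s'≢r : s' ≢ r
        s'≢r refl = r∉ s'∈
        z₂ : LL s' t' T₂ ≈ 𝟎
        z₂ = L𝟎 (L-out (λ (_ , n) → n refl) T₂-in)
        z₃ : LL s' t' T₃ ≈ 𝟎
        z₃ = L𝟎 (≈-trans (L-miss (s , x) ((p , r) ▷ g) λ { (inj₁ (e , _)) → s≢p (sym e) ; (inj₂ (e , _)) → x≢p (sym e) })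
               (⊖▷-elim (link-other s'≢r (p∉ ∘ proj₁) gQ)))
        z₄ : LL s' t' T₄ ≈ 𝟎
        z₄ = L𝟎 (link-other s'≢r (λ (_ , n) → n refl) tx-in)
        z₅ : LL s' t' T₅ ≈ 𝟎
        z₅ = ≈-trans (D-anti _ _ T₅) (⊙-𝟎 (L𝟎 (L-out (λ (_ , n) → n refl) T₅-in)))

    -- Lifts exist only up to powers of 6, and these depend on the class; in a sum both lifts are
    -- brought to a common multiple.
    lift-span : ∀ {G G' d} → (∀ {a} → G' a → Lifted (Span G P (2 + d)) d s t a) → ∀ {a} → Span G' (Q s t) d a → Lifted (Span G P (2 + d)) d s t a
    lift-span g (gen x) = g x
    lift-span g (bdy i) = lift-∂ i
    lift-span g (add {a} {b} x y) = record { m = X₁.m + X₂.m ; Y = pow X₂.m ⊙ X₁.Y ⊕ pow X₁.m ⊙ X₂.Y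
      ; member = add (scl _ X₁.member) (scl _ X₂.member)
      ; cycle = in⊕ (in⊙ _ (X₁.cycle .isIn)) (in⊙ _ (X₂.cycle .isIn)) , ⊕-𝟎 (⊙-𝟎 (X₁.cycle .isCycle)) (⊙-𝟎 (X₂.cycle .isCycle))
      ; hit = ≈-trans (⊕-cong (⊙-cong _ X₁.hit) (⊙-cong _ X₂.hit)) (mk λ φ A → trans (lem (pow X₁.m) (pow X₂.m) ⟨ a ∣ φ ⟩ ⟨ b ∣ φ ⟩) (cong (ℤ._* (⟨ a ∣ φ ⟩ ℤ.+ ⟨ b ∣ φ ⟩)) (sym (pow-+ X₁.m X₂.m))))
      ; miss = λ i j n → ⊕-𝟎 (⊙-𝟎 (X₁.miss i j n)) (⊙-𝟎 (X₂.miss i j n)) }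
      where
      module X₁ = Lifted (lift-span g x)
      module X₂ = Lifted (lift-span g y)
      lem : ∀ p q a b → q ℤ.* (p ℤ.* a) ℤ.+ p ℤ.* (q ℤ.* b) ≡ p ℤ.* q ℤ.* (a ℤ.+ b)
      lem = solve-∀
    lift-span g (scl {a} k x) = record { m = X₁.m ; Y = k ⊙ X₁.Y ; member = scl k X₁.member ; cycle = in⊙ k (X₁.cycle .isIn) , ⊙-𝟎 (X₁.cycle .isCycle)
      ; hit = ≈-trans (⊙-cong k X₁.hit) (⊙-comm k _ a) ; miss = λ i j n → ⊙-𝟎 (X₁.miss i j n) }
      where module X₁ = Lifted (lift-span g x)
    lift-span g (rsp e x) = record { Lifted X₁ ; hit = ≈-trans (X₁ .hit) (⊙-cong _ e) }
      where X₁ = lift-span g x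
    lift-span g (div {a} x) = record { m = suc X₁.m ; Y = X₁.Y ; member = X₁.member ; cycle = X₁.cycle ; miss = X₁.miss
      ; hit = ≈-trans X₁.hit (≈-trans (⊙-comm _ (+ 6) a) (⊙-assoc (+ 6) _ a)) }
      where module X₁ = Lifted (lift-span g x)

  valid-pair : ∀ {s t} → s ∈ S → t ∈ S → s ≢ t → Lab (_∈ S) (s ∷ t ∷ [])
  valid-pair i j n = lab! ((n ∷ []) ∷ [] ∷ []) λ { (here refl) → i ; (there (here refl)) → j }

  LL-cyc : ∀ {d z s t} → s ∈ S → t ∈ S → Cyc P (2 + d) z → Cyc (Q s t) d (LL s t z)
  LL-cyc {s = s} {t} i j c = Cyc-mono (λ { ((((v , vp) , vs) , vr) , vt) → into v vp vr , λ { (here e) → vs e ; (there (here e)) → vt e } }) (L-cyc r t (L-cyc p s c))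
    where
    into : ∀ {v} → P v → v ≢ p → v ≢ r → v ∈ S
    into (here e) m n = contradiction e m
    into (there (here e)) m n = contradiction e n
    into (there (there v)) m n = v

  LL-degenerate : ∀ {d z} → In P (suc d) z → (∀ {s t} → s ∈ S → t ∈ S → s ≢ t → LL s t z ≈ 𝟎) → ∀ s t → LL s t z ≈ 𝟎
  LL-degenerate {zero} i h s t = L₀ (In-L p s i)
  LL-degenerate {suc d} {z} i h s t with s ∈? (p ∷ r ∷ S) | t ∈? (p ∷ r ∷ S) | s ≟ t
  ... | no n | _ | _ = L𝟎 (L-outʳ n i)
  ... | _ | no n | _ = L-outʳ (λ ((v , _) , _) → n v) (In-L p s i)
  ... | _ | _ | yes refl = L-outʳ (λ (_ , n) → n refl) (In-L p s i)
  ... | yes (here refl) | _ | _ = L𝟎 (L-loop i)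
  ... | yes (there (here refl)) | _ | _ = L-out (λ (_ , n) → n refl) (In-L p s i)
  ... | _ | yes (here refl) | _ = L-outʳ (λ ((_ , n) , _) → n refl) (In-L p s i)
  ... | _ | yes (there (here refl)) | _ = L-loop (In-L p s i)
  ... | yes (there (there s∈)) | yes (there (there t∈)) | no n = h s∈ t∈ n

  module _ {G : Ch → Set} {d : ℕ}
    (tri-case : ∀ {a b c w} → Lab P (a ∷ b ∷ c ∷ []) → Cyc (P − (a ∷ b ∷ c ∷ [])) d w → Span G P (suc d) (tri a b c ⋀ w)) where

    separated : ∀ {z} → Cyc P (suc d) z → (∀ {s t} → s ∈ S → t ∈ S → s ≢ t → LL s t z ≈ 𝟎) → Span G P (suc d) z
    separated {z} c h = rsp (≈-sym eq) (add (add (span-∑ S λ i → case₁ i) (span-∑ S λ i → case₂ i))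
        (bdy (in▷ (here refl) (there (here refl)) p≢r (In-mono (λ v → (there (there v) , λ { refl → p∉ v }) , λ { refl → r∉ v }) e-in))))
      where
      open Sep (separate u c (LL-degenerate (c .isIn) h)) renaming (b to b′; c to c′)
      case₁ : ∀ {s} → s ∈ S → Span G P (suc d) (tri s p r ⋀ b′ s)
      case₁ {s} i = tri-case (lab! (((λ { refl → p∉ i }) ∷ (λ { refl → r∉ i }) ∷ []) ∷ (p≢r ∷ []) ∷ [] ∷ [])
          λ { (here refl) → there (there i) ; (there (here refl)) → here refl ; (there (there (here refl))) → there (here refl) })
        (Cyc-mono (λ (v , n) → there (there v) , λ { (here e) → n e ; (there (here refl)) → p∉ v ; (there (there (here refl))) → r∉ v }) b-cyc)
      case₂ : ∀ {t} → t ∈ S → Span G P (suc d) (tri t r p ⋀ c′ t)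
      case₂ {t} i = tri-case (lab! (((λ { refl → r∉ i }) ∷ (λ { refl → p∉ i }) ∷ []) ∷ (≢-sym p≢r ∷ []) ∷ [] ∷ [])
          λ { (here refl) → there (there i) ; (there (here refl)) → there (here refl) ; (there (there (here refl))) → here refl })
        (Cyc-mono (λ (v , n) → there (there v) , λ { (here e) → n e ; (there (here refl)) → r∉ v ; (there (there (here refl))) → p∉ v }) c-cyc)

  -- The pairs (s, t) are cleared one at a time by subtracting a lift of the coefficient there. The
  -- lift has zero coefficient at all other pairs, so what is cleared stays clear. Once nothing is
  -- left, `separate` writes the cycle through triangles times cycles.
  eliminate : ∀ {G d} → (∀ {a b c w} → Lab P (a ∷ b ∷ c ∷ []) → Cyc (P − (a ∷ b ∷ c ∷ [])) (suc d) w → Span G P (2 + d) (tri a b c ⋀ w)) →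
    (∀ {s t a} → Lab (_∈ S) (s ∷ t ∷ []) → Cyc (Q s t) d a → Lifted (Span G P (2 + d)) d s t a) →
    ∀ {z} → Cyc P (2 + d) z → Span G P (2 + d) z
  eliminate {G} {d} h₁ h₂ c = go (Data.List.cartesianProduct S S) (λ i → ∈-cartesianProduct⁻ S S i) c λ i j n m → contradiction (∈-cartesianProduct⁺ i j) m
    where
    -- `ps` lists the pairs still to be treated; the coefficients at all other pairs are already
    -- zero.
    go : ∀ ps → (∀ {s t} → (s , t) ∈ ps → s ∈ S × t ∈ S) → ∀ {z} → Cyc P (2 + d) z →
         (∀ {s t} → s ∈ S → t ∈ S → s ≢ t → (s , t) ∉ ps → LL s t z ≈ 𝟎) → Span G P (2 + d) z
    go [] v c h = separated h₁ c λ i j n → h i j n λ ()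
    go ((s , t) ∷ ps) v {z} c h with s ≟ t
    ... | yes refl = go ps (v ∘ there) c λ { i j n m → h i j n λ { (here refl) → n refl ; (there k) → m k } }
    ... | no ne = div-pow F.m (rsp (⊕-undo (pow F.m ⊙ z) F.Y) (add (go ps (v ∘ there) z'-cyc zero!) F.member))
      where
      is = proj₁ (v (here refl))
      it = proj₂ (v (here refl))
      module F = Lifted (h₂ (valid-pair is it ne) (LL-cyc is it c))
      z' = pow F.m ⊙ z ⊕ ⊖ F.Y
      z'-cyc : Cyc P (2 + d) z'
      z'-cyc = in⊕ (in⊙ _ (c .isIn)) (in⊙ _ (F.cycle .isIn)) , ⊕-𝟎 (⊙-𝟎 (c .isCycle)) (⊙-𝟎 (F.cycle .isCycle))
      zero! : ∀ {s' t'} → s' ∈ S → t' ∈ S → s' ≢ t' → (s' , t') ∉ ps → LL s' t' z' ≈ 𝟎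
      zero! {s'} {t'} i j n m with s' ≟ s | t' ≟ t
      ... | yes refl | yes refl = ≈-trans (⊕-cong ≈-refl (⊙-cong _ F.hit)) (⊕-inv _)
      ... | no k | _ = ⊕-𝟎 (⊙-𝟎 (h i j n λ { (here refl) → k refl ; (there l) → m l })) (⊙-𝟎 (F.miss i j (inj₁ k)))
      ... | yes _ | no k = ⊕-𝟎 (⊙-𝟎 (h i j n λ { (here refl) → k refl ; (there l) → m l })) (⊙-𝟎 (F.miss i j (inj₂ k)))

-- Generation by induction on the number of vertices

−-++ : ∀ {P : ℕ → Set} xs {ys v} → (P − xs − ys) v → (P − (xs ++ ys)) v
−-++ xs ((p , m) , n) = p , [ m , n ] ∘ ∈-++⁻ xs

Lab-swap : ∀ {P} xs ys {zs} → Lab P (xs ++ ys ++ zs) → Lab P (ys ++ xs ++ zs)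
Lab-swap xs ys l = let lx , lyz = Lab-split xs l ; ly , lz = Lab-split ys lyz in
  Lab-++ (Lab-mono proj₁ ly) (Lab-++ (lab! (uniq lx) λ i → incl lx i , λ j → proj₂ (incl ly j) i)
    (Lab-mono (λ ((p , m) , n) → (p , n) , m) lz))

-- tri, pents and spectators are the types [3,1], [5,2]^q and [1,0]; w stands for an arbitrary cycle.
data GenA (P : ℕ → Set) (q : ℕ) : Ch → Set where
  ga : ∀ {a b c x vs} → Lab P (a ∷ b ∷ c ∷ x ∷ vs) → length vs ≡ quin q → GenA P q (tri a b c ⋀ pents vs)

data GenB (P : ℕ → Set) : ℕ → Ch → Set where
  gb : ∀ {q x vs} → Lab P (x ∷ vs) → length vs ≡ quin q → GenB P q (pents vs)
  gb′ : ∀ {q a b c x w} → Lab P (a ∷ b ∷ c ∷ x ∷ []) → Cyc (P − (a ∷ b ∷ c ∷ x ∷ [])) (suc (dbl q)) w → GenB P (suc q) (tri a b c ⋀ w)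

data GenC (P : ℕ → Set) : ℕ → Ch → Set where
  gc : ∀ {q a b c vs} → Lab P (a ∷ b ∷ c ∷ vs) → length vs ≡ quin q → GenC P q (tri a b c ⋀ pents vs)
  gc′ : ∀ {q a b c a' b' c' w} → let six = a ∷ b ∷ c ∷ a' ∷ b' ∷ c' ∷ [] in
        Lab P six → Cyc (P − six) (suc (dbl q)) w → GenC P (suc q) (tri a b c ⋀ tri a' b' c' ⋀ w)

data GenD (P : ℕ → Set) : ℕ → Ch → Set where
  gd : ∀ {q vs} → Lab P vs → length vs ≡ quin q → GenD P q (pents vs)
  gd′ : ∀ {q a b c w} → Lab P (a ∷ b ∷ c ∷ []) → Cyc (P − (a ∷ b ∷ c ∷ [])) (suc (dbl q)) w → GenD P (suc q) (tri a b c ⋀ w)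

-- For d edges on n vertices: kA, kB, kC, kD are the cases 5d - 2n = -3, -2, -1, 0, and kV₀, kV₁ (d even, d odd) the range
-- 5d - 2n ≤ -4, in which the homology vanishes away from 3.
data Kind : Set where
  kV₀ kV₁ kA kB kC kD : ℕ → Kind

deg : Kind → ℕ
deg (kV₀ q) = dbl q
deg (kV₁ q) = suc (dbl q)
deg (kA q) = suc (dbl q)
deg (kB q) = dbl q
deg (kC q) = suc (dbl q)
deg (kD q) = dbl q

Size : Kind → ℕ → Set
Size (kV₀ q) n = 2 + quin q ≤ n
Size (kV₁ q) n = 5 + quin q ≤ n
Size (kA q) n = n ≡ 4 + quin q
Size (kB q) n = n ≡ 1 + quin q
Size (kC q) n = n ≡ 3 + quin q
Size (kD q) n = n ≡ quin q

Gen : Kind → (ℕ → Set) → Ch → Set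
Gen (kA q) P = GenA P q
Gen (kB q) P = GenB P q
Gen (kC q) P = GenC P q
Gen (kD q) P = GenD P q
Gen _ P _ = ⊥

Generated : Kind → List ℕ → Set
Generated κ S = Unique S → Size κ (length S) → ∀ {z} → Cyc (_∈ S) (deg κ) z → Span (Gen κ (_∈ S)) (_∈ S) (deg κ) z

scalar : ∀ {P z} → In P 0 z → Σ ℤ λ k → z ≈ k ⊙ vac
scalar in𝟎 = 0ℤ , ≈-sym (⊙-zeroˡ vac)
scalar invac = 1ℤ , ≈-sym (⊙-idˡ vac)
scalar (in⊕ i j) = let k , e = scalar i ; m , f = scalar j in k ℤ.+ m , ≈-trans (⊕-cong e f) (mk λ φ A → sym (ℤₚ.*-distribʳ-+ ⟨ vac ∣ φ ⟩ k m))
scalar (in⊙ k i) = let m , e = scalar i in k ℤ.* m , ≈-trans (⊙-cong k e) (⊙-assoc k m vac)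
scalar (in≈ e i) = let k , f = scalar i in k , ≈-trans (≈-sym e) f

module Step (S : List ℕ) (ih : ∀ κ T′ → length T′ < length S → Generated κ T′) where

  rest : ∀ {vs} → Lab (_∈ S) vs → Unique S → Removed S vs
  rest l u = remove u l

  module _ (u : Unique S) {a b c : ℕ} (l : Lab (_∈ S) (a ∷ b ∷ c ∷ [])) where
    open Removed (remove u l)

    tri-ih : ∀ {H w} κ → Size κ (length left) → Cyc ((_∈ S) − (a ∷ b ∷ c ∷ [])) (deg κ) w →
             (∀ {g} → Gen κ (_∈ left) g → Span H (_∈ S) (suc (deg κ)) (tri a b c ⋀ g)) → Span H (_∈ S) (suc (deg κ)) (tri a b c ⋀ w)
    tri-ih κ s wc h = tri-⋀ l to h (ih κ left (subst (length left <_) (sym left-length) (ℕₚ.m≤n+m (suc (length left)) 2)) left-uniq s (Cyc-mono (λ (v , n) → from v n) wc))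

    left-≡ : ∀ {n} → length S ≡ 3 + n → length left ≡ n
    left-≡ e = ℕₚ.+-cancelˡ-≡ 3 _ _ (trans (sym left-length) e)

    left-≤ : ∀ {n} → 3 + n ≤ length S → n ≤ length left
    left-≤ e = ℕₚ.+-cancelˡ-≤ 3 _ _ (subst (_ ≤_) left-length e)

    on-A : ∀ {H q g} → GenA (_∈ left) q g → Span H (_∈ S) (2 + dbl q) (tri a b c ⋀ g)
    on-A {q = q} (ga {a'} {b'} {c'} {x} {vs} k e) =
      let seven = a ∷ b ∷ c ∷ a' ∷ b' ∷ c' ∷ x ∷ []
          k₁ , k₂ = Lab-split seven (Lab-++ l (Lab-mono to k))
      in tri²-spectator k₁ (Cyc-mono (incl k₂) (pents-cyc q (uniq k₂) e))

    on-B : ∀ {q g} → GenB (_∈ left) q g → Span (GenA (_∈ S) q) (_∈ S) (suc (dbl q)) (tri a b c ⋀ g)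
    on-B (gb k e) = gen (ga (Lab-++ l (Lab-mono to k)) e)
    on-B (gb′ k wc) = tri²-spectator (Lab-++ l (Lab-mono to k)) (Cyc-mono (λ (v , n) → −-++ {_∈ S} (a ∷ b ∷ c ∷ []) (to v , n)) wc)

    on-C : ∀ {q g} → GenC (_∈ left) q g → Span (GenB (_∈ S) (suc q)) (_∈ S) (2 + dbl q) (tri a b c ⋀ g)
    on-C {q} (gc {a = a'} {b'} {c'} {vs} k e) =
      let six = a ∷ b ∷ c ∷ a' ∷ b' ∷ c' ∷ []
          k₁ , k₂ = Lab-split six (Lab-++ l (Lab-mono to k))
      in tri²-exchange k₁ (Cyc-mono (incl k₂) (pents-cyc q (uniq k₂) e)) λ u₁ i₁ →
           gen (gb (Lab-++ (lab! u₁ (incl k₁ ∘ i₁)) (Lab-mono (λ (p , n) → p , n ∘ i₁) k₂)) (cong (5 ℕ.+_) e))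
    -- Of the three triangles the first two become a pentagon and a free vertex `x`. The third is
    -- kept as the triangle of `gb′`, and the pentagon joins its arbitrary cofactor.
    on-C (gc′ {q} {a'} {b'} {c'} {a''} {b''} {c''} {w} k wc) =
      let six = a ∷ b ∷ c ∷ a' ∷ b' ∷ c' ∷ []
          abc = a'' ∷ b'' ∷ c'' ∷ []
          k₁ , k₂ = Lab-split six {abc} (Lab-++ l (Lab-mono to k))
          w-out : ∀ {v} → ((_∈ left) − (a' ∷ b' ∷ c' ∷ a'' ∷ b'' ∷ c'' ∷ [])) v → ((_∈ S) − six − abc) v
          w-out (v , n) = let p , m = to v in (p , λ i → [ m , n ∘ ∈-++⁺ˡ ] (∈-++⁻ (a ∷ b ∷ c ∷ []) i)) , n ∘ ∈-++⁺ʳ (a' ∷ b' ∷ c' ∷ [])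
      in tri²-exchange k₁ (cyc-⋀ (λ i j → proj₂ (w-out j) i) (incl k₂) (proj₁ ∘ w-out) (tri-cyc (uniq k₂)) wc) λ {x} {v₁} {v₂} {v₃} {v₄} {v₅} u₁ i₁ →
           let x-new : x ∉ abc
               x-new j = proj₂ (incl k₂ j) (i₁ (here refl))
           in rsp (tri-pent w (uniq k₂) (AllPairs.tail u₁)) (gen (gb′ {q = suc q}
             (Lab-++ (Lab-mono proj₁ k₂) (lab! ([] ∷ []) λ { (here refl) → incl k₁ (i₁ (here refl)) , x-new }))
             (cyc-⋀ (λ i j → proj₂ (proj₁ (w-out j)) (i₁ (there i)))
               (λ i → incl k₁ (i₁ (there i)) , λ j → case ∈-++⁻ abc j of λ
                 { (inj₁ m) → proj₂ (incl k₂ m) (i₁ (there i)) ; (inj₂ (here refl)) → All.lookup (AllPairs.head u₁) i refl })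
               (λ j → let (p , n) , m = w-out j in p , λ h → case ∈-++⁻ abc h of λ { (inj₁ h') → m h' ; (inj₂ (here refl)) → n (i₁ (here refl)) })
               (pent-cyc (AllPairs.tail u₁)) wc)))

    on-D : ∀ {q g} → GenD (_∈ left) q g → Span (GenC (_∈ S) q) (_∈ S) (suc (dbl q)) (tri a b c ⋀ g)
    on-D (gd k e) = gen (gc (Lab-++ l (Lab-mono to k)) e)
    on-D (gd′ k wc) = gen (gc′ (Lab-++ l (Lab-mono to k)) (Cyc-mono (λ (v , n) → −-++ {_∈ S} (a ∷ b ∷ c ∷ []) (to v , n)) wc))

    -- Removing [3,1] may leave the vanishing range by one step, to the case -3. There each
    -- generator has a triangle and a free vertex, and with the removed triangle it cancels.
    on-V : ∀ {H q w} → 4 + quin q ≤ length left → Cyc ((_∈ S) − (a ∷ b ∷ c ∷ [])) (suc (dbl q)) w → Span H (_∈ S) (2 + dbl q) (tri a b c ⋀ w)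
    on-V {q = q} s wc with length left ≟ 4 + quin q
    ... | yes e = tri-ih (kA q) e wc on-A
    ... | no n = tri-ih (kV₁ q) (ℕₚ.≤∧≢⇒< s (≢-sym n)) wc λ ()

module Step₂ {p r : ℕ} {S : List ℕ} (ih : ∀ κ T′ → length T′ < length (p ∷ r ∷ S) → Generated κ T′) (u : Unique (p ∷ r ∷ S)) where
  open Elimination u
  open Step (p ∷ r ∷ S) ih

  module _ {s t : ℕ} (l : Lab (_∈ S) (s ∷ t ∷ [])) where
    open Removed (remove (AllPairs.tail (AllPairs.tail u)) l)

    lift-ih : ∀ {G a} κ → Size κ (length left) → Cyc (Q s t) (deg κ) a →
              (∀ {g} → Gen κ (_∈ left) g → Lifted (Span G P (2 + deg κ)) (deg κ) s t g) → Lifted (Span G P (2 + deg κ)) (deg κ) s t a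
    lift-ih {G} κ z c h = lift-span l h (span-lift (ih κ left lt left-uniq z (Cyc-mono (λ (v , n) → from v n) c)))
      where
      span-lift : ∀ {a} → Span (Gen κ (_∈ left)) (_∈ left) (deg κ) a → Span (Gen κ (_∈ left)) (Q s t) (deg κ) a
      span-lift = span-bind to gen
      lt : length left < 2 + length S
      lt = subst (λ n → length left < 2 + n) (sym left-length) (ℕₚ.m≤n+m (suc (length left)) 3)

    left-≡₂ : ∀ {n} → 2 + length S ≡ 4 + n → length left ≡ n
    left-≡₂ e = ℕₚ.+-cancelˡ-≡ 4 _ _ (trans (sym (cong (2 ℕ.+_) left-length)) e)

    left-≤₂ : ∀ {n} → 4 + n ≤ 2 + length S → n ≤ length left
    left-≤₂ e = ℕₚ.+-cancelˡ-≤ 4 _ _ (subst (λ k → _ ≤ 2 + k) left-length e)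

    psrt : ∀ {ys} → Lab (Q s t) ys → Lab P (p ∷ s ∷ r ∷ t ∷ ys)
    psrt k = Lab-++ {xs = p ∷ s ∷ r ∷ t ∷ []}
      (lab! ((≢-sym (s≢p l) ∷ p≢r ∷ ≢-sym (t≢p l) ∷ []) ∷ (s≢r l ∷ s≢t l ∷ []) ∷ (≢-sym (t≢r l) ∷ []) ∷ [] ∷ [])
        λ { (here refl) → here refl ; (there (here refl)) → there (there (s∈ l)) ; (there (there (here refl))) → there (here refl) ; (there (there (there (here refl)))) → there (there (t∈ l)) })
      (Lab-mono (λ { (v , n) → there (there v) , λ { (here refl) → p∉ v ; (there (here refl)) → n (here refl) ; (there (there (here refl))) → r∉ v ; (there (there (there (here refl)))) → n (there (here refl)) } }) k)

    psrt-tri : ∀ {a b c ys} → Lab (Q s t) (a ∷ b ∷ c ∷ ys) → Lab P (a ∷ b ∷ c ∷ p ∷ s ∷ r ∷ t ∷ ys)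
    psrt-tri {a} {b} {c} k = Lab-swap (p ∷ s ∷ r ∷ t ∷ []) (a ∷ b ∷ c ∷ []) (psrt k)

    lift-A : ∀ {q g} → GenA (_∈ left) q g → Lifted (Span (GenC P (suc q)) P (3 + dbl q)) (suc (dbl q)) s t g
    lift-A {q} (ga {a} {b} {c} {x} {vs} k e) =
      let k' = Lab-mono to k
          abc = a ∷ b ∷ c ∷ []
          k₁ , k₂ = Lab-split abc k'
          k₃ , k₄ = Lab-split (x ∷ []) k₂
          big = psrt-tri k'
          _ , tail′ = Lab-split abc big
          pent-lab , _ = Lab-split (p ∷ s ∷ r ∷ t ∷ x ∷ []) tail′
      in lift-pent l {x = x} (Lab-mono proj₁ k₃)
           (cyc-⋀ (λ i j → proj₂ (proj₁ (incl k₄ j)) i) (λ i → incl k₁ i , λ { (here refl) → proj₂ (incl k₃ (here refl)) i })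
             (λ j → let (v , _) , n = incl k₄ j in v , n) (tri-cyc (uniq k₁)) (pents-cyc q (uniq k₄) e))
           (rsp (tri-pent (pents vs) (uniq k₁) (uniq pent-lab)) (gen (gc big (cong (5 ℕ.+_) e))))

    lift-B : ∀ {q g} → GenB (_∈ left) q g → Lifted (Span (GenD P (suc q)) P (2 + dbl q)) (dbl q) s t g
    lift-B {q} (gb {x = x} {vs} k e) =
      let k' = Lab-mono to k ; k₁ , k₂ = Lab-split (x ∷ []) k'
      in lift-pent l {x = x} k₁ (Cyc-mono (incl k₂) (pents-cyc q (uniq k₂) e)) (gen (gd (psrt k') (cong (5 ℕ.+_) e)))
    lift-B (gb′ {q} {a} {b} {c} {x} {w} k wc) =
      let k' = Lab-mono to k
          abc = a ∷ b ∷ c ∷ []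
          k₁ , k₂ = Lab-split abc k'
          big = psrt-tri k'
          abc-lab , tail′ = Lab-split abc big
          w-out : ∀ {v} → ((_∈ left) − (a ∷ b ∷ c ∷ x ∷ [])) v → Q s t v × v ∉ abc × v ∉ x ∷ []
          w-out (v , n) = to v , n ∘ ∈-++⁺ˡ , n ∘ ∈-++⁺ʳ abc
      in lift-pent l {x = x} (Lab-mono proj₁ k₂)
           (cyc-⋀ (λ i j → proj₁ (proj₂ (w-out j)) i) (λ i → incl k₁ i , λ { (here refl) → proj₂ (incl k₂ (here refl)) i })
             (λ j → let v , _ , n = w-out j in v , n) (tri-cyc (uniq k₁)) wc)
           (rsp (tri-pent w (uniq k₁) (uniq tail′)) (gen (gd′ {q = suc q} abc-lab
             (cyc-⋀ (λ { i j → let (v , n) , _ , m = w-out j in case i of λ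
                  { (here refl) → p∉ v ; (there (here refl)) → n (here refl) ; (there (there (here refl))) → r∉ v
                  ; (there (there (there (here refl)))) → n (there (here refl)) ; (there (there (there (there h)))) → m h } })
               (incl tail′) (λ j → let (v , _) , n , _ = w-out j in there (there v) , n) (pent-cyc (uniq tail′)) wc))))

  -- With a single edge no two vertices can be covered by different edges, so there is nothing to
  -- eliminate.
  low : ∀ {G z} → (∀ {a b c w} → Lab P (a ∷ b ∷ c ∷ []) → Cyc (P − (a ∷ b ∷ c ∷ [])) 0 w → Span G P 1 (tri a b c ⋀ w)) → Cyc P 1 z → Span G P 1 z
  low h c = separated h c λ {s} {t} _ _ _ → L₀ (In-L p s (c .isIn))

  -- The triangle part leads from -3 to -2, from -2 to -1 and from -1 to 0. Linking two edges lowers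
  -- 5d - 2n by 2, which leads from 0 to -2, from -1 to -3, and otherwise into the vanishing range.
  -- At 0 the triangle part needs no recursion, since `gd′` admits any cofactor.
  step : ∀ κ → Size κ (2 + length S) → ∀ {z} → Cyc P (deg κ) z → Span (Gen κ P) P (deg κ) z
  -- With two vertices available the empty simplex is the boundary of the single edge `pr`.
  step (kV₀ zero) z c = let k , e = scalar (c .isIn) in
    rsp (≈-trans (⊙-cong k (∂-edge (p , r) ≈-refl)) (≈-sym e)) (scl k (bdy (in▷ (here refl) (there (here refl)) p≢r invac)))
  step (kV₀ (suc q)) z = eliminate (λ l → on-V u l (left-≤ u l z)) (λ l c → lift-ih l (kV₀ q) (left-≤₂ l (ℕₚ.≤-trans (ℕₚ.n≤1+n _) z)) c λ ())
  step (kV₁ zero) z = low λ l c → tri-ih u l (kV₀ 0) (left-≤ u l z) c λ ()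
  step (kV₁ (suc q)) z = eliminate (λ l c → tri-ih u l (kV₀ (suc q)) (left-≤ u l z) c λ ()) (λ l c → lift-ih l (kV₁ q) (left-≤₂ l (ℕₚ.≤-trans (ℕₚ.n≤1+n _) z)) c λ ())
  step (kA zero) z = low λ l c → tri-ih u l (kB 0) (left-≡ u l z) c (on-B u l)
  step (kA (suc q)) z = eliminate (λ l c → tri-ih u l (kB (suc q)) (left-≡ u l z) c (on-B u l)) (λ l c → lift-ih l (kV₁ q) (ℕₚ.≤-reflexive (sym (left-≡₂ l z))) c λ ())
  step (kB zero) ()
  step (kB (suc q)) z = eliminate (λ l c → tri-ih u l (kC q) (left-≡ u l z) c (on-C u l)) (λ l c → lift-ih l (kV₀ q) (ℕₚ.≤-reflexive (sym (left-≡₂ l z))) c λ ())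
  step (kC zero) z = low λ l c → tri-ih u l (kD 0) (left-≡ u l z) c (on-D u l)
  step (kC (suc q)) z = eliminate (λ l c → tri-ih u l (kD (suc q)) (left-≡ u l z) c (on-D u l)) (λ l c → lift-ih l (kA q) (left-≡₂ l z) c (lift-A l))
  step (kD zero) ()
  step (kD (suc q)) z = eliminate (λ l c → gen (gd′ l c)) (λ l c → lift-ih l (kB q) (left-≡₂ l z) c (lift-B l))

-- Recursion on a bound for the number of vertices. With at most one vertex, the size conditions
-- leave only cases without edges, where every chain is a multiple of the empty simplex.
generated : ∀ n κ S → length S < n → Generated κ S
generated (suc n) κ (p ∷ r ∷ S) lt u = Step₂.step (λ κ T′ l → generated n κ T′ (ℕₚ.<-≤-trans l (ℕₚ.≤-pred lt))) u κ
generated n (kV₀ q) [] lt u ()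
generated n (kV₁ q) [] lt u ()
generated n (kA q) [] lt u ()
generated n (kB q) [] lt u ()
generated n (kC q) [] lt u ()
generated n (kD zero) [] lt u e c = let k , h = scalar (c .isIn) in rsp (≈-sym h) (scl k (gen (gd {vs = []} (lab! [] λ ()) refl)))
generated n (kV₀ q) (x ∷ []) lt u (s≤s ())
generated n (kV₁ q) (x ∷ []) lt u (s≤s ())
generated n (kA q) (x ∷ []) lt u ()
generated n (kB zero) (x ∷ []) lt u e c = let k , h = scalar (c .isIn) in rsp (≈-sym h) (scl k (gen (gb {x = x} {vs = []} (lab! u id) refl)))
generated n (kC q) (x ∷ []) lt u ()
generated n (kD zero) (x ∷ []) lt u ()

-- Chessboard cycles

-- Laplace expansion along one row: `r` is the entry of the row in a column, and `G` the minor on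
-- the remaining columns.
det : (ℕ → Ch → Ch) → (List ℕ → Ch) → List ℕ → Ch
det r G [] = 𝟎
det r G (x ∷ xs) = r x (G xs) ⊕ ⊖ det r (G ∘ (x ∷_)) xs

one : ℕ → Ch → Ch
one _ a = a

edge : ℕ → ℕ → Ch → Ch
edge y x a = (y , x) ▷ a

-- The fundamental cycle of a chessboard complex M_{m,m+1} (rows ys, columns xs), as a determinant.
chess : List ℕ → List ℕ → Ch
chess [] (x ∷ []) = vac
chess [] _ = 𝟎
chess (y ∷ ys) xs = det (edge y) (chess ys) xs

lin-one : ∀ x → Lin (one x)
lin-one x = lin-id

lin-edge : ∀ y x → Lin (edge y x)
lin-edge y x = record { l≈ = ▷-cong _ ; l⊕ = ▷-⊕ _ ; l⊙ = ▷-⊙ _ }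

det-𝟎 : ∀ {r} → (∀ x → Lin (r x)) → ∀ xs {G : List ℕ → Ch} → (∀ l → suc (length l) ≡ length xs → G l ≈ 𝟎) → det r G xs ≈ 𝟎
det-𝟎 R [] h = ≈-refl
det-𝟎 R (x ∷ xs) h = ⊕-𝟎 (≈-trans (l≈ (R x) (h xs refl)) (lin-hom (R x) .h𝟎)) (⊙-𝟎 (det-𝟎 R xs λ l e → h (x ∷ l) (cong suc e)))

det-⊖ : ∀ {r} → (∀ x → Lin (r x)) → ∀ xs (G H : List ℕ → Ch) → det r (λ l → G l ⊕ ⊖ H l) xs ≈ det r G xs ⊕ ⊖ det r H xs
det-⊖ R [] G H = ≈-sym (⊕-inv 𝟎)
det-⊖ {r} R (x ∷ xs) G H = ≈-trans (⊕-cong (≈-trans (l⊕ (R x) _ _) (⊕-cong ≈-refl (l⊙ (R x) -1ℤ _))) (⊙-cong _ (det-⊖ R xs _ _)))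
  (mk λ φ A → lem ⟨ r x (G xs) ∣ φ ⟩ ⟨ r x (H xs) ∣ φ ⟩ ⟨ det r (G ∘ (x ∷_)) xs ∣ φ ⟩ ⟨ det r (H ∘ (x ∷_)) xs ∣ φ ⟩)
  where lem : ∀ a b c d → (a ℤ.+ -1ℤ ℤ.* b) ℤ.+ -1ℤ ℤ.* (c ℤ.+ -1ℤ ℤ.* d) ≡ (a ℤ.+ -1ℤ ℤ.* c) ℤ.+ -1ℤ ℤ.* (b ℤ.+ -1ℤ ℤ.* d)
        lem = solve-∀

det-one-▷ : ∀ e xs (G : List ℕ → Ch) → det one (λ l → e ▷ G l) xs ≈ e ▷ det one G xs
det-one-▷ e [] G = ≈-sym (▷-𝟎 e)
det-one-▷ e (x ∷ xs) G = ≈-trans (⊕-cong ≈-refl (⊙-cong _ (det-one-▷ e xs _))) (mk λ φ A → refl)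

-- Exchanging two rows, one of them consisting of ones, changes the sign of a determinant.
det-anti : ∀ y xs (G : List ℕ → Ch) → det one (det (edge y) G) xs ≈ ⊖ det (edge y) (det one G) xs
det-anti y [] G = ≈-sym (⊙-zeroʳ _)
det-anti y (x ∷ xs) G = ≈-trans (⊕-cong ≈-refl (⊙-cong _ left)) (≈-trans
  (mk λ φ A → lem ⟨ det (edge y) G xs ∣ φ ⟩ ⟨ (y , x) ▷ det one G xs ∣ φ ⟩ ⟨ det (edge y) (det one (G ∘ (x ∷_))) xs ∣ φ ⟩)
  (⊙-cong _ (⊕-cong ≈-refl (⊙-cong _ (≈-sym right)))))
  where
  left : det one (λ l → (y , x) ▷ G l ⊕ ⊖ det (edge y) (G ∘ (x ∷_)) l) xs ≈ (y , x) ▷ det one G xs ⊕ ⊖ ⊖ det (edge y) (det one (G ∘ (x ∷_))) xs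
  left = ≈-trans (det-⊖ lin-one xs _ _) (⊕-cong (det-one-▷ _ xs G) (⊙-cong _ (det-anti y xs (G ∘ (x ∷_)))))
  right : det (edge y) (λ l → G l ⊕ ⊖ det one (G ∘ (x ∷_)) l) xs ≈ det (edge y) G xs ⊕ ⊖ det (edge y) (det one (G ∘ (x ∷_))) xs
  right = det-⊖ (lin-edge y) xs _ _
  lem : ∀ g h k → g ℤ.+ -1ℤ ℤ.* (h ℤ.+ -1ℤ ℤ.* (-1ℤ ℤ.* k)) ≡ -1ℤ ℤ.* (h ℤ.+ -1ℤ ℤ.* (g ℤ.+ -1ℤ ℤ.* k))
  lem = solve-∀

∂-det : ∀ y xs (G : List ℕ → Ch) → ∂ₑ (det (edge y) G xs) ≈ det one G xs ⊕ ⊖ det (edge y) (∂ₑ ∘ G) xs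
∂-det y [] G = ≈-sym (⊕-inv 𝟎)
∂-det y (x ∷ xs) G = ≈-trans (⊕-cong (⊕-cong (⊙-idˡ _) ≈-refl) (⊙-cong _ (∂-det y xs _)))
  (mk λ φ A → lem ⟨ G xs ∣ φ ⟩ ⟨ (y , x) ▷ ∂ₑ (G xs) ∣ φ ⟩ ⟨ det one (G ∘ (x ∷_)) xs ∣ φ ⟩ ⟨ det (edge y) (∂ₑ ∘ G ∘ (x ∷_)) xs ∣ φ ⟩)
  where lem : ∀ a b c d → (a ℤ.+ -1ℤ ℤ.* b) ℤ.+ -1ℤ ℤ.* (c ℤ.+ -1ℤ ℤ.* d) ≡ (a ℤ.+ -1ℤ ℤ.* c) ℤ.+ -1ℤ ℤ.* (b ℤ.+ -1ℤ ℤ.* d)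
        lem = solve-∀

-- The column left unmatched in `chess` acts as a last row of ones, so this is a determinant with
-- two equal rows. The added row is moved down by `det-anti` until the two meet, as vac - vac.
chess-row : ∀ ys xs → det one (chess ys) xs ≈ 𝟎
chess-row [] [] = ≈-refl
chess-row [] (x ∷ []) = ⊕-inv 𝟎
chess-row [] (x ∷ x' ∷ []) = ≈-trans (⊕-cong ≈-refl (⊙-cong _ (⊕-elimʳ (⊙-zeroʳ _)))) (⊕-inv vac)
chess-row [] (x ∷ x' ∷ x'' ∷ xs) = ⊕-𝟎 ≈-refl (⊙-𝟎 (det-𝟎 lin-one (x' ∷ x'' ∷ xs) {chess [] ∘ (x ∷_)} λ { (_ ∷ _) _ → ≈-refl }))
chess-row (y ∷ ys) xs = ≈-trans (det-anti y xs (chess ys)) (⊙-𝟎 (det-𝟎 (lin-edge y) xs λ l _ → chess-row ys l))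

-- By `∂-det` the boundary replaces one row of edges at a time by a row of ones, and each resulting
-- determinant vanishes.
chess-∂ : ∀ ys xs → ∂ₑ (chess ys xs) ≈ 𝟎
chess-∂ [] [] = ≈-refl
chess-∂ [] (x ∷ []) = ≈-refl
chess-∂ [] (x ∷ x' ∷ xs) = ≈-refl
chess-∂ (y ∷ ys) xs = ≈-trans (∂-det y xs (chess ys)) (⊕-𝟎 (chess-row ys xs) (⊙-𝟎 (det-𝟎 (lin-edge y) xs λ l _ → chess-∂ ys l)))

Minor : List ℕ → ℕ → List ℕ → Set
Minor xs x l = x ∈ xs × Unique l × (∀ {v} → v ∈ l → v ∈ xs) × x ∉ l

minor-∷ : ∀ {x xs x' l} → Unique (x ∷ xs) → Minor xs x' l → Minor (x ∷ xs) x' (x ∷ l)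
minor-∷ (n ∷ u) (i , v , s , m) = there i , (All.tabulate (λ j → All.lookup n (s j)) ∷ v) ,
  (λ { (here e) → here e ; (there j) → there (s j) }) , λ { (here refl) → All.lookup n i refl ; (there j) → m j }

minor-head : ∀ {x xs} → Unique (x ∷ xs) → Minor (x ∷ xs) x xs
minor-head (n ∷ u) = here refl , u , there , λ i → All.lookup n i refl

det-In : ∀ {P y d xs} G → Unique xs → P y → (∀ {x} → x ∈ xs → P x × y ≢ x) → (∀ {x l} → Minor xs x l → In (P ∖ y ∖ x) d (G l)) → In P (suc d) (det (edge y) G xs)
det-In {xs = []} G u py px h = in𝟎
det-In {xs = x ∷ xs} G u@(_ ∷ u') py px h = in⊕ (in▷ py (proj₁ (px (here refl))) (proj₂ (px (here refl))) (h (minor-head u)))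
  (in⊙ _ (det-In (G ∘ (x ∷_)) u' py (px ∘ there) (h ∘ minor-∷ u)))

chess-In : ∀ {P} ys xs → Lab P (ys ++ xs) → In P (length ys) (chess ys xs)
chess-In [] [] l = in𝟎
chess-In [] (x ∷ []) l = invac
chess-In [] (x ∷ x' ∷ xs) l = in𝟎
chess-In {P} (y ∷ ys) xs l = let l₁ , l₂ = Lab-split (y ∷ ys) l in
  det-In (chess ys) (uniq l₂) (incl l (here refl)) (λ i → proj₁ (incl l₂ i) , λ { refl → proj₂ (incl l₂ i) (here refl) }) λ (i , u , s , n) →
    chess-In ys _ (lab! (UP.++⁺ (AllPairs.tail (uniq l₁)) u λ (j , k) → proj₂ (incl l₂ (s k)) (there j)) λ {v} j →
      [ (λ k → (incl l₁ (there k) , (λ { refl → All.lookup (AllPairs.head (uniq l₁)) k refl })) , λ { refl → proj₂ (incl l₂ i) (there k) })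
               , (λ k → (proj₁ (incl l₂ (s k)) , λ { refl → proj₂ (incl l₂ (s k)) (here refl) }) , λ { refl → n k }) ] (∈-++⁻ ys j))

det-link : ∀ {R y x₀ d xs} G → ¬ R y → Unique xs → x₀ ∉ xs → (∀ {x l} → Minor xs x l → In R d (G l)) → L y x₀ (det (edge y) G xs) ≈ 𝟎
det-link {xs = []} G ny u n h = ≈-refl
det-link {xs = x ∷ xs} G ny u@(_ ∷ u') n h = ⊕-𝟎 (link-other (n ∘ here) ny (h (minor-head u))) (⊙-𝟎 (det-link (G ∘ (x ∷_)) ny u' (n ∘ there) (h ∘ minor-∷ u)))

chess-link : ∀ y ys x xs → Unique (y ∷ ys ++ x ∷ xs) → L y x (chess (y ∷ ys) (x ∷ xs)) ≈ chess ys xs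
chess-link y ys x xs u = ≈-trans (⊕-elimʳ (⊙-𝟎 (det-link {_≢ y} (chess ys ∘ (x ∷_)) (λ n → n refl) (AllPairs.tail (uniq l₂)) (λ i → All.lookup (AllPairs.head (uniq l₂)) i refl)
    λ (_ , v , s , _) → chess-In ys _ (lab! (UP.++⁺ (AllPairs.tail (uniq l₁)) (All.tabulate (λ i → All.lookup (AllPairs.head (uniq l₂)) (s i)) ∷ v)
      λ { (j , here refl) → proj₂ (incl l₂ (here refl)) (there j) ; (j , there k) → proj₂ (incl l₂ (there (s k))) (there j) })
      λ i → off ([ ∈-++⁺ˡ , (λ { (here e) → ∈-++⁺ʳ ys (here e) ; (there k) → ∈-++⁺ʳ ys (there (s k)) }) ] (∈-++⁻ ys i))))))
  (link-same {_≢ y} (λ n → n refl) (chess-In ys xs (lab! (AllPairs.tail (UP.++⁺ {xs = y ∷ ys} (uniq l₁) (AllPairs.tail (uniq l₂)) λ (j , k) → proj₂ (incl l₂ (there k)) j))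
    λ i → off ([ ∈-++⁺ˡ , ∈-++⁺ʳ ys ∘ there ] (∈-++⁻ ys i)))))
  where
  l : Lab (_∈ y ∷ ys ++ x ∷ xs) (y ∷ ys ++ x ∷ xs)
  l = lab! u id
  l₁ = proj₁ (Lab-split (y ∷ ys) {x ∷ xs} l)
  l₂ = proj₂ (Lab-split (y ∷ ys) {x ∷ xs} l)
  off : ∀ {v} → v ∈ ys ++ x ∷ xs → v ≢ y
  off i refl = All.lookup (AllPairs.head u) i refl

-- Classes of order 5 and the standard cycle

Bounds : (ℕ → Set) → ℕ → Ch → Set
Bounds P d a = Σ Ch λ h → In P (suc d) h × ∂ₑ h ≈ a

nul-bounds : ∀ {P d a} → Nul P d a → Σ ℕ λ m → Bounds P d (pow m ⊙ a)
nul-bounds (bdy {h} i) = 0 , h , i , ≈-sym (⊙-idˡ _)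
nul-bounds (add {a} {b} s t) = let m , h , i , e = nul-bounds s ; n , k , j , f = nul-bounds t in
  m + n , pow n ⊙ h ⊕ pow m ⊙ k , in⊕ (in⊙ _ i) (in⊙ _ j) , ≈-trans (⊕-cong (⊙-cong _ e) (⊙-cong _ f))
    (mk λ φ A → trans (lem (pow m) (pow n) ⟨ a ∣ φ ⟩ ⟨ b ∣ φ ⟩) (cong (ℤ._* (⟨ a ∣ φ ⟩ ℤ.+ ⟨ b ∣ φ ⟩)) (sym (pow-+ m n))))
  where lem : ∀ p q a b → q ℤ.* (p ℤ.* a) ℤ.+ p ℤ.* (q ℤ.* b) ≡ p ℤ.* q ℤ.* (a ℤ.+ b)
        lem = solve-∀
nul-bounds (scl {a} k s) = let m , h , i , e = nul-bounds s in m , k ⊙ h , in⊙ k i , ≈-trans (⊙-cong k e) (⊙-comm k _ a)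
nul-bounds (rsp e s) = let m , h , i , f = nul-bounds s in m , h , i , ≈-trans f (⊙-cong _ e)
nul-bounds (div {a} s) = let m , h , i , e = nul-bounds s in suc m , h , i , ≈-trans e (≈-trans (⊙-comm _ (+ 6) a) (⊙-assoc (+ 6) _ a))

bounds-nul : ∀ {P d a} m → Bounds P d (pow m ⊙ a) → Nul P d a
bounds-nul m (h , i , e) = div-pow m (rsp e (bdy i))

pow-mod-5 : ∀ m → Σ ℤ λ c → pow m ≡ 1ℤ ℤ.+ + 5 ℤ.* c
pow-mod-5 zero = 0ℤ , refl
pow-mod-5 (suc m) = let c , e = pow-mod-5 m in 1ℤ ℤ.+ + 6 ℤ.* c , trans (cong (+ 6 ℤ.*_) e) (lem c)
  where lem : ∀ c → + 6 ℤ.* (1ℤ ℤ.+ + 5 ℤ.* c) ≡ 1ℤ ℤ.+ + 5 ℤ.* (1ℤ ℤ.+ + 6 ℤ.* c)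
        lem = solve-∀

record Order5 (P : ℕ → Set) (d : ℕ) (a : Ch) : Set where
  field
    cycle : Cyc P d a
    non-bounding : ¬ Bounds P d a
    bounding : Bounds P d (+ 5 ⊙ a)

-- If both 6^m a and 5 a bound, then so does a, because 6^m is 1 modulo 5.
not-nul : ∀ {P d a} → Order5 P d a → ¬ Nul P d a
not-nul {a = a} o s = let m , h , i , e = nul-bounds s ; k , j , f = Order5.bounding o ; c , eq = pow-mod-5 m in
  Order5.non-bounding o (h ⊕ (- c) ⊙ k , in⊕ i (in⊙ _ j) , ≈-trans (⊕-cong e (⊙-cong _ f))
    (mk λ φ A → trans (cong (λ p → p ℤ.* ⟨ a ∣ φ ⟩ ℤ.+ - c ℤ.* (+ 5 ℤ.* ⟨ a ∣ φ ⟩)) eq) (lem c ⟨ a ∣ φ ⟩)))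
  where lem : ∀ c x → (1ℤ ℤ.+ + 5 ℤ.* c) ℤ.* x ℤ.+ - c ℤ.* (+ 5 ℤ.* x) ≡ x
        lem = solve-∀

-- Only after multiplication by a power of 6 does 5 a bound, hence the factor in the conclusion. The
-- multiple itself does not bound, as that would make `a` null.
order5 : ∀ {P d a} → Cyc P d a → ¬ Nul P d a → Nul P d (+ 5 ⊙ a) → Σ ℕ λ m → Order5 P d (pow m ⊙ a)
order5 {a = a} (ai , ac) n s = let m , h , i , e = nul-bounds s in m , record
  { cycle = in⊙ _ ai , ⊙-𝟎 ac
  ; non-bounding = n ∘ bounds-nul m
  ; bounding = h , i , ≈-trans e (⊙-comm _ (+ 5) a) }

seq : ℕ → ℕ → List ℕ
seq k zero = []
seq k (suc n) = k ∷ seq (suc k) n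

seq-∈ : ∀ k n {v} → v ∈ seq k n → k ≤ v × v < k + n
seq-∈ k (suc n) (here refl) = ℕₚ.≤-refl , subst (k <_) (sym (ℕₚ.+-suc k n)) (s≤s (ℕₚ.m≤m+n k n))
seq-∈ k (suc n) {v} (there i) = let p , q = seq-∈ (suc k) n i in ℕₚ.≤-trans (ℕₚ.n≤1+n k) p , subst (v <_) (sym (ℕₚ.+-suc k n)) q

seq-unique : ∀ k n → Unique (seq k n)
seq-unique k zero = []
seq-unique k (suc n) = All.tabulate (λ { i refl → ℕₚ.<-irrefl refl (proj₁ (seq-∈ (suc k) n i)) }) ∷ seq-unique (suc k) n

seq-length : ∀ k n → length (seq k n) ≡ n
seq-length k zero = refl
seq-length k (suc n) = cong suc (seq-length (suc k) n)

map-pents : ∀ f vs → mapC f (pents vs) ≡ pents (map f vs)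
map-pents f (a ∷ b ∷ c ∷ d ∷ e ∷ vs) = trans (mapC-⋀ f (pent a b c d e) (pents vs)) (cong (mapC f (pent a b c d e) ⋀_) (map-pents f vs))
map-pents f [] = refl
map-pents f (_ ∷ []) = refl
map-pents f (_ ∷ _ ∷ []) = refl
map-pents f (_ ∷ _ ∷ _ ∷ []) = refl
map-pents f (_ ∷ _ ∷ _ ∷ _ ∷ []) = refl

map-lab : ∀ xs vs → map (lab (xs ++ vs)) (seq (length xs) (length vs)) ≡ vs
map-lab xs [] = refl
map-lab xs (v ∷ vs) = cong₂ _∷_ (hd xs) (trans (cong₂ (λ l k → map (lab l) (seq k (length vs))) (sym (++-assoc xs (v ∷ []) vs)) (sym (trans (Lₚ.length-++ xs) (ℕₚ.+-comm (length xs) 1)))) (map-lab (xs ++ v ∷ []) vs))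
  where
  hd : ∀ xs → lab (xs ++ v ∷ vs) (length xs) ≡ v
  hd [] = refl
  hd (x ∷ xs) = hd xs

-- Vertex 0 occurs in no edge; it is the factor [1,0].
γ₀ : ℕ → Ch
γ₀ q = tri 1 2 3 ⋀ pents (seq 4 (quin q))

γ₀-image : ∀ {P q g} → GenA P q g → Nul (_< 4 + quin q) (suc (dbl q)) (γ₀ q) → Nul P (suc (dbl q)) g
γ₀-image {P} {q} (ga {a} {b} {c} {x} {vs} l e) s =
  rsp (≡⇒≈ (trans (mapC-⋀ f (tri 1 2 3) _) (cong (tri a b c ⋀_) (trans (map-pents f (seq 4 (quin q))) (cong pents (trans (cong (map f ∘ seq 4) (sym e)) (map-lab (x ∷ a ∷ b ∷ c ∷ []) vs)))))))
    (nul-map (λ i → incl l′ (lab-∈ labels (within i))) (λ i j → lab-inj (uniq l′) (within i) (within j)) s)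
  where
  labels = x ∷ a ∷ b ∷ c ∷ vs
  f = lab labels
  l′ : Lab P labels
  l′ = Lab-swap (a ∷ b ∷ c ∷ []) (x ∷ []) l
  len : 4 + quin q ≡ length labels
  len = cong (4 ℕ.+_) (sym e)
  within : ∀ {v} → v < 4 + quin q → v < length labels
  within {v} = subst (v <_) len

γ₀-cyc : ∀ q → Cyc (_< 4 + quin q) (suc (dbl q)) (γ₀ q)
γ₀-cyc q = cyc-⋀ (λ i j → ℕₚ.<-irrefl refl (ℕₚ.<-≤-trans (bound 4 (1 ∷ 2 ∷ 3 ∷ []) refl i) (proj₁ (seq-∈ 4 _ j))))
  (λ i → ℕₚ.<-≤-trans (bound 4 (1 ∷ 2 ∷ 3 ∷ []) refl i) (ℕₚ.m≤m+n 4 _)) (λ j → proj₂ (seq-∈ 4 _ j))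
  (tri-cyc (uniqueᵇ-sound (1 ∷ 2 ∷ 3 ∷ []) refl)) (pents-cyc q (seq-unique 4 _) (seq-length 4 _))

γ₀-essential : ∀ q {z} → Order5 (_< 4 + quin q) (suc (dbl q)) z → ¬ Nul (_< 4 + quin q) (suc (dbl q)) (γ₀ q)
γ₀-essential q {z} o s = not-nul o (span-bind (upTo-< n) (λ g → span-bind (upTo-< n) (λ ()) (γ₀-image g s))
    (generated (suc (length (upTo n))) (kA q) (upTo n) ℕₚ.≤-refl (UP.upTo⁺ n) (Lₚ.length-upTo n) (Cyc-mono ∈-upTo⁺ (Order5.cycle o))))
  where n = 4 + quin q

γ₁₄-⋀-torsion : ∀ {Q e w m} → 14 ≤ m → Cyc Q e w → (∀ {v} → Q v → 14 ≤ v) → (∀ {v} → Q v → v < m) → Nul (_< m) (5 + e) (+ 5 ⊙ (γ₁₄ ⋀ w))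
γ₁₄-⋀-torsion le wc lo hi = nul-⋀ʳ (λ p q → ℕₚ.<-irrefl refl (ℕₚ.<-≤-trans p (lo q))) (λ p → ℕₚ.<-≤-trans p le) hi wc γ₁₄-torsion

⋀-assoc₃ : ∀ a b c d → ((a ⋀ b) ⋀ c) ⋀ d ≡ a ⋀ (b ⋀ (c ⋀ d))
⋀-assoc₃ a b c d = trans (⋀-assoc (a ⋀ b) c d) (⋀-assoc a b (c ⋀ d))

γ₁₄-⋀-pents : ∀ q → γ₁₄ ⋀ pents (seq 14 (quin q)) ≡ γ₀ (2 + q)
γ₁₄-⋀-pents q = ⋀-assoc₃ (tri 1 2 3) (pentL B₉) (pentL C₁₄) (pents (seq 14 (quin q)))

γ₀-torsion : ∀ q → Nul (_< 4 + quin (2 + q)) (suc (dbl (2 + q))) (+ 5 ⊙ γ₀ (2 + q))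
γ₀-torsion q = rsp (⊙-cong (+ 5) (≡⇒≈ (γ₁₄-⋀-pents q)))
  (γ₁₄-⋀-torsion (ℕₚ.m≤m+n 14 (quin q)) (pents-cyc q (seq-unique 14 _) (seq-length 14 _)) (λ i → proj₁ (seq-∈ 14 _ i)) (λ i → proj₂ (seq-∈ 14 _ i)))

γ₀-order5 : ∀ q {z} → Order5 (_< 4 + quin (2 + q)) (suc (dbl (2 + q))) z →
            Σ ℕ λ m → Order5 (_< 4 + quin (2 + q)) (suc (dbl (2 + q))) (pow m ⊙ γ₀ (2 + q))
γ₀-order5 q o = order5 (γ₀-cyc (2 + q)) (γ₀-essential (2 + q) o) (γ₀-torsion q)

-- Replacing a pentagon by a chessboard cycle

hexagon : Ch
hexagon = chess (14 ∷ 15 ∷ []) (16 ∷ 17 ∷ 18 ∷ [])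

-- All terms on the right are images of one hexagon under permutations of the five vertices. Hence,
-- with 2 inverted, the vanishing of the hexagon class carries over to the pentagon.
pent-as-hexagons : + 2 ⊙ pent 14 15 16 17 18 ≈
  ((mapC (sw 15 18) hexagon ⊕ mapC (sw 15 16) hexagon) ⊕ ⊖ mapC (sw 14 17) hexagon) ⊕ mapC (sw 14 16) (mapC (sw 15 18) hexagon)
pent-as-hexagons = compute _ _ refl

sw-fix : ∀ {P i j d a} → ¬ P i → ¬ P j → In P d a → mapC (sw i j) a ≈ a
sw-fix ni nj = mapC-id λ p → sw-o (λ { refl → ni p }) (λ { refl → nj p })

sw-middle : ∀ {P Q d e g r i j} y → In P d g → In Q e r → ¬ P i → ¬ P j → ¬ Q i → ¬ Q j →
            mapC (sw i j) (g ⋀ (y ⋀ r)) ≈ g ⋀ (mapC (sw i j) y ⋀ r)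
sw-middle {g = g} {r} {i} {j} y gi ri pi pj qi qj = ≈-trans (≡⇒≈ (trans (mapC-⋀ (sw i j) g _) (cong (mapC (sw i j) g ⋀_) (mapC-⋀ (sw i j) y r))))
  (≈-trans (⋀-congˡ _ (sw-fix pi pj gi)) (⋀-congʳ g (⋀-congʳ (mapC (sw i j) y) (sw-fix qi qj ri))))

-- Replacing one [5,2] by the fundamental cycle of M_{u+2,u+3}, which is of type [2u+5,u+2]; linking away the u edges
-- between the additional rows and columns leaves the hexagon M_{2,3}, and two pentagons are a sum of hexagons.
module Enlarge (q : ℕ) where
  n₀ = 19 + quin q
  R = pents (seq 19 (quin q))

  R-cyc : Cyc (_∈ seq 19 (quin q)) (dbl q) R
  R-cyc = pents-cyc q (seq-unique 19 _) (seq-length 19 _)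

  rows cols : ℕ → List ℕ
  rows zero = 14 ∷ 15 ∷ []
  rows (suc u) = n₀ + dbl u ∷ rows u
  cols zero = 16 ∷ 17 ∷ 18 ∷ []
  cols (suc u) = suc (n₀ + dbl u) ∷ cols u

  Z W : ℕ → Ch
  Z u = chess (rows u) (cols u)
  W u = γ₁₄ ⋀ (Z u ⋀ R)

  Vertex : ℕ → ℕ → Set
  Vertex u v = (14 ≤ v × v < 19) ⊎ (n₀ ≤ v × v < n₀ + dbl u)

  Vertex-suc : ∀ {u v} → Vertex u v → Vertex (suc u) v
  Vertex-suc (inj₁ i) = inj₁ i
  Vertex-suc {u} (inj₂ (i , j)) = inj₂ (i , ℕₚ.<-≤-trans j (ℕₚ.+-monoʳ-≤ n₀ (ℕₚ.m≤n+m (dbl u) 2)))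

  19≤n₀ : 19 ≤ n₀
  19≤n₀ = ℕₚ.m≤m+n 19 (quin q)

  Vertex-< : ∀ {u v} → Vertex u v → v < n₀ + dbl u
  Vertex-< {u} (inj₁ (_ , j)) = ℕₚ.<-≤-trans j (ℕₚ.≤-trans 19≤n₀ (ℕₚ.m≤m+n n₀ (dbl u)))
  Vertex-< (inj₂ (_ , j)) = j

  Vertex-≥ : ∀ {u v} → Vertex u v → 14 ≤ v
  Vertex-≥ (inj₁ (i , _)) = i
  Vertex-≥ (inj₂ (i , _)) = ℕₚ.≤-trans (ℕₚ.≤-trans (ℕₚ.m≤m+n 14 5) 19≤n₀) i

  Vertex-R : ∀ {u v} → Vertex u v → v ∈ seq 19 (quin q) → ⊥
  Vertex-R (inj₁ (_ , j)) i = ℕₚ.<-irrefl refl (ℕₚ.<-≤-trans j (proj₁ (seq-∈ 19 _ i)))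
  Vertex-R (inj₂ (i , _)) j = ℕₚ.<-irrefl refl (ℕₚ.<-≤-trans (proj₂ (seq-∈ 19 _ j)) i)

  new-row : ∀ u → Vertex (suc u) (n₀ + dbl u)
  new-row u = inj₂ (ℕₚ.m≤m+n n₀ (dbl u) , ℕₚ.+-monoʳ-< n₀ (ℕₚ.m<n+m (dbl u) {2} (s≤s z≤n)))

  new-col : ∀ u → Vertex (suc u) (suc (n₀ + dbl u))
  new-col u = inj₂ (ℕₚ.≤-trans (ℕₚ.m≤m+n n₀ (dbl u)) (ℕₚ.n≤1+n _) , subst (_< n₀ + dbl (suc u)) (ℕₚ.+-suc n₀ (dbl u)) (ℕₚ.+-monoʳ-< n₀ ℕₚ.≤-refl))

  five-bounds : ∀ l → allᵇ (λ v → (14 ℕ.≤ᵇ v) ∧ (v <ᵇ 19)) l ≡ true → ∀ {v} → v ∈ l → Vertex 0 v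
  five-bounds l h {v} i = let p , q = ∧-true {14 ℕ.≤ᵇ v} (all-∈ {P = λ v → (14 ℕ.≤ᵇ v) ∧ (v <ᵇ 19)} l h i) in
    inj₁ (ℕₚ.≤ᵇ⇒≤ 14 v (subst T (sym p) tt) , ℕₚ.<ᵇ⇒< v 19 (subst T (sym q) tt))

  rows-V : ∀ u {v} → v ∈ rows u → Vertex u v
  rows-V zero = five-bounds (14 ∷ 15 ∷ []) refl
  rows-V (suc u) (here refl) = new-row u
  rows-V (suc u) (there i) = Vertex-suc (rows-V u i)

  cols-V : ∀ u {v} → v ∈ cols u → Vertex u v
  cols-V zero = five-bounds (16 ∷ 17 ∷ 18 ∷ []) refl
  cols-V (suc u) (here refl) = new-col u
  cols-V (suc u) (there i) = Vertex-suc (cols-V u i)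

  rows-unique : ∀ u → Unique (rows u)
  rows-unique zero = uniqueᵇ-sound (14 ∷ 15 ∷ []) refl
  rows-unique (suc u) = All.tabulate (λ { i refl → ℕₚ.<-irrefl refl (Vertex-< (rows-V u i)) }) ∷ rows-unique u

  cols-unique : ∀ u → Unique (cols u)
  cols-unique zero = uniqueᵇ-sound (16 ∷ 17 ∷ 18 ∷ []) refl
  cols-unique (suc u) = All.tabulate (λ { i refl → ℕₚ.<-irrefl refl (ℕₚ.<-trans ℕₚ.≤-refl (Vertex-< (cols-V u i))) }) ∷ cols-unique u

  rows-cols : ∀ u {v} → v ∈ rows u → v ∈ cols u → ⊥
  rows-cols zero = disjᵇˡ-sound (14 ∷ 15 ∷ []) (16 ∷ 17 ∷ 18 ∷ []) refl
  rows-cols (suc u) (here refl) (here e) = ℕₚ.1+n≢n (sym e)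
  rows-cols (suc u) (here refl) (there j) = ℕₚ.<-irrefl refl (Vertex-< (cols-V u j))
  rows-cols (suc u) (there i) (here refl) = ℕₚ.<-irrefl refl (ℕₚ.<-trans ℕₚ.≤-refl (Vertex-< (rows-V u i)))
  rows-cols (suc u) (there i) (there j) = rows-cols u i j

  board : ∀ u → Lab (Vertex u) (rows u ++ cols u)
  board u = lab! (UP.++⁺ (rows-unique u) (cols-unique u) λ (i , j) → rows-cols u i j) λ i → [ rows-V u , cols-V u ] (∈-++⁻ (rows u) i)

  rows-length : ∀ u → length (rows u) ≡ 2 + u
  rows-length zero = refl
  rows-length (suc u) = cong suc (rows-length u)

  Z-cyc : ∀ u → Cyc (Vertex u) (2 + u) (Z u)
  Z-cyc u = subst (λ d → In (Vertex u) d (Z u)) (rows-length u) (chess-In (rows u) (cols u) (board u)) , chess-∂ (rows u) (cols u)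

  Outer : ℕ → ℕ → Set
  Outer u v = 14 ≤ v × v < n₀ + dbl u

  ZR-cyc : ∀ u → Cyc (Outer u) (2 + u + dbl q) (Z u ⋀ R)
  ZR-cyc u = cyc-⋀ (Vertex-R {u}) (λ v → Vertex-≥ {u} v , Vertex-< {u} v)
    (λ i → let p , r = seq-∈ 19 _ i in ℕₚ.≤-trans (ℕₚ.m≤m+n 14 5) p , ℕₚ.<-≤-trans r (ℕₚ.m≤m+n n₀ (dbl u))) (Z-cyc u) R-cyc

  14≤n : ∀ u → 14 ≤ n₀ + dbl u
  14≤n u = ℕₚ.≤-trans (ℕₚ.≤-trans (ℕₚ.m≤m+n 14 5) 19≤n₀) (ℕₚ.m≤m+n n₀ (dbl u))

  W-deg : ℕ → ℕ
  W-deg u = 5 + (2 + u + dbl q)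

  W-cyc : ∀ u → Cyc (_< n₀ + dbl u) (W-deg u) (W u)
  W-cyc u = cyc-⋀ {P = P₁₄} {Q = Outer u} (λ p (r , _) → ℕₚ.<-irrefl refl (ℕₚ.<-≤-trans p r)) (λ p → ℕₚ.<-≤-trans p (14≤n u)) proj₂ (γ₁₄-in , compute γ₁₄-∂ 𝟎 refl) (ZR-cyc u)
    where γ₁₄-∂ = ∂ₑ γ₁₄

  W-torsion : ∀ u → Nul (_< n₀ + dbl u) (W-deg u) (+ 5 ⊙ W u)
  W-torsion u = γ₁₄-⋀-torsion (14≤n u) (ZR-cyc u) proj₁ proj₂

  -- The sign comes from passing the five edges of `γ₁₄`. The new row and column stand first in
  -- `Z (suc u)`, so the link there is the leading minor without a further sign.
  W-link : ∀ u → L (n₀ + dbl u) (suc (n₀ + dbl u)) (W (suc u)) ≈ ⊖ W u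
  W-link u =
    L y x (γ₁₄ ⋀ (Z (suc u) ⋀ R))                                  ≈⟨ D-⋀ (lnk-flip (y , x)) (Z (suc u) ⋀ R) γ₁₄-in ⟩
    L y x γ₁₄ ⋀ (Z (suc u) ⋀ R) ⊕ ⊖ (γ₁₄ ⋀ L y x (Z (suc u) ⋀ R))  ≈⟨ ⊕-elimˡ (⋀-congˡ _ (L-out (λ i → ℕₚ.<-irrefl refl (ℕₚ.<-≤-trans i (14≤n u))) γ₁₄-in)) ⟩
    ⊖ (γ₁₄ ⋀ L y x (Z (suc u) ⋀ R))                                ≈⟨ ⊙-cong _ (⋀-congʳ γ₁₄ inner) ⟩
    ⊖ (γ₁₄ ⋀ (Z u ⋀ R)) ∎≈
    where
    y = n₀ + dbl u
    x = suc y
    inner : L y x (Z (suc u) ⋀ R) ≈ Z u ⋀ R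
    inner = ≈-trans (D-⋀ (lnk-flip (y , x)) R (Z-cyc (suc u) .isIn)) (≈-trans
      (⊕-elimʳ (⊙-𝟎 (≈-trans (⋀-congʳ (Z (suc u)) (L-out (Vertex-R {suc u} (new-row u)) (R-cyc .isIn))) (⋀-𝟎 (Z (suc u))))))
      (⋀-congˡ R (chess-link y (rows u) x (cols u) (uniq (board (suc u))))))

  -- Linking anticommutes with the boundary, so the link of a filling of a multiple of `W (suc u)`
  -- fills the same multiple of `W u`. It also removes exactly the two new vertices from the
  -- support.
  W-unlink : ∀ u → Nul (_< n₀ + dbl (suc u)) (W-deg (suc u)) (W (suc u)) → Nul (_< n₀ + dbl u) (W-deg u) (W u)
  W-unlink u s = let m , h , i , e = nul-bounds s in bounds-nul m (L y x h , In-mono smaller (In-L y x i) ,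
      ≈-trans (D-anti _ _ h) (≈-trans (⊙-cong _ (≈-trans (L-cong y x e) (⊙-cong (pow m) (W-link u)))) (sign (pow m) (W u))))
    where
    y = n₀ + dbl u
    x = suc y
    sign : ∀ k a → ⊖ (k ⊙ ⊖ a) ≈ k ⊙ a
    sign k a .at φ A = lem k ⟨ a ∣ φ ⟩
      where lem : ∀ k a → -1ℤ ℤ.* (k ℤ.* (-1ℤ ℤ.* a)) ≡ k ℤ.* a
            lem = solve-∀
    smaller : ∀ {v} → ((_< n₀ + dbl (suc u)) ∖ y ∖ x) v → v < y
    smaller {v} ((p , m) , n) = ℕₚ.≤∧≢⇒< (ℕₚ.≤-pred (ℕₚ.≤∧≢⇒< (ℕₚ.≤-pred (subst (v <_) (trans (ℕₚ.+-suc n₀ _) (cong suc (ℕₚ.+-suc n₀ _))) p)) n)) m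

  W-hexagon : ∀ u → Nul (_< n₀ + dbl u) (W-deg u) (W u) → Nul (_< n₀ + 0) (W-deg 0) (W 0)
  W-hexagon zero s = s
  W-hexagon (suc u) s = W-hexagon u (W-unlink u s)

  swapped : ∀ {i j y} → Vertex 0 i → Vertex 0 j → Nul (_< n₀ + 0) (W-deg 0) (γ₁₄ ⋀ (y ⋀ R)) → Nul (_< n₀ + 0) (W-deg 0) (γ₁₄ ⋀ (mapC (sw i j) y ⋀ R))
  swapped {i} {j} {y} vi vj s = rsp (sw-middle {P = P₁₄} {Q = _∈ seq 19 (quin q)} {g = γ₁₄} {r = R} {i} {j} y γ₁₄-in (R-cyc .isIn) (low vi) (low vj) (Vertex-R {0} vi) (Vertex-R {0} vj))
    (nul-map (sw-closed {_< n₀ + 0} (Vertex-< vi) (Vertex-< vj)) (λ _ _ → sw-inj i j) s)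
    where
    low : ∀ {v} → Vertex 0 v → v < 14 → ⊥
    low v p = ℕₚ.<-irrefl refl (ℕₚ.<-≤-trans p (Vertex-≥ {0} v))

  vertices : ∀ {v} → v ∈ 14 ∷ 15 ∷ 16 ∷ 17 ∷ 18 ∷ [] → Vertex 0 v
  vertices = five-bounds (14 ∷ 15 ∷ 16 ∷ 17 ∷ 18 ∷ []) refl

  pentagon : Nul (_< n₀ + 0) (W-deg 0) (W 0) → Nul (_< n₀ + 0) (W-deg 0) (γ₁₄ ⋀ (pent 14 15 16 17 18 ⋀ R))
  pentagon s = div-by (+ 2) (+ 3) refl (rsp (l⊙ F (+ 2) p₅) (rsp (≈-sym (l≈ F pent-as-hexagons))
      (rsp (≈-sym (expand (mapC (sw 15 18) hexagon) (mapC (sw 15 16) hexagon) (mapC (sw 14 17) hexagon) (mapC (sw 14 16) (mapC (sw 15 18) hexagon))))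
        (add (add (add (swapped v15 v18 s) (swapped v15 v16 s)) (span-neg (swapped v14 v17 s))) (swapped v14 v16 (swapped v15 v18 s))))))
    where
    p₅ = pent 14 15 16 17 18
    v14 = vertices (here refl)
    v15 = vertices (there (here refl))
    v16 = vertices (there (there (here refl)))
    v17 = vertices (there (there (there (here refl))))
    v18 = vertices (there (there (there (there (here refl)))))
    f : Ch → Ch
    f y = γ₁₄ ⋀ (y ⋀ R)
    F : Lin f
    F = lin-∘ (lin-⋀ʳ γ₁₄) (lin-⋀ˡ R)
    expand : ∀ a b c d → f (((a ⊕ b) ⊕ ⊖ c) ⊕ d) ≈ ((f a ⊕ f b) ⊕ ⊖ f c) ⊕ f d
    expand a b c d = ≈-trans (l⊕ F _ d) (⊕-cong (≈-trans (l⊕ F _ (⊖ c)) (⊕-cong (l⊕ F a b) (l⊙ F -1ℤ c))) ≈-refl)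

  γ₀-from-W : ∀ u → Nul (_< n₀ + dbl u) (W-deg u) (W u) → Nul (_< 4 + quin (3 + q)) (suc (dbl (3 + q))) (γ₀ (3 + q))
  γ₀-from-W u s = subst (λ n → Nul (_< n) (W-deg 0) (γ₀ (3 + q))) (ℕₚ.+-identityʳ n₀)
    (rsp (≡⇒≈ (γ₁₄-⋀-pents (suc q))) (pentagon (W-hexagon u s)))

  W-order5 : ∀ u {z} → Order5 (_< 4 + quin (3 + q)) (suc (dbl (3 + q))) z → Σ ℕ λ m → Order5 (_< n₀ + dbl u) (W-deg u) (pow m ⊙ W u)
  W-order5 u o = order5 (W-cyc u) (γ₀-essential (3 + q) o ∘ γ₀-from-W u) (W-torsion u)

-- Comparison with the chains of Defs

-- Pairing with this reads off the coefficient of the empty simplex.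
unit : Fn
unit [] = 1ℤ
unit (_ ∷ _) = 0ℤ

Alt-unit : Alt unit
Alt-unit .swap [] s t τ = refl
Alt-unit .swap (_ ∷ σ) s t τ = refl
Alt-unit .flip [] t τ = refl
Alt-unit .flip (_ ∷ σ) t τ = refl

if-ᵇ : ∀ {A : Set} {x y : A} b → (b ≡ true → x ≡ y) → ∀ {z} → (b ≡ false → z ≡ y) → (if b then x else z) ≡ y
if-ᵇ true p q = p refl
if-ᵇ false p q = q refl

<ᵇ-yes : ∀ {m n} → m < n → (m <ᵇ n) ≡ true
<ᵇ-yes {m} {n} p with m <ᵇ n in eq
... | true = refl
... | false = ⊥-elim (subst T eq (ℕₚ.<⇒<ᵇ p))

<ᵇ-true : ∀ m n → (m <ᵇ n) ≡ true → m < n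
<ᵇ-true m n e = ℕₚ.<ᵇ⇒< m n (subst T (sym e) tt)

<ᵇ-false : ∀ m n → (m <ᵇ n) ≡ false → ¬ m < n
<ᵇ-false m n e p = case trans (sym e) (<ᵇ-yes p) of λ ()

D-linear : ∀ k w v a → D (λ t → k ℤ.* w t ℤ.+ v t) a ≈ k ⊙ D w a ⊕ D v a
D-linear k w v 𝟎 = ≈-sym (⊕-elimˡ (⊙-zeroʳ k))
D-linear k w v vac = ≈-sym (⊕-elimˡ (⊙-zeroʳ k))
D-linear k w v (t ▷ a) = ≈-trans (⊕-cong ≈-refl (⊙-cong _ (▷-cong t (D-linear k w v a))))
  (mk λ φ A → lem k (w t) (v t) ⟨ a ∣ φ ⟩ ⟨ t ▷ D w a ∣ φ ⟩ ⟨ t ▷ D v a ∣ φ ⟩)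
  where lem : ∀ k w v x y z → (k ℤ.* w ℤ.+ v) ℤ.* x ℤ.+ -1ℤ ℤ.* (k ℤ.* y ℤ.+ z) ≡ k ℤ.* (w ℤ.* x ℤ.+ -1ℤ ℤ.* y) ℤ.+ (v ℤ.* x ℤ.+ -1ℤ ℤ.* z)
        lem = solve-∀
D-linear k w v (a ⊕ b) = ≈-trans (⊕-cong (D-linear k w v a) (D-linear k w v b)) (≈-trans (⊕-inter _ _ _ _) (⊕-cong (≈-sym (⊙-distˡ k _ _)) ≈-refl))
D-linear k w v (m ⊙ a) = ≈-trans (⊙-cong m (D-linear k w v a)) (≈-trans (⊙-distˡ m _ _) (⊕-cong (⊙-comm m k _) ≈-refl))

in-empty : ∀ {P d a} → (∀ {v} → ¬ P v) → In P (suc d) a → a ≈ 𝟎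
in-empty n in𝟎 = ≈-refl
in-empty n (in▷ px _ _ _) = contradiction px n
in-empty n (in⊕ i j) = ⊕-𝟎 (in-empty n i) (in-empty n j)
in-empty n (in⊙ k i) = ⊙-𝟎 (in-empty n i)
in-empty n (in≈ e i) = ≈-trans (≈-sym e) (in-empty n i)

-- With all links zero, `a` agrees with `K p a` for each vertex `p`. Discarding the vertices one
-- after another leaves a chain of positive degree on no vertices.
links-detect : ∀ {U d a} → Unique U → In (_∈ U) (suc d) a → (∀ p s → L p s a ≈ 𝟎) → a ≈ 𝟎
links-detect {U} {d} {a} u i h = in-empty (λ (v , n) → n v) (strip U id)
  where
  keep : ∀ p → a ≈ K p a
  keep p = ≈-trans (split p u id i) (⊕-elimˡ (∑-zero U λ {s} _ → ▷-elim (h p s)))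
  drop′ : ∀ {P} p → In P (suc d) a → In (P ∖ p) (suc d) a
  drop′ p j = in≈ (≈-sym (keep p)) (In-K p j)
  strip : ∀ l → (∀ {v} → v ∈ l → v ∈ U) → In ((_∈ U) − l) (suc d) a
  strip [] s = In-mono (λ v → v , λ ()) i
  strip (p ∷ l) s = In-mono (λ ((v , n) , m) → v , λ { (here e) → m e ; (there k) → n k }) (drop′ p (strip l (s ∘ there)))

sum-zero : ∀ {A : Set} (l : List A) (f : A → ℤ) → (∀ {x} → x ∈ l → f x ≡ 0ℤ) → sumℤ (map f l) ≡ 0ℤ
sum-zero [] f h = refl
sum-zero (x ∷ l) f h = cong₂ ℤ._+_ (h (here refl)) (sum-zero l f (h ∘ there))

sum-delta : ∀ {A : Set} {l : List A} {y} (f : A → ℤ) → Unique l → y ∈ l → (∀ {x} → x ∈ l → x ≢ y → f x ≡ 0ℤ) → sumℤ (map f l) ≡ f y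
sum-delta {l = x ∷ l} f (n ∷ u) (here refl) h = trans (cong (λ ○ → f x ℤ.+ ○) (sum-zero l f λ i → h (there i) λ { refl → All.lookup n i refl })) (ℤₚ.+-identityʳ _)
sum-delta {l = x ∷ l} f (n ∷ u) (there y∈) h = trans (cong₂ ℤ._+_ (h (here refl) (All.lookup n y∈)) (sum-delta f u y∈ (h ∘ there))) (ℤₚ.+-identityˡ _)

eqᵇ-yes : ∀ {k} (x : Fin k) → eqᵇ x x ≡ true
eqᵇ-yes x = Dec.dec-true (x Fₚ.≟ x) refl

eqᵇ-no : ∀ {k} {x y : Fin k} → x ≢ y → eqᵇ x y ≡ false
eqᵇ-no {x = x} {y} = Dec.dec-false (x Fₚ.≟ y)

module Eval (n : ℕ) where

  low : Edge n → ℕ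
  low e = toℕ (proj₁ e)

  high : Edge n → ℕ
  high e = toℕ (proj₂ e)

  Ascending : E → Set
  Ascending (x , y) = x < y

  emb : Edge n → E
  emb e = low e , high e

  Λ : Edge n → Ch → Ch
  Λ e = L (low e) (high e)

  V : ℕ → Set
  V = _< n

  -- The coefficient at a simplex as an iterated contraction, first edge first. It makes sense for
  -- unsorted lists too, with the corresponding sign, and this accounts for the signs in `∂`.
  eval : Ch → Chain n
  eval a [] = ⟨ a ∣ unit ⟩
  eval a (e ∷ σ) = eval (Λ e a) σ

  eval-cong : ∀ {a b} → a ≈ b → ∀ σ → eval a σ ≡ eval b σ
  eval-cong p [] = p .at unit Alt-unit
  eval-cong p (e ∷ σ) = eval-cong (L-cong _ _ p) σ

  eval-𝟎 : ∀ σ → eval 𝟎 σ ≡ 0ℤ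
  eval-𝟎 [] = refl
  eval-𝟎 (e ∷ σ) = eval-𝟎 σ

  eval-⊕ : ∀ a b σ → eval (a ⊕ b) σ ≡ eval a σ ℤ.+ eval b σ
  eval-⊕ a b [] = refl
  eval-⊕ a b (e ∷ σ) = eval-⊕ (Λ e a) (Λ e b) σ

  eval-⊙ : ∀ k a σ → eval (k ⊙ a) σ ≡ k ℤ.* eval a σ
  eval-⊙ k a [] = refl
  eval-⊙ k a (e ∷ σ) = eval-⊙ k (Λ e a) σ

  eval-≈𝟎 : ∀ {a} → a ≈ 𝟎 → ∀ σ → eval a σ ≡ 0ℤ
  eval-≈𝟎 p σ = trans (eval-cong p σ) (eval-𝟎 σ)

  eval-swap : ∀ a e f σ → eval a (e ∷ f ∷ σ) ≡ - eval a (f ∷ e ∷ σ)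
  eval-swap a e f σ = trans (eval-cong (D-anti _ _ a) σ) (trans (eval-⊙ -1ℤ (Λ e (Λ f a)) σ) (ℤₚ.-1*i≡-i _))

  eval-killed : ∀ {e a} σ → e ∈ σ → Λ e a ≈ 𝟎 → eval a σ ≡ 0ℤ
  eval-killed (e ∷ σ) (here refl) h = eval-≈𝟎 h σ
  eval-killed {a = a} (f ∷ σ) (there i) h = eval-killed σ i (≈-trans (D-anti _ _ a) (⊙-𝟎 (L-cong _ _ h)))

  eval-out : ∀ {P d a e} σ → In P d a → e ∈ σ → ¬ P (low e) ⊎ ¬ P (high e) → eval a σ ≡ 0ℤ
  eval-out σ i e∈ h = eval-killed σ e∈ ([ (λ m → L-out m i) , (λ m → L-outʳ m i) ] h)

  Sorted : List (Edge n) → Set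
  Sorted = AllPairs (λ e f → key e < key f)

  key-mono : ∀ {e f : Edge n} → low e < low f → key e < key f
  key-mono {a , b} {c , d} p = begin-strict
    toℕ a * n + toℕ b  <⟨ ℕₚ.+-monoʳ-< (toℕ a * n) (Fₚ.toℕ<n b) ⟩
    toℕ a * n + n      ≡⟨ ℕₚ.+-comm (toℕ a * n) n ⟩
    suc (toℕ a) * n      ≤⟨ ℕₚ.*-monoˡ-≤ n p ⟩
    toℕ c * n            ≤⟨ ℕₚ.m≤m+n _ _ ⟩
    toℕ c * n + toℕ d  ∎
    where open ℕₚ.≤-Reasoning

  key-inj : ∀ {e f : Edge n} → key e ≡ key f → e ≡ f
  key-inj {a , b} {c , d} q with ℕₚ.<-cmp (toℕ a) (toℕ c)
  ... | tri< p _ _ = contradiction q (ℕₚ.<⇒≢ (key-mono {a , b} {c , d} p))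
  ... | tri> _ _ p = contradiction (sym q) (ℕₚ.<⇒≢ (key-mono {c , d} {a , b} p))
  ... | tri≈ _ p _ with Fₚ.toℕ-injective p
  ...   | refl = cong (a ,_) (Fₚ.toℕ-injective (ℕₚ.+-cancelˡ-≡ (toℕ a * n) _ _ q))

  pos-least : ∀ (e : Edge n) (σ : List (Edge n)) → All (λ f → key e < key f) σ → pos e σ ≡ 0
  pos-least e [] h = refl
  pos-least e (x ∷ σ) (p ∷ h) = if-ᵇ {x = suc (pos e σ)} {y = 0} (key x <ᵇ key e) (λ q → ⊥-elim (ℕₚ.<-asym p (<ᵇ-true (key x) (key e) q))) λ _ → pos-least e σ h

  eval-ins : ∀ a e σ → Sorted σ → All (λ f → e ≢ f) σ → eval a (e ∷ σ) ≡ sgn (pos e σ) ℤ.* eval a (ins e σ)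
  eval-ins a e [] s h = sym (ℤₚ.*-identityˡ _)
  eval-ins a e (x ∷ σ) (p ∷ s) (m ∷ h) with key e <ᵇ key x in eq
  ... | true = sym (trans (cong (λ k → sgn k ℤ.* eval a (e ∷ x ∷ σ)) least) (ℤₚ.*-identityˡ (eval a (e ∷ x ∷ σ))))
    where
    lt = <ᵇ-true (key e) (key x) eq
    least : pos e (x ∷ σ) ≡ 0
    least = pos-least e (x ∷ σ) (lt ∷ All.map (λ {f} → ℕₚ.<-trans {key e} {key x} {key f} lt) p)
  ... | false = trans (eval-swap a e x σ) (trans (cong -_ (eval-ins (Λ x a) e σ s h)) (trans (ℤₚ.neg-distribˡ-* (sgn (pos e σ)) (eval (Λ x a) (ins e σ)))
      (cong (λ k → sgn k ℤ.* eval (Λ x a) (ins e σ)) (sym later))))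
    where
    e≮x = <ᵇ-false (key e) (key x) eq
    later : pos e (x ∷ σ) ≡ suc (pos e σ)
    later = if-ᵇ {x = suc (pos e σ)} {y = suc (pos e σ)} (key x <ᵇ key e) (λ _ → refl) {pos e σ} λ q → contradiction (key-inj {e} {x} (ℕₚ.≤-antisym (ℕₚ.≮⇒≥ (<ᵇ-false (key x) (key e) q)) (ℕₚ.≮⇒≥ e≮x))) m

  record Matching (m : ℕ) (σ : List (Edge n)) : Set where
    field
      len : length σ ≡ m
      oriented : All (λ e → low e < high e) σ
      sorted : Sorted σ
      disjoint : AllPairs Disj σ
  open Matching

  matching⁺ : ∀ {m σ} → IsMatching n m σ → Matching m σ
  matching⁺ (l , o , s , d) = record { len = l ; oriented = o ; sorted = Linkedₚ.Linked⇒AllPairs ℕₚ.<-trans s ; disjoint = d }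

  matching⁻ : ∀ {m σ} → Matching m σ → IsMatching n m σ
  matching⁻ M = len M , oriented M , Linkedₚ.AllPairs⇒Linked (sorted M) , disjoint M

  matching-tail : ∀ {m e σ} → Matching (suc m) (e ∷ σ) → Matching m σ
  matching-tail M = record { len = ℕₚ.suc-injective (len M) ; oriented = All.tail (oriented M) ; sorted = AllPairs.tail (sorted M) ; disjoint = AllPairs.tail (disjoint M) }

  Disj-sym : ∀ {e f : Edge n} → Disj e f → Disj f e
  Disj-sym (p , q , r , s) = ≢-sym p , ≢-sym r , ≢-sym q , ≢-sym s

  Disj-≢ : ∀ {e f : Edge n} → Disj e f → e ≢ f
  Disj-≢ (p , _) refl = p refl

  All-ins : ∀ {Q : Edge n → Set} {e} σ → Q e → All Q σ → All Q (ins e σ)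
  All-ins [] q h = q ∷ []
  All-ins {e = e} (x ∷ σ) q (p ∷ h) with key e <ᵇ key x
  ... | true = q ∷ p ∷ h
  ... | false = p ∷ All-ins σ q h

  ins-length : ∀ e (σ : List (Edge n)) → length (ins e σ) ≡ suc (length σ)
  ins-length e [] = refl
  ins-length e (x ∷ σ) with key e <ᵇ key x
  ... | true = refl
  ... | false = cong suc (ins-length e σ)

  ins-disjoint : ∀ {e} σ → All (Disj e) σ → AllPairs Disj σ → AllPairs Disj (ins e σ)
  ins-disjoint [] h d = [] ∷ []
  ins-disjoint {e} (x ∷ σ) (p ∷ h) (q ∷ d) with key e <ᵇ key x
  ... | true = (p ∷ h) ∷ q ∷ d
  ... | false = All-ins σ (Disj-sym {e} {x} p) q ∷ ins-disjoint σ h d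

  ins-sorted : ∀ {e} σ → All (Disj e) σ → Sorted σ → Sorted (ins e σ)
  ins-sorted [] h s = [] ∷ []
  ins-sorted {e} (x ∷ σ) (p ∷ h) (q ∷ s) with key e <ᵇ key x in eq
  ... | true = (lt ∷ All.map (λ {f} → ℕₚ.<-trans {key e} {key x} {key f} lt) q) ∷ q ∷ s
    where lt = <ᵇ-true (key e) (key x) eq
  ... | false = All-ins σ (ℕₚ.≤∧≢⇒< (ℕₚ.≮⇒≥ (<ᵇ-false (key e) (key x) eq)) λ k → Disj-≢ {e} {x} p (key-inj {e} {x} (sym k))) q ∷ ins-sorted σ h s

  matching-ins : ∀ {m e σ} → low e < high e → All (Disj e) σ → Matching m σ → Matching (suc m) (ins e σ)
  matching-ins {e = e} {σ} o h M = record { len = trans (ins-length e σ) (cong suc (len M)) ; oriented = All-ins σ o (oriented M)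
    ; sorted = ins-sorted σ h (sorted M) ; disjoint = ins-disjoint σ h (disjoint M) }

  eval-matching : ∀ {m a e σ} → All (Disj e) σ → Matching m σ → eval a (e ∷ σ) ≡ sgn (pos e σ) ℤ.* eval a (ins e σ)
  eval-matching {a = a} {e} {σ} h M = eval-ins a e σ (sorted M) (All.map (λ {f} → Disj-≢ {e} {f}) h)

  data Meets (e : Edge n) (σ : List (Edge n)) : Set where
    disj : All (Disj e) σ → allᵇ (disjᵇ e) σ ≡ true → Meets e σ
    meet : ∀ {f} → f ∈ σ → (low e ≡ low f ⊎ low e ≡ high f) ⊎ (high e ≡ low f ⊎ high e ≡ high f) → allᵇ (disjᵇ e) σ ≡ false → Meets e σ

  meets : ∀ e σ → Meets e σ
  meets e [] = disj [] refl
  meets e@(a , b) (f@(c , d) ∷ σ) with a Fₚ.≟ c | a Fₚ.≟ d | b Fₚ.≟ c | b Fₚ.≟ d | meets e σ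
  ... | yes refl | _ | _ | _ | _ = meet (here refl) (inj₁ (inj₁ refl)) lem
    where lem : allᵇ (disjᵇ e) (f ∷ σ) ≡ false
          lem rewrite eqᵇ-yes a = refl
  ... | no p | yes refl | _ | _ | _ = meet (here refl) (inj₁ (inj₂ refl)) lem
    where lem : allᵇ (disjᵇ e) (f ∷ σ) ≡ false
          lem rewrite eqᵇ-no p | eqᵇ-yes a = refl
  ... | no p | no q | yes refl | _ | _ = meet (here refl) (inj₂ (inj₁ refl)) lem
    where lem : allᵇ (disjᵇ e) (f ∷ σ) ≡ false
          lem rewrite eqᵇ-no p | eqᵇ-no q | eqᵇ-yes b = refl
  ... | no p | no q | no r | yes refl | _ = meet (here refl) (inj₂ (inj₂ refl)) lem
    where lem : allᵇ (disjᵇ e) (f ∷ σ) ≡ false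
          lem rewrite eqᵇ-no p | eqᵇ-no q | eqᵇ-no r | eqᵇ-yes b = refl
  ... | no p | no q | no r | no s | disj h k = disj ((p , q , r , s) ∷ h) lem
    where lem : allᵇ (disjᵇ e) (f ∷ σ) ≡ true
          lem rewrite eqᵇ-no p | eqᵇ-no q | eqᵇ-no r | eqᵇ-no s = k
  ... | no p | no q | no r | no s | meet i m k = meet (there i) m lem
    where lem : allᵇ (disjᵇ e) (f ∷ σ) ≡ false
          lem rewrite eqᵇ-no p | eqᵇ-no q | eqᵇ-no r | eqᵇ-no s = k

  eval-meet : ∀ {P d a e f} σ → In P (suc d) a → f ∈ σ → (low e ≡ low f ⊎ low e ≡ high f) ⊎ (high e ≡ low f ⊎ high e ≡ high f) → eval a (e ∷ σ) ≡ 0ℤ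
  eval-meet {P} {e = e} {f} σ i f∈ m = eval-out σ (In-L (low e) (high e) i) f∈ (touch {P} {f} m)
    where
    touch : ∀ {P f} → (low e ≡ low f ⊎ low e ≡ high f) ⊎ (high e ≡ low f ⊎ high e ≡ high f) → ¬ (P ∖ low e ∖ high e) (low f) ⊎ ¬ (P ∖ low e ∖ high e) (high f)
    touch (inj₁ (inj₁ q)) = inj₁ λ ((_ , n) , _) → n (sym q)
    touch (inj₁ (inj₂ q)) = inj₂ λ ((_ , n) , _) → n (sym q)
    touch (inj₂ (inj₁ q)) = inj₁ λ (_ , n) → n (sym q)
    touch (inj₂ (inj₂ q)) = inj₂ λ (_ , n) → n (sym q)

  -- Over all edges this sum of indicators is 1 on each edge of the complete graph. It turns the
  -- formal boundary into the sum of links over single edges that the definition of `∂` uses.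
  edge-weight : List (Edge n) → E → ℤ
  edge-weight [] t = 0ℤ
  edge-weight (e ∷ l) t = (if low e <ᵇ high e then 1ℤ else 0ℤ) ℤ.* lnk (emb e) t ℤ.+ edge-weight l t

  edge-weight-sum : ∀ l t → edge-weight l t ≡ sumℤ (map (λ e → (if low e <ᵇ high e then 1ℤ else 0ℤ) ℤ.* lnk (emb e) t) l)
  edge-weight-sum [] t = refl
  edge-weight-sum (e ∷ l) t = cong (λ ○ → (if low e <ᵇ high e then 1ℤ else 0ℤ) ℤ.* lnk (emb e) t ℤ.+ ○) (edge-weight-sum l t)

  edge-weight-flip : ∀ l → FlipInv (edge-weight l)
  edge-weight-flip [] t = refl
  edge-weight-flip (e ∷ l) t = cong₂ ℤ._+_ (cong ((if low e <ᵇ high e then 1ℤ else 0ℤ) ℤ.*_) (lnk-flip (emb e) t)) (edge-weight-flip l t)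

  allEdges-unique : Unique (allEdges n)
  allEdges-unique = UP.cartesianProduct⁺ (UP.allFin⁺ n) (UP.allFin⁺ n)

  allEdges-∈ : ∀ e → e ∈ allEdges n
  allEdges-∈ (a , b) = ∈-cartesianProduct⁺ (∈-allFin a) (∈-allFin b)

  oriented-edge : ∀ {x y} → x < n → y < n → Edge n
  oriented-edge p q = Fin.fromℕ< p , Fin.fromℕ< q

  emb-oriented : ∀ {x y} (p : x < n) (q : y < n) → emb (oriented-edge p q) ≡ (x , y)
  emb-oriented p q = cong₂ _,_ (Fₚ.toℕ-fromℕ< p) (Fₚ.toℕ-fromℕ< q)

  emb-inj : ∀ {e f} → emb e ≡ emb f → e ≡ f
  emb-inj q = cong₂ _,_ (Fₚ.toℕ-injective (cong proj₁ q)) (Fₚ.toℕ-injective (cong proj₂ q))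

  edge-weight-ordered : ∀ {x y} → x < n → y < n → x < y → edge-weight (allEdges n) (x , y) ≡ 1ℤ
  edge-weight-ordered {x} {y} x< y< p = trans (edge-weight-sum (allEdges n) (x , y)) (trans (sum-delta _ allEdges-unique (allEdges-∈ e₀) off) on)
    where
    e₀ = oriented-edge x< y<
    eq₀ = emb-oriented x< y<
    on : (if low e₀ <ᵇ high e₀ then 1ℤ else 0ℤ) ℤ.* lnk (emb e₀) (x , y) ≡ 1ℤ
    on = cong₂ ℤ._*_ (cong (λ b → if b then 1ℤ else 0ℤ) (<ᵇ-yes (subst Ascending (sym eq₀) p))) (lnk-yes {emb e₀} {x , y} (inj₁ (cong proj₁ eq₀ , cong proj₂ eq₀)))
    off : ∀ {e} → e ∈ allEdges n → e ≢ e₀ → (if low e <ᵇ high e then 1ℤ else 0ℤ) ℤ.* lnk (emb e) (x , y) ≡ 0ℤ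
    off {e} _ m with low e <ᵇ high e in eq
    ... | false = refl
    ... | true = trans (ℤₚ.*-identityˡ _) (lnk-no {emb e} {x , y} λ
          { (inj₁ (q , r)) → m (emb-inj (trans (cong₂ _,_ q r) (sym eq₀)))
          ; (inj₂ (q , r)) → ℕₚ.<-asym p (subst Ascending (cong₂ _,_ q r) (<ᵇ-true (low e) (high e) eq)) })

  edge-weight-one : ∀ {x y} → x < n → y < n → x ≢ y → edge-weight (allEdges n) (x , y) ≡ 1ℤ
  edge-weight-one {x} {y} x< y< x≢y with ℕₚ.<-cmp x y
  ... | tri≈ _ q _ = contradiction q x≢y
  ... | tri> _ _ p = trans (edge-weight-flip (allEdges n) (x , y)) (edge-weight-ordered y< x< p)
  ... | tri< p _ _ = edge-weight-ordered x< y< p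

  eval-weight : ∀ l a σ → eval (D (edge-weight l) a) σ ≡ sumℤ (map (λ e → (if low e <ᵇ high e then 1ℤ else 0ℤ) ℤ.* eval (Λ e a) σ) l)
  eval-weight [] a σ = eval-≈𝟎 (D-0 a) σ
  eval-weight (e ∷ l) a σ = trans (eval-cong (D-linear w (lnk (emb e)) (edge-weight l) a) σ) (trans (eval-⊕ (w ⊙ Λ e a) (D (edge-weight l) a) σ) (cong₂ ℤ._+_ (eval-⊙ w (Λ e a) σ) (eval-weight l a σ)))
    where w = if low e <ᵇ high e then 1ℤ else 0ℤ

  -- The comparison is termwise. For an edge disjoint from `σ` the two terms differ by sorting it
  -- in; an edge that meets `σ` is skipped by `∂`, and its link has no term at `σ`.
  eval-∂ : ∀ {m a σ} → In V (suc m) a → Matching m σ → ∂ (eval a) σ ≡ eval (∂ₑ a) σ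
  eval-∂ {m} {a} {σ} i M = trans (cong sumℤ (map-cong term (allEdges n))) (trans (sym (eval-weight (allEdges n) a σ))
    (sym (eval-cong (D-agree (λ _ → refl) (edge-weight-flip (allEdges n)) (λ p q r → sym (edge-weight-one p q r)) i) σ)))
    where
    term : ∀ e → (if addable e σ then sgn (pos e σ) ℤ.* eval a (ins e σ) else 0ℤ) ≡ (if low e <ᵇ high e then 1ℤ else 0ℤ) ℤ.* eval (Λ e a) σ
    term e with low e <ᵇ high e
    ... | false = refl
    ... | true with meets e σ
    ...   | disj h k rewrite k = trans (sym (eval-matching {a = a} h M)) (sym (ℤₚ.*-identityˡ _))
    ...   | meet f∈ q k rewrite k = sym (trans (ℤₚ.*-identityˡ (eval (Λ e a) σ)) (eval-meet {e = e} σ i f∈ q))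

  -- The coefficients of a link are, up to sign, coefficients of the chain itself. By induction all
  -- links vanish, and `links-detect` applies.
  detect : ∀ m {a} → In V m a → (∀ {σ} → Matching m σ → eval a σ ≡ 0ℤ) → a ≈ 𝟎
  detect zero i h = let k , e = scalar i in ≈-trans e (≈-trans (≡⇒≈ (cong (_⊙ vac)
    (trans (sym (trans (e .at unit Alt-unit) (ℤₚ.*-identityʳ k))) (h {[]} record { len = refl ; oriented = [] ; sorted = [] ; disjoint = [] })))) (⊙-zeroˡ vac))
  detect (suc m) {a} i h = links-detect (UP.upTo⁺ n) (In-mono ∈-upTo⁺ i) link
    where
    Linkless : E → Set
    Linkless (x , y) = L x y a ≈ 𝟎
    forward : ∀ {p s} → p < s → L p s a ≈ 𝟎
    forward {p} {s} p<s with s ℕ.<? n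
    ... | no ns = L-outʳ ns i
    ... | yes s< = subst Linkless eq (detect m (In-mono (proj₁ ∘ proj₁) (In-L (low e) (high e) i)) zero!)
      where
      p< = ℕₚ.<-trans p<s s<
      e = oriented-edge p< s<
      eq = emb-oriented p< s<
      zero! : ∀ {σ} → Matching m σ → eval a (e ∷ σ) ≡ 0ℤ
      zero! {σ} M with meets e σ
      ... | disj d _ = trans (eval-matching {a = a} d M) (trans (cong (sgn (pos e σ) ℤ.*_) (h (matching-ins (subst Ascending (sym eq) p<s) d M))) (ℤₚ.*-zeroʳ (sgn (pos e σ))))
      ... | meet f∈ q _ = eval-meet {e = e} σ i f∈ q
    link : ∀ p s → L p s a ≈ 𝟎
    link p s with ℕₚ.<-cmp p s
    ... | tri< p<s _ _ = forward p<s
    ... | tri≈ _ refl _ = L-loop i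
    ... | tri> _ _ s<p = ≈-trans (L-sym p s i) (forward s<p)

  simp : List (Edge n) → Ch
  simp [] = vac
  simp (e ∷ σ) = emb e ▷ simp σ

  simp-In : ∀ {P : ℕ → Set} {σ} → All (λ e → P (low e) × P (high e)) σ → All (λ e → low e < high e) σ → AllPairs Disj σ → In P (length σ) (simp σ)
  simp-In [] [] [] = invac
  simp-In ((p , q) ∷ h) (o ∷ os) (d ∷ ds) = in▷ p q (ℕₚ.<⇒≢ o) (simp-In (All.zipWith (λ { ((p , q) , (a , b , c , e)) →
      ((p , (a ∘ sym ∘ Fₚ.toℕ-injective)) , (c ∘ sym ∘ Fₚ.toℕ-injective)) , ((q , (b ∘ sym ∘ Fₚ.toℕ-injective)) , (e ∘ sym ∘ Fₚ.toℕ-injective)) }) (h , d)) os ds)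

  simp-V : ∀ {m σ} → Matching m σ → In V m (simp σ)
  simp-V {σ = σ} M = subst (λ k → In V k (simp σ)) (len M) (simp-In (All.universal (λ e → Fₚ.toℕ<n (proj₁ e) , Fₚ.toℕ<n (proj₂ e)) σ) (oriented M) (disjoint M))

  Same-oriented : ∀ {e f : Edge n} → low e < high e → low f < high f → Same (emb e) (emb f) → e ≡ f
  Same-oriented o p (inj₁ (q , r)) = emb-inj (cong₂ _,_ q r)
  Same-oriented o p (inj₂ (q , r)) = ⊥-elim (ℕₚ.<-asym p (subst Ascending (cong₂ _,_ q r) o))

  Λ-simp-miss : ∀ {e} σ → low e < high e → All (λ f → low f < high f) σ → All (e ≢_) σ → Λ e (simp σ) ≈ 𝟎
  Λ-simp-miss [] o os ms = ≈-refl
  Λ-simp-miss (f ∷ σ) o (p ∷ os) (m ∷ ms) = ≈-trans (L-miss (emb f) (simp σ) (m ∘ Same-oriented o p)) (⊖▷-elim (Λ-simp-miss σ o os ms))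

  eval-▷-miss : ∀ {e} b σ → low e < high e → All (λ f → low f < high f) σ → All (e ≢_) σ → eval (emb e ▷ b) σ ≡ 0ℤ
  eval-▷-miss {e} b [] o os ms = only-nonempty b
    where
    only-nonempty : ∀ b → ⟨ b ∣ unit ∘ (emb e ∷_) ⟩ ≡ 0ℤ
    only-nonempty b = trans (pair-ext b {ψ = λ _ → 0ℤ ℤ.* 0ℤ} λ _ → refl) (trans (pair-scal b 0ℤ {λ _ → 0ℤ}) (ℤₚ.*-zeroˡ ⟨ b ∣ (λ _ → 0ℤ) ⟩))
  eval-▷-miss {e} b (f ∷ σ) o (p ∷ os) (m ∷ ms) = trans (eval-cong (L-miss (emb e) b λ s → m (sym (Same-oriented p o s))) σ)
    (trans (eval-⊙ -1ℤ (emb e ▷ Λ f b) σ) (trans (cong (-1ℤ ℤ.*_) (eval-▷-miss (Λ f b) σ o os ms)) refl))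

  tail-≢ : ∀ {e f : Edge n} {σ} → key e ≡ key f → All (λ g → key f < key g) σ → All (e ≢_) σ
  tail-≢ q = All.map λ { p refl → ℕₚ.<-irrefl (sym q) p }

  eval-simp-hit : ∀ {m e σ} τ → Matching (suc m) (e ∷ σ) → eval (simp (e ∷ σ)) (e ∷ τ) ≡ eval (simp σ) τ
  eval-simp-hit {e = e} {σ} τ M = eval-cong (≈-trans (L-hit (emb e) (simp σ) (inj₁ (refl , refl)))
    (⊕-elimʳ (⊖▷-elim (Λ-simp-miss σ (All.head (oriented M)) (All.tail (oriented M)) (tail-≢ {e} {e} refl (AllPairs.head (sorted M))))))) τ

  eval-simp-same : ∀ {m} τ → Matching m τ → eval (simp τ) τ ≡ 1ℤ
  eval-simp-same [] M = refl
  eval-simp-same (e ∷ τ) M with trans (sym (len M)) refl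
  ... | refl = trans (eval-simp-hit τ M) (eval-simp-same τ (matching-tail M))

  eval-simp-other : ∀ {m k} σ τ → Matching m σ → Matching k τ → σ ≢ τ → eval (simp σ) τ ≡ 0ℤ
  eval-simp-other [] [] M N ne = contradiction refl ne
  eval-simp-other [] (e ∷ τ) M N ne = eval-𝟎 τ
  eval-simp-other (e ∷ σ) [] M N ne = eval-▷-miss (simp σ) [] (All.head (oriented M)) [] []
  eval-simp-other (e ∷ σ) (f ∷ τ) M N ne with trans (sym (len M)) refl | trans (sym (len N)) refl | ℕₚ.<-cmp (key e) (key f)
  ... | refl | refl | tri< p _ _ = eval-▷-miss (simp σ) (f ∷ τ) (All.head (oriented M)) (oriented N)
        ((λ { refl → ℕₚ.<-irrefl refl p }) ∷ All.map (λ { q refl → ℕₚ.<-asym p q }) (AllPairs.head (sorted N)))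
  ... | refl | refl | tri> _ _ p = eval-≈𝟎 (Λ-simp-miss (e ∷ σ) (All.head (oriented N)) (oriented M)
        ((λ { refl → ℕₚ.<-irrefl refl p }) ∷ All.map (λ { q refl → ℕₚ.<-asym p q }) (AllPairs.head (sorted M)))) τ
  ... | refl | refl | tri≈ _ q _ with key-inj {e} {f} q
  ...   | refl = trans (eval-simp-hit τ M) (eval-simp-other σ τ (matching-tail M) (matching-tail N) (ne ∘ cong (e ∷_)))

  tuples : ℕ → List (List (Edge n))
  tuples zero = [] ∷ []
  tuples (suc m) = Data.List.cartesianProductWith _∷_ (allEdges n) (tuples m)

  tuples-∈ : ∀ m {σ} → length σ ≡ m → σ ∈ tuples m
  tuples-∈ zero {[]} _ = here refl
  tuples-∈ (suc m) {e ∷ σ} q = ∈-cartesianProductWith⁺ _∷_ (allEdges-∈ e) (tuples-∈ m (ℕₚ.suc-injective q))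

  tuples-unique : ∀ m → Unique (tuples m)
  tuples-unique zero = [] ∷ []
  tuples-unique (suc m) = UP.cartesianProductWith⁺ _∷_ Lₚ.∷-injective allEdges-unique (tuples-unique m)

  matching? : ∀ m σ → Dec (IsMatching n m σ)
  matching? m σ = (length σ ℕ.≟ m) ×-dec All.all? (λ e → low e ℕ.<? high e) σ ×-dec Linked.linked? (λ e f → key e ℕ.<? key f) σ ×-dec
    AllPairs.allPairs? (λ (a , b) (c , d) → ¬? (a Fₚ.≟ c) ×-dec ¬? (a Fₚ.≟ d) ×-dec ¬? (b Fₚ.≟ c) ×-dec ¬? (b Fₚ.≟ d)) σ

  matchings : ℕ → List (List (Edge n))
  matchings m = filter (matching? m) (tuples m)

  formal : ℕ → Chain n → Ch
  formal m z = ∑ (matchings m) (λ σ → z σ ⊙ simp σ)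

  matchings-sound : ∀ {m σ} → σ ∈ matchings m → Matching m σ
  matchings-sound {m} i = matching⁺ (proj₂ (∈-filter⁻ (matching? m) {xs = tuples m} i))

  formal-In : ∀ m z → In V m (formal m z)
  formal-In m z = go (matchings m) (matchings-sound {m})
    where
    go : ∀ l → (∀ {σ} → σ ∈ l → Matching m σ) → In V m (∑ l (λ σ → z σ ⊙ simp σ))
    go [] h = in𝟎
    go (σ ∷ l) h = in⊕ (in⊙ (z σ) (simp-V (h (here refl)))) (go l (h ∘ there))

  eval-∑ : ∀ {A : Set} (l : List A) (f : A → Ch) τ → eval (∑ l f) τ ≡ sumℤ (map (λ x → eval (f x) τ) l)
  eval-∑ [] f τ = eval-𝟎 τ
  eval-∑ (x ∷ l) f τ = trans (eval-⊕ (f x) (∑ l f) τ) (cong (λ ○ → eval (f x) τ ℤ.+ ○) (eval-∑ l f τ))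

  eval-formal : ∀ {m τ} z → Matching m τ → eval (formal m z) τ ≡ z τ
  eval-formal {m} {τ} z M = trans (eval-∑ (matchings m) _ τ) (trans
    (sum-delta _ (UP.filter⁺ (matching? m) (tuples-unique m)) (∈-filter⁺ (matching? m) (tuples-∈ m (len M)) (matching⁻ M))
      λ {σ} i ne → trans (eval-⊙ (z σ) (simp σ) τ) (trans (cong (z σ ℤ.*_) (eval-simp-other σ τ (matchings-sound {m} i) M ne)) (ℤₚ.*-zeroʳ (z σ))))
    (trans (eval-⊙ (z τ) (simp τ) τ) (trans (cong (z τ ℤ.*_) (eval-simp-same τ M)) (ℤₚ.*-identityʳ (z τ)))))

  ∂-local : ∀ {m σ} {c c' : Chain n} → Matching m σ → (∀ {τ} → Matching (suc m) τ → c τ ≡ c' τ) → ∂ c σ ≡ ∂ c' σ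
  ∂-local {σ = σ} {c} {c'} M h = cong sumℤ (map-cong term (allEdges n))
    where
    term : ∀ e → (if addable e σ then sgn (pos e σ) ℤ.* c (ins e σ) else 0ℤ) ≡ (if addable e σ then sgn (pos e σ) ℤ.* c' (ins e σ) else 0ℤ)
    term e with low e <ᵇ high e in eq
    ... | false = refl
    ... | true with meets e σ
    ...   | disj d k rewrite k = cong (sgn (pos e σ) ℤ.*_) (h (matching-ins (<ᵇ-true (low e) (high e) eq) d M))
    ...   | meet _ _ k rewrite k = refl

  Represents : ℕ → Ch → Chain n → Set
  Represents m a z = ∀ {σ} → Matching m σ → z σ ≡ eval a σ

  ∂-represents : ∀ {m a z} → In V (suc m) a → Represents (suc m) a z → Represents m (∂ₑ a) (∂ z)
  ∂-represents {a = a} i r M = trans (∂-local M (λ N → r N)) (eval-∂ i M)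

  same-chain : ∀ {m a b z} → In V m a → In V m b → Represents m a z → Represents m b z → a ≈ b
  same-chain {m} {a} {b} {z} i j r s = ≈-trans (≈-sym (⊕-undo a b)) (≈-trans (⊕-cong (detect m (in⊕ i (in⊙ -1ℤ j)) zero!) ≈-refl) ⊕-idˡ)
    where
    zero! : ∀ {σ} → Matching m σ → eval (a ⊕ ⊖ b) σ ≡ 0ℤ
    zero! {σ} M = trans (eval-⊕ a (⊖ b) σ) (trans (cong₂ ℤ._+_ (sym (r M)) (trans (eval-⊙ -1ℤ b σ) (trans (cong (-1ℤ ℤ.*_) (sym (s M))) (ℤₚ.-1*i≡-i (z σ))))) (ℤₚ.+-inverseʳ (z σ)))

  boundary⁺ : ∀ {m a z} → Represents m a z → Bounds V m a → IsBoundary n m z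
  boundary⁺ {m} {a} r (h , i , e) = eval h , λ σ IM → let M = matching⁺ IM in trans (eval-∂ i M) (trans (eval-cong e σ) (sym (r M)))

  boundary⁻ : ∀ {m a z} → In V m a → Represents m a z → IsBoundary n m z → Bounds V m a
  boundary⁻ {m} {a} {z} i r (c , h) = formal (suc m) c , j , same-chain (∂-In j) i
      (λ M → trans (sym (h _ (matching⁻ M))) (∂-represents j (λ N → sym (eval-formal c N)) M)) r
    where j = formal-In (suc m) c

  cycle⁺ : ∀ {m a z} → In V (suc m) a → Represents (suc m) a z → ∂ₑ a ≈ 𝟎 → IsCycle n (suc m) z
  cycle⁺ i r e σ IM = trans (∂-represents i r (matching⁺ IM)) (eval-≈𝟎 e σ)

  cycle⁻ : ∀ {m a z} → In V (suc m) a → Represents (suc m) a z → IsCycle n (suc m) z → ∂ₑ a ≈ 𝟎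
  cycle⁻ {m} i r c = detect m (∂-In i) λ M → trans (sym (∂-represents i r M)) (c _ (matching⁻ M))

  five-represents : ∀ {m a z} → Represents m a z → Represents m (+ 5 ⊙ a) (λ σ → + 5 ℤ.* z σ)
  five-represents {a = a} r {σ} M = trans (cong (+ 5 ℤ.*_) (r M)) (sym (eval-⊙ (+ 5) a σ))

  order5⁺ : ∀ {m a z} → Represents (suc m) a z → Order5 V (suc m) a → HasOrder5Class n (suc m) z
  order5⁺ r o = cycle⁺ (O.cycle .isIn) r (O.cycle .isCycle) , O.non-bounding ∘ boundary⁻ (O.cycle .isIn) r , boundary⁺ (five-represents r) O.bounding
    where module O = Order5 o

  order5⁻ : ∀ {m z} → HasOrder5Class n (suc m) z → Order5 V (suc m) (formal (suc m) z)
  order5⁻ {m} {z} (c , nb , b) = record { cycle = i , cycle⁻ i r c ; non-bounding = nb ∘ boundary⁺ r ; bounding = boundary⁻ (in⊙ (+ 5) i) (five-represents r) b }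
    where
    i = formal-In (suc m) z
    r : Represents (suc m) (formal (suc m) z) z
    r M = sym (eval-formal z M)

-- Wedge products of cycles in blocks

update : ∀ {A : Set} {s} → (Fin s → A) → Fin s → A → Fin s → A
update z zero x zero = x
update z zero x (suc k) = z (suc k)
update z (suc i) x zero = z zero
update z (suc i) x (suc k) = update (z ∘ suc) i x k

update-same : ∀ {A : Set} {s} (z : Fin s → A) i x → update z i x i ≡ x
update-same z zero x = refl
update-same z (suc i) x = update-same (z ∘ suc) i x

update-other : ∀ {A : Set} {s} (z : Fin s → A) {i k} x → k ≢ i → update z i x k ≡ z k
update-other z {zero} {zero} x n = contradiction refl n
update-other z {zero} {suc k} x n = refl
update-other z {suc i} {zero} x n = refl
update-other z {suc i} {suc k} x n = update-other (z ∘ suc) x (n ∘ cong suc)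

⋀⋀ : ∀ {s} → (Fin s → Ch) → Ch
⋀⋀ {zero} z = vac
⋀⋀ {suc s} z = z zero ⋀ ⋀⋀ (z ∘ suc)

-- The number of edges in the factors ahead of block `i`, hence the sign exponent of a contraction
-- that passes them.
before : ∀ {s} → (Fin s → ℕ) → Fin s → ℕ
before d zero = 0
before d (suc i) = d zero + before (d ∘ suc) i

before-cong : ∀ {s} {d d' : Fin s → ℕ} → (∀ k → d k ≡ d' k) → ∀ i → before d i ≡ before d' i
before-cong h zero = refl
before-cong h (suc i) = cong₂ _+_ (h zero) (before-cong (h ∘ suc) i)

before-+ : ∀ {s} (d d' : Fin s → ℕ) i → before (λ k → d k + d' k) i ≡ before d i + before d' i
before-+ d d' zero = refl
before-+ d d' (suc i) = trans (cong (d zero + d' zero ℕ.+_) (before-+ (d ∘ suc) (d' ∘ suc) i)) (inter (d zero) (d' zero) (before (d ∘ suc) i) _)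
  where
  inter : ∀ a b c e → a + b + (c + e) ≡ a + c + (b + e)
  inter a b c e = trans (ℕₚ.+-assoc a b _) (trans (cong (a ℕ.+_) (trans (sym (ℕₚ.+-assoc b c e)) (trans (cong (ℕ._+ e) (ℕₚ.+-comm b c)) (ℕₚ.+-assoc c b e)))) (sym (ℕₚ.+-assoc a c _)))

bump : ∀ {s} → Fin s → Fin s → ℕ
bump j k = if eqᵇ j k then 1 else 0

before-zero : ∀ {s} (i : Fin s) → before {s} (λ _ → 0) i ≡ 0
before-zero zero = refl
before-zero (suc i) = before-zero i

before-bump : ∀ {s} (j i : Fin s) → before (bump j) i ≡ (if toℕ j <ᵇ toℕ i then 1 else 0)
before-bump zero zero = refl
before-bump (suc j) zero = refl
before-bump zero (suc i) = cong suc (before-zero i)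
before-bump (suc j) (suc i) = before-bump j i

⋀⋀-link-𝟎 : ∀ {s p e} (z : Fin s → Ch) (d : Fin s → ℕ) (P : Fin s → ℕ → Set) → (∀ k → In (P k) (d k) (z k)) → (∀ k → L p e (z k) ≈ 𝟎) → L p e (⋀⋀ z) ≈ 𝟎
⋀⋀-link-𝟎 {zero} z d P i h = ≈-refl
⋀⋀-link-𝟎 {suc s} z d P i h = ≈-trans (D-⋀ (lnk-flip _) (⋀⋀ (z ∘ suc)) (i zero)) (⊕-𝟎 (⋀-congˡ _ (h zero))
  (⊙-𝟎 (≈-trans (⋀-congʳ (z zero) (⋀⋀-link-𝟎 (z ∘ suc) (d ∘ suc) (P ∘ suc) (i ∘ suc) (h ∘ suc))) (⋀-𝟎 (z zero)))))

⋀⋀-link : ∀ {s p e} (z : Fin s → Ch) (d : Fin s → ℕ) (P : Fin s → ℕ → Set) → (∀ k → In (P k) (d k) (z k)) → ∀ i → (∀ k → k ≢ i → L p e (z k) ≈ 𝟎) →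
          L p e (⋀⋀ z) ≈ sgn (before d i) ⊙ ⋀⋀ (update z i (L p e (z i)))
⋀⋀-link {p = p} {e} z d P ins zero h = ≈-trans (D-⋀ (lnk-flip _) (⋀⋀ (z ∘ suc)) (ins zero)) (≈-trans
  (⊕-elimʳ (⊙-𝟎 (≈-trans (⋀-congʳ (z zero) (⋀⋀-link-𝟎 (z ∘ suc) (d ∘ suc) (P ∘ suc) (ins ∘ suc) λ k → h (suc k) λ ())) (⋀-𝟎 (z zero)))))
  (≈-sym (⊙-idˡ _)))
⋀⋀-link {p = p} {e} z d P ins (suc i) h = ≈-trans (D-⋀ (lnk-flip _) (⋀⋀ (z ∘ suc)) (ins zero)) (≈-trans
  (⊕-elimˡ (⋀-congˡ _ (h zero λ ())))
  (≈-trans (⊙-cong _ (≈-trans (⋀-congʳ (z zero) (⋀⋀-link (z ∘ suc) (d ∘ suc) (P ∘ suc) (ins ∘ suc) i λ k n → h (suc k) (n ∘ Fₚ.suc-injective))) (⋀-⊙ʳ (z zero) _ _)))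
    (≈-trans (⊙-assoc _ _ _) (≡⇒≈ (cong (_⊙ ⋀⋀ (update z (suc i) (L p e (z (suc i))))) (sym (sgn-+ (d zero) (before (d ∘ suc) i))))))))

unit-++ : ∀ σ τ → unit (σ ++ τ) ≡ unit σ ℤ.* unit τ
unit-++ [] τ = sym (ℤₚ.*-identityˡ _)
unit-++ (_ ∷ σ) τ = refl

unit-⋀ : ∀ a b → ⟨ a ⋀ b ∣ unit ⟩ ≡ ⟨ a ∣ unit ⟩ ℤ.* ⟨ b ∣ unit ⟩
unit-⋀ a b = trans (⋀-adj a b unit) (trans (pair-ext a λ σ → trans (pair-ext b (unit-++ σ)) (trans (pair-scal b (unit σ)) (ℤₚ.*-comm (unit σ) _)))
  (trans (pair-scal a ⟨ b ∣ unit ⟩) (ℤₚ.*-comm ⟨ b ∣ unit ⟩ _)))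

unit-deg : ∀ {P d a} → In P (suc d) a → ⟨ a ∣ unit ⟩ ≡ 0ℤ
unit-deg in𝟎 = refl
unit-deg (in▷ {x} {y} {a = a} _ _ _ _) = trans (pair-ext a {φ = unit ∘ ((x , y) ∷_)} {ψ = λ _ → 0ℤ ℤ.* 0ℤ} λ _ → refl) (trans (pair-scal a 0ℤ {λ _ → 0ℤ}) (ℤₚ.*-zeroˡ ⟨ a ∣ (λ _ → 0ℤ) ⟩))
unit-deg (in⊕ i j) = cong₂ ℤ._+_ (unit-deg i) (unit-deg j)
unit-deg (in⊙ k i) = trans (cong (k ℤ.*_) (unit-deg i)) (ℤₚ.*-zeroʳ k)
unit-deg (in≈ e i) = trans (sym (e .at unit Alt-unit)) (unit-deg i)

all-tabulate : ∀ {s} {A : Set} (p : A → Bool) (g : Fin s → A) → allᵇ p (Data.List.tabulate g) ≡ true → ∀ i → p (g i) ≡ true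
all-tabulate p g h zero = proj₁ (∧-true {p (g zero)} h)
all-tabulate p g h (suc i) = all-tabulate p (g ∘ suc) (proj₂ (∧-true {p (g zero)} h)) i

allᵇ-cong : ∀ {A : Set} {p p' : A → Bool} l → (∀ x → p x ≡ p' x) → allᵇ p l ≡ allᵇ p' l
allᵇ-cong [] h = refl
allᵇ-cong (x ∷ l) h = cong₂ _∧_ (h x) (allᵇ-cong l h)

allᵇ-no : ∀ {A : Set} {p : A → Bool} {l x} → x ∈ l → p x ≡ false → allᵇ p l ≡ false
allᵇ-no {p = p} {y ∷ l} (here refl) h rewrite h = refl
allᵇ-no {p = p} {y ∷ l} (there i) h = trans (cong (p y ∧_) (allᵇ-no i h)) (𝔹ₚ.∧-zeroʳ (p y))

prod-suc : ∀ {s} (g : Fin (suc s) → ℤ) → prodℤ (map g (allFin (suc s))) ≡ g zero ℤ.* prodℤ (map (g ∘ suc) (allFin s))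
prod-suc g = cong (λ l → g zero ℤ.* prodℤ l) (trans (Lₚ.map-tabulate suc g) (sym (Lₚ.map-tabulate id (g ∘ suc))))

unit-⋀⋀ : ∀ {s} (z : Fin s → Ch) → ⟨ ⋀⋀ z ∣ unit ⟩ ≡ prodℤ (map (λ i → ⟨ z i ∣ unit ⟩) (allFin s))
unit-⋀⋀ {zero} z = refl
unit-⋀⋀ {suc s} z = trans (unit-⋀ (z zero) _) (trans (cong (⟨ z zero ∣ unit ⟩ ℤ.*_) (unit-⋀⋀ (z ∘ suc))) (sym (prod-suc (λ i → ⟨ z i ∣ unit ⟩))))

prod-zero : ∀ {A : Set} {l : List A} {x} (g : A → ℤ) → x ∈ l → g x ≡ 0ℤ → prodℤ (map g l) ≡ 0ℤ
prod-zero {l = y ∷ l} g (here refl) h = trans (cong (ℤ._* prodℤ (map g l)) h) (ℤₚ.*-zeroˡ (prodℤ (map g l)))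
prod-zero {l = y ∷ l} g (there i) h = trans (cong (g y ℤ.*_) (prod-zero g i h)) (ℤₚ.*-zeroʳ (g y))

all-or-not : ∀ {A : Set} (p : A → Bool) l → allᵇ p l ≡ true ⊎ (Σ A λ x → x ∈ l × p x ≡ false)
all-or-not p [] = inj₁ refl
all-or-not p (x ∷ l) with p x in eq
... | false = inj₂ (x , here refl , eq)
... | true with all-or-not p l
...   | inj₁ h = inj₁ h
...   | inj₂ (y , i , h) = inj₂ (y , there i , h)

module Wedge {n s : ℕ} (f : Fin n → Fin s) where
  open Eval n

  Block : Fin s → ℕ → Set
  Block i v = Σ (Fin n) λ x → toℕ x ≡ v × f x ≡ i

  block-of : ∀ {i x} → Block i (toℕ x) → f x ≡ i
  block-of (y , q , h) with Fₚ.toℕ-injective q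
  ... | refl = h

  monoᵇ : List (Edge n) → Bool
  monoᵇ = allᵇ (λ e → eqᵇ (f (proj₁ e)) (f (proj₂ e)))

  lengthsᵇ : (Fin s → ℕ) → List (Edge n) → Bool
  lengthsᵇ d σ = allᵇ (λ i → length (restrict f i σ) ≡ᵇ d i) (allFin s)

  inv : List (Edge n) → ℕ
  inv σ = inversions (map (λ e → toℕ (f (proj₁ e))) σ)

  prodOf : (Fin s → Chain n) → List (Edge n) → ℤ
  prodOf zs σ = prodℤ (map (λ i → zs i (restrict f i σ)) (allFin s))

  wedgeOf : (Fin s → ℕ) → (Fin s → Chain n) → Chain n
  wedgeOf d zs σ = if monoᵇ σ ∧ lengthsᵇ d σ then sgn (inv σ) ℤ.* prodOf zs σ else 0ℤ

  restrict-hit : ∀ {i e} σ → f (proj₁ e) ≡ i → f (proj₂ e) ≡ i → restrict f i (e ∷ σ) ≡ e ∷ restrict f i σ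
  restrict-hit {e = e} σ refl q rewrite q | eqᵇ-yes (f (proj₁ e)) = refl

  restrict-miss : ∀ {i e} σ → f (proj₁ e) ≢ i → restrict f i (e ∷ σ) ≡ restrict f i σ
  restrict-miss σ n rewrite eqᵇ-no n = refl

  restrict-length : ∀ e σ k → f (proj₁ e) ≡ f (proj₂ e) → length (restrict f k (e ∷ σ)) ≡ bump (f (proj₁ e)) k + length (restrict f k σ)
  restrict-length e σ k q = go (f (proj₁ e) Fₚ.≟ k)
    where
    go : Dec (f (proj₁ e) ≡ k) → length (restrict f k (e ∷ σ)) ≡ bump (f (proj₁ e)) k + length (restrict f k σ)
    go (yes p) = trans (cong length (restrict-hit {k} {e} σ p (trans (sym q) p))) (cong (λ b → (if b then 1 else 0) + length (restrict f k σ)) (sym (trans (cong (λ x → eqᵇ x k) p) (eqᵇ-yes k))))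
    go (no n) = trans (cong length (restrict-miss {k} {e} σ n)) (cong (λ b → (if b then 1 else 0) + length (restrict f k σ)) (sym (eqᵇ-no n)))

  count-∷ : ∀ (p : ℕ → Bool) x l → countᵇ p (x ∷ l) ≡ (if p x then 1 else 0) + countᵇ p l
  count-∷ p x l with p x
  ... | true = refl
  ... | false = refl

  count-before : ∀ i τ → monoᵇ τ ≡ true → countᵇ (λ y → y <ᵇ toℕ i) (map (λ e → toℕ (f (proj₁ e))) τ) ≡ before (λ k → length (restrict f k τ)) i
  count-before i [] h = sym (before-zero i)
  count-before i (e ∷ τ) h = trans (count-∷ (λ y → y <ᵇ toℕ i) (toℕ (f (proj₁ e))) _) (trans
      (cong₂ _+_ (sym (before-bump (f (proj₁ e)) i)) (count-before i τ (proj₂ (∧-true {eqᵇ (f (proj₁ e)) (f (proj₂ e))} h))))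
      (trans (sym (before-+ (bump (f (proj₁ e))) _ i)) (sym (before-cong (λ k → restrict-length e τ k (mono-head (proj₁ (∧-true {eqᵇ (f (proj₁ e)) (f (proj₂ e))} h)))) i))))
    where
    mono-head : ∀ {x y : Fin s} → eqᵇ x y ≡ true → x ≡ y
    mono-head {x} {y} h with x Fₚ.≟ y
    ... | yes q = q

  not-here : ∀ {i k} {e : Edge n} → f (proj₁ e) ≡ i → k ≢ i → ¬ Block k (low e)
  not-here q n b = n (trans (sym (block-of b)) q)

  -- Induction on `σ`. Contraction with the first edge affects only the factor of its block, after
  -- passing `before d j` edges. When the lengths match, this is the number of later edges in
  -- earlier blocks, which are exactly the inversions that the first edge causes.
  eval-wedge : ∀ σ (z : Fin s → Ch) (d : Fin s → ℕ) → (∀ i → In (Block i) (d i) (z i)) → eval (⋀⋀ z) σ ≡ wedgeOf d (λ i → eval (z i)) σ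
  eval-wedge [] z d ins with all-or-not (λ i → 0 ≡ᵇ d i) (allFin s)
  ... | inj₁ h rewrite h = trans (unit-⋀⋀ z) (sym (ℤₚ.*-identityˡ _))
  ... | inj₂ (i , i∈ , h) rewrite allᵇ-no {p = λ i → 0 ≡ᵇ d i} i∈ h = trans (unit-⋀⋀ z) (prod-zero (λ i → ⟨ z i ∣ unit ⟩) i∈ (positive (d i) h (ins i)))
    where
    positive : ∀ m → (0 ≡ᵇ m) ≡ false → In (Block i) m (z i) → ⟨ z i ∣ unit ⟩ ≡ 0ℤ
    positive (suc m) _ j = unit-deg j
  eval-wedge (e ∷ σ) z d ins = mixed-or-not (j Fₚ.≟ f (proj₂ e))
    where
    j = f (proj₁ e)
    Goal = eval (⋀⋀ z) (e ∷ σ) ≡ wedgeOf d (λ i → eval (z i)) (e ∷ σ)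
    value = sgn (inv (e ∷ σ)) ℤ.* prodOf (λ i → eval (z i)) (e ∷ σ)
    mixed : j ≢ f (proj₂ e) → Goal
    mixed n = trans (eval-≈𝟎 (⋀⋀-link-𝟎 z d Block ins λ k → off k (j Fₚ.≟ k)) σ)
      (sym (cong (λ b → if (b ∧ monoᵇ σ) ∧ lengthsᵇ d (e ∷ σ) then value else 0ℤ) (eqᵇ-no n)))
      where
      off : ∀ k → Dec (j ≡ k) → L (low e) (high e) (z k) ≈ 𝟎
      off k (yes p) = L-outʳ (λ b → n (trans p (sym (block-of b)))) (ins k)
      off k (no m) = L-out (λ b → m (block-of b)) (ins k)
    empty-block : j ≡ f (proj₂ e) → d j ≡ 0 → Goal
    empty-block q deq = trans (eval-≈𝟎 (⋀⋀-link-𝟎 z d Block ins λ k → off k (k Fₚ.≟ j)) σ) (sym (trans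
      (cong (λ b → if monoᵇ (e ∷ σ) ∧ b then value else 0ℤ) (allᵇ-no {p = λ i → length (restrict f i (e ∷ σ)) ≡ᵇ d i} (∈-allFin j) bad))
      (cong (λ b → if b then value else 0ℤ) (𝔹ₚ.∧-zeroʳ (monoᵇ (e ∷ σ))))))
      where
      off : ∀ k → Dec (k ≡ j) → L (low e) (high e) (z k) ≈ 𝟎
      off k (yes refl) = L₀ (subst (λ m → In (Block k) m (z k)) deq (ins k))
      off k (no m) = L-out (not-here {j} {k} {e} refl m) (ins k)
      bad : (length (restrict f j (e ∷ σ)) ≡ᵇ d j) ≡ false
      bad = trans (cong₂ _≡ᵇ_ (cong length (restrict-hit {j} {e} σ refl (sym q))) deq) refl
    link-block : j ≡ f (proj₂ e) → ∀ m → d j ≡ suc m → Goal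
    link-block q m deq = trans (eval-cong (⋀⋀-link z d Block ins j λ k ne → L-out (not-here {j} {k} {e} refl ne) (ins k)) σ)
      (trans (eval-⊙ (sgn (before d j)) (⋀⋀ z') σ) (trans (cong (sgn (before d j) ℤ.*_) (eval-wedge σ z' d' λ k → ins' k (k Fₚ.≟ j))) final))
      where
      link = L (low e) (high e) (z j)
      z' = update z j link
      d' = update d j m
      ins' : ∀ k → Dec (k ≡ j) → In (Block k) (d' k) (z' k)
      ins' k (yes refl) = subst (In (Block k) (d' k)) (sym (update-same z k link)) (subst (λ r → In (Block k) r link) (sym (update-same d k m))
            (In-mono (proj₁ ∘ proj₁) (In-L (low e) (high e) (subst (λ r → In (Block k) r (z k)) deq (ins k)))))
      ins' k (no ne) = subst (In (Block k) (d' k)) (sym (update-other z link ne)) (subst (λ r → In (Block k) r (z k)) (sym (update-other d m ne)) (ins k))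
      lengths : ∀ k → Dec (k ≡ j) → (length (restrict f k (e ∷ σ)) ≡ᵇ d k) ≡ (length (restrict f k σ) ≡ᵇ d' k)
      lengths k (yes refl) = trans (cong₂ _≡ᵇ_ (cong length (restrict-hit {k} {e} σ refl (sym q))) deq) (cong (length (restrict f k σ) ≡ᵇ_) (sym (update-same d k m)))
      lengths k (no ne) = cong₂ _≡ᵇ_ (cong length (restrict-miss {k} {e} σ (≢-sym ne))) (sym (update-other d m ne))
      factors : ∀ k → Dec (k ≡ j) → eval (z k) (restrict f k (e ∷ σ)) ≡ eval (z' k) (restrict f k σ)
      factors k (yes refl) = trans (cong (eval (z k)) (restrict-hit {k} {e} σ refl (sym q))) (cong (λ a → eval a (restrict f k σ)) (sym (update-same z k link)))
      factors k (no ne) = trans (cong (eval (z k)) (restrict-miss {k} {e} σ (≢-sym ne))) (cong (λ a → eval a (restrict f k σ)) (sym (update-other z link ne)))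
      prods : prodOf (λ i → eval (z i)) (e ∷ σ) ≡ prodOf (λ i → eval (z' i)) σ
      prods = cong prodℤ (map-cong (λ k → factors k (k Fₚ.≟ j)) (allFin s))
      cond : monoᵇ (e ∷ σ) ∧ lengthsᵇ d (e ∷ σ) ≡ monoᵇ σ ∧ lengthsᵇ d' σ
      cond = cong₂ _∧_ (cong (_∧ monoᵇ σ) (trans (cong (eqᵇ j) (sym q)) (eqᵇ-yes j))) (allᵇ-cong (allFin s) λ k → lengths k (k Fₚ.≟ j))
      value' = sgn (inv σ) ℤ.* prodOf (λ i → eval (z' i)) σ
      scale : ∀ b → (b ≡ true → sgn (before d j) ℤ.* value' ≡ value) → sgn (before d j) ℤ.* (if b then value' else 0ℤ) ≡ (if b then value else 0ℤ)
      scale false h = ℤₚ.*-zeroʳ (sgn (before d j))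
      scale true h = h refl
      before-update : ∀ {s} (d : Fin s → ℕ) j m → before (update d j m) j ≡ before d j
      before-update d zero m = refl
      before-update d (suc j) m = cong (d zero ℕ.+_) (before-update (d ∘ suc) j m)
      same-value : monoᵇ σ ∧ lengthsᵇ d' σ ≡ true → sgn (before d j) ℤ.* value' ≡ value
      same-value h = trans (sym (ℤₚ.*-assoc (sgn (before d j)) (sgn (inv σ)) _)) (cong₂ ℤ._*_ (trans (sym (sgn-+ (before d j) (inv σ))) (cong (λ k → sgn (k + inv σ)) (sym counts))) (sym prods))
        where
        same-lengths : ∀ k → length (restrict f k σ) ≡ d' k
        same-lengths k = ≡ᵇ-sound (length (restrict f k σ)) (d' k) (all-tabulate (λ i → length (restrict f i σ) ≡ᵇ d' i) id (proj₂ (∧-true {monoᵇ σ} h)) k)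
        counts : countᵇ (λ y → y <ᵇ toℕ j) (map (λ e → toℕ (f (proj₁ e))) σ) ≡ before d j
        counts = trans (count-before j σ (proj₁ (∧-true {monoᵇ σ} h))) (trans (before-cong same-lengths j) (before-update d j m))
      final : sgn (before d j) ℤ.* wedgeOf d' (λ i → eval (z' i)) σ ≡ wedgeOf d (λ i → eval (z i)) (e ∷ σ)
      final = trans (scale (monoᵇ σ ∧ lengthsᵇ d' σ) same-value) (cong (λ b → if b then value else 0ℤ) (sym cond))
    full-or-empty : j ≡ f (proj₂ e) → ∀ m → d j ≡ m → Goal
    full-or-empty q zero = empty-block q
    full-or-empty q (suc m) = link-block q m
    mixed-or-not : Dec (j ≡ f (proj₂ e)) → Goal
    mixed-or-not (no n) = mixed n
    mixed-or-not (yes q) = full-or-empty q (d j) refl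

  supported : ∀ {i d z} → In (Block i) d z → SupportedIn f i d (eval z)
  supported {i} {d} {z} j τ M n with all-or-not (inBlock f i) τ
  ... | inj₁ h = contradiction (All.tabulate (all-∈ {P = inBlock f i} τ h)) n
  ... | inj₂ (e , e∈ , h) = eval-out τ j e∈ (side (f (proj₁ e) Fₚ.≟ i) (f (proj₂ e) Fₚ.≟ i))
    where
    side : Dec (f (proj₁ e) ≡ i) → Dec (f (proj₂ e) ≡ i) → ¬ Block i (low e) ⊎ ¬ Block i (high e)
    side (no m) _ = inj₁ (m ∘ block-of)
    side (yes _) (no m) = inj₂ (m ∘ block-of)
    side (yes p) (yes q) = case trans (sym h) (cong₂ _∧_ (trans (cong (λ x → eqᵇ x i) p) (eqᵇ-yes i)) (trans (cong (λ x → eqᵇ x i) q) (eqᵇ-yes i))) of λ ()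

-- The standard cycle as a cycle of the required type

fives : ℕ → CycleType
fives q = Data.List.replicate q (5 , 2)

pent-block : ∀ q → Fin (quin q) → Fin (length (fives q))
pent-block (suc q) zero = zero
pent-block (suc q) (suc zero) = zero
pent-block (suc q) (suc (suc zero)) = zero
pent-block (suc q) (suc (suc (suc zero))) = zero
pent-block (suc q) (suc (suc (suc (suc zero)))) = zero
pent-block (suc q) (suc (suc (suc (suc (suc x))))) = suc (pent-block q x)

block : ∀ q → Fin (4 + quin q) → Fin (length (type5 q))
block q zero = zero
block q (suc zero) = suc zero
block q (suc (suc zero)) = suc zero
block q (suc (suc (suc zero))) = suc zero
block q (suc (suc (suc (suc x)))) = suc (suc (pent-block q x))

pent-factor : ∀ q → ℕ → Fin (length (fives q)) → Ch
pent-factor (suc q) k zero = pent k (1 + k) (2 + k) (3 + k) (4 + k)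
pent-factor (suc q) k (suc i) = pent-factor q (5 + k) i

-- The scalar, a power of 6 in the application, is placed in the factor [1,0]; thus a multiple of
-- `γ₀` is again a wedge product of the same type.
factor : ∀ q → ℤ → Fin (length (type5 q)) → Ch
factor q c zero = c ⊙ vac
factor q c (suc zero) = tri 1 2 3
factor q c (suc (suc i)) = pent-factor q 4 i

degree : ∀ (ty : CycleType) → Fin (length ty) → ℕ
degree ty i = proj₂ (Data.List.lookup ty i)

pent-factor-⋀⋀ : ∀ q k → ⋀⋀ (pent-factor q k) ≡ pents (seq k (quin q))
pent-factor-⋀⋀ zero k = refl
pent-factor-⋀⋀ (suc q) k = cong (pent k (1 + k) (2 + k) (3 + k) (4 + k) ⋀_) (pent-factor-⋀⋀ q (5 + k))

factor-⋀⋀ : ∀ q c → ⋀⋀ (factor q c) ≡ c ⊙ γ₀ q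
factor-⋀⋀ q c = cong (λ w → c ⊙ (tri 1 2 3 ⋀ w)) (pent-factor-⋀⋀ q 4)

PentBlock : ∀ q → ℕ → Fin (length (fives q)) → ℕ → Set
PentBlock q k i v = Σ (Fin (quin q)) λ x → k + toℕ x ≡ v × pent-block q x ≡ i

pent-factor-cyc : ∀ q k i → Cyc (PentBlock q k i) (degree (fives q) i) (pent-factor q k i)
pent-factor-cyc (suc q) k zero = Cyc-mono
  (λ { (here refl) → zero , ℕₚ.+-identityʳ k , refl
     ; (there (here refl)) → suc zero , ℕₚ.+-comm k 1 , refl
     ; (there (there (here refl))) → suc (suc zero) , ℕₚ.+-comm k 2 , refl
     ; (there (there (there (here refl)))) → suc (suc (suc zero)) , ℕₚ.+-comm k 3 , refl
     ; (there (there (there (there (here refl))))) → suc (suc (suc (suc zero))) , ℕₚ.+-comm k 4 , refl })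
  (pent-cyc (seq-unique k 5))
pent-factor-cyc (suc q) k (suc i) = Cyc-mono
  (λ (x , p , h) → suc (suc (suc (suc (suc x)))) , trans (trans (sym (ℕₚ.+-assoc k 5 (toℕ x))) (cong (ℕ._+ toℕ x) (ℕₚ.+-comm k 5))) p , cong suc h)
  (pent-factor-cyc q (5 + k) i)

factor-cyc : ∀ q c i → Cyc (Wedge.Block (block q) i) (degree (type5 q) i) (factor q c i)
factor-cyc q c zero = in⊙ c invac , ⊙-zeroʳ c
factor-cyc q c (suc zero) = Cyc-mono
  (λ { (here refl) → suc zero , refl , refl ; (there (here refl)) → suc (suc zero) , refl , refl ; (there (there (here refl))) → suc (suc (suc zero)) , refl , refl })
  (tri-cyc (uniqueᵇ-sound (1 ∷ 2 ∷ 3 ∷ []) refl))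
factor-cyc q c (suc (suc i)) = Cyc-mono (λ (x , p , h) → suc (suc (suc (suc x))) , p , cong (λ j → suc (suc j)) h) (pent-factor-cyc q 4 i)

countF : ∀ {m} → (Fin m → Bool) → ℕ
countF {zero} p = 0
countF {suc m} p = (if p zero then 1 else 0) + countF (p ∘ suc)

count-tabulate : ∀ {m} {A : Set} (p : A → Bool) (g : Fin m → A) → countᵇ p (Data.List.tabulate g) ≡ countF (p ∘ g)
count-tabulate {zero} p g = refl
count-tabulate {suc m} p g with p (g zero)
... | true = cong suc (count-tabulate p (g ∘ suc))
... | false = count-tabulate p (g ∘ suc)

countF-none : ∀ m → countF {m} (λ _ → false) ≡ 0
countF-none zero = refl
countF-none (suc m) = countF-none m

pent-block-size : ∀ q i → countF (λ x → eqᵇ (pent-block q x) i) ≡ proj₁ (Data.List.lookup (fives q) i)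
pent-block-size (suc q) zero = cong (5 ℕ.+_) (countF-none (quin q))
pent-block-size (suc q) (suc i) = pent-block-size q i

block-size : ∀ q i → blockSize (block q) i ≡ proj₁ (Data.List.lookup (type5 q) i)
block-size q i = trans (count-tabulate (λ x → eqᵇ (block q x) i) id) (sizes i)
  where
  sizes : ∀ i → countF (λ x → eqᵇ (block q x) i) ≡ proj₁ (Data.List.lookup (type5 q) i)
  sizes zero = cong (1 ℕ.+_) (countF-none (quin q))
  sizes (suc zero) = cong (3 ℕ.+_) (countF-none (quin q))
  sizes (suc (suc i)) = pent-block-size q i

degree-sum : ∀ q → sumℕ (map proj₂ (type5 q)) ≡ suc (dbl q)
degree-sum q = cong suc (go q)
  where
  go : ∀ q → sumℕ (map proj₂ (fives q)) ≡ dbl q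
  go zero = refl
  go (suc q) = cong (2 ℕ.+_) (go q)

module Standard (q : ℕ) where
  n = 4 + quin q
  open Eval n
  open Wedge (block q)

  γ : ℤ → Chain n
  γ c = eval (⋀⋀ (factor q c))

  γ-represents : ∀ c → Represents (suc (dbl q)) (c ⊙ γ₀ q) (γ c)
  γ-represents c {σ} M = cong (λ a → eval a σ) (factor-⋀⋀ q c)

  is-cycle : ∀ d {a} → In V d a → ∂ₑ a ≈ 𝟎 → IsCycle n d (eval a)
  is-cycle zero i c = tt
  is-cycle (suc d) i c = cycle⁺ i (λ _ → refl) c

  block-V : ∀ {i v} → Block i v → V v
  block-V (x , refl , _) = Fₚ.toℕ<n x

  γ-type : ∀ c → ∂ₑ (c ⊙ γ₀ q) ≈ 𝟎 → HasType n (suc (dbl q)) (γ c) (type5 q)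
  γ-type c e = cycle⁺ (in⊙ c (γ₀-cyc q .isIn)) (γ-represents c) e , degree-sum q , block q , block-size q , (λ i → eval (factor q c i)) ,
    (λ i → supported (factor-cyc q c i .isIn) , is-cycle (degree (type5 q) i) (In-mono block-V (factor-cyc q c i .isIn)) (factor-cyc q c i .isCycle)) ,
    λ σ _ → eval-wedge σ (factor q c) (degree (type5 q)) (λ i → factor-cyc q c i .isIn)

standard-generator : ∀ q {n m} → n ≡ 4 + quin (2 + q) → m ≡ suc (dbl (2 + q)) → {z : Chain n} → HasOrder5Class n m z →
                     Σ (Chain n) λ γ → HasType n m γ (type5 (2 + q)) × HasOrder5Class n m γ
standard-generator q refl refl o = let k , o′ = γ₀-order5 q (order5⁻ o) in
  γ (pow k) , γ-type (pow k) (Order5.cycle o′ .isCycle) , order5⁺ (γ-represents (pow k)) o′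
  where
  open Standard (2 + q)
  open Eval (4 + quin (2 + q))

persistent : ∀ q u {n m n′ m′} → n ≡ 4 + quin (3 + q) → m ≡ dbl (3 + q) → n′ ≡ 4 + quin (3 + q) + dbl u → suc m′ ≡ Enlarge.W-deg q u →
             HasElemOrder5 n m → HasElemOrder5 n′ m′
persistent q u refl refl refl refl (z , o) = let k , o′ = W-order5 u (Eval.order5⁻ (4 + quin (3 + q)) o) in
  Eval.eval n′ (pow k ⊙ W u) , Eval.order5⁺ n′ (λ _ → refl) o′
  where
  open Enlarge q
  n′ = 4 + quin (3 + q) + dbl u

-- The indices of the theorem

quin-* : ∀ q → 5 * q ≡ quin q
quin-* zero = refl
quin-* (suc q) = trans (ℕₚ.*-suc 5 q) (cong (5 ℕ.+_) (quin-* q))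

dbl-* : ∀ q → 2 * q ≡ dbl q
dbl-* zero = refl
dbl-* (suc q) = trans (ℕₚ.*-suc 2 q) (cong (2 ℕ.+_) (dbl-* q))

vertices-eq : ∀ q → 5 * q + 4 ≡ 4 + quin q
vertices-eq q = trans (ℕₚ.+-comm (5 * q) 4) (cong (4 ℕ.+_) (quin-* q))

theorem5p10 : ∀ (q : ℕ) → 3 ≤ q →
    (HasElemOrder5 (5 * q + 4) (2 * q)
    ⇔ Σ (Chain (5 * q + 4)) (λ γ →
    HasType (5 * q + 4) (2 * q + 1) γ (type5 q)
    × HasOrder5Class (5 * q + 4) (2 * q + 1) γ))
    × (HasElemOrder5 (5 * q + 4) (2 * q) →
    ∀ (u : ℕ) → HasElemOrder5 (5 * q + 4 + 2 * u) (2 * q + u))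
theorem5p10 (suc (suc (suc q))) (s≤s (s≤s (s≤s z≤n))) =
  -- The torsion argument spends two pentagons, so `standard-generator` is indexed by Q - 2; the
  -- enlargement spends a third, so `persistent` is indexed by Q - 3.
  mk⇔ (λ (z , o) → standard-generator (suc q) (vertices-eq Q) (trans edges-eq (cong suc (dbl-* Q))) (subst (λ m → HasOrder5Class N′ m z) (sym edges-eq) o))
      (λ (γ , _ , o) → γ , subst (λ m → HasOrder5Class N′ m γ) edges-eq o) ,
  λ z u → persistent q u (vertices-eq Q) (dbl-* Q) (cong₂ _+_ (vertices-eq Q) (dbl-* u)) (degree-eq u) z
  where
  Q = 3 + q
  N′ = 5 * Q + 4
  edges-eq : 2 * Q + 1 ≡ suc (2 * Q)
  edges-eq = ℕₚ.+-comm (2 * Q) 1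
  degree-eq : ∀ u → suc (2 * Q + u) ≡ Enlarge.W-deg q u
  degree-eq u = trans (cong (λ k → suc (k + u)) (dbl-* Q)) (cong (7 ℕ.+_) (ℕₚ.+-comm (dbl q) u))
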